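{- Let $\alpha,\beta$ be nonincreasing sequences of nonnegative integers with finitely many nonzero terms, and $r=|\alpha|+|\beta|$. For each positive integer $k$ at least the number of nonzero entries of $\alpha$ and of $\beta$, regard $\alpha,\beta$ as $k$-tuples (padding with zeros) and define $$N_k(\alpha;\beta)=\frac{1}{2^{k^2-r}}\left(\prod_{l=0}^{k-1}\frac{l!}{(k+l)!}\right)^{ -1}\sum_{\text{rearrangements }\sigma,\tau\text{ of }\alpha,\beta}\tilde M_k(\sigma(\alpha),\tau(\beta)).$$ Then $N_k(\alpha;\beta)$ is a polynomial in $k$ of degree $\le 2(|\alpha|+|\beta|)$.
   Context: $|\alpha|=\sum_i\alpha_i$. "Rearrangements $\sigma,\tau$" means distinct permutations: $\sigma(\alpha)=(\alpha_{\sigma_1},\dots,\alpha_{\sigma_k})$ ranges over the distinct orderings of the $k$-tuple $\alpha$ (two orderings count once if they give the same tuple), similarly for $\tau(\beta)$. For $k$-tuples of integers $a,b$, $\tilde M_k(a,b)=(-1)^{\sum_i b_i}\det M$ where $M$ is the $2k\times2k$ matrix with entries, for $1\le i\le k$, $1\le j\le 2k$: $M_{i,j}=1/\Gamma(2k-i-j+2-a_i)$ and $M_{k+i,j}=(-1)^{i+j-1}/\Gamma(2k-i-j+2-b_i)$, with the convention $1/\Gamma(m)=0$ for $m\in\{0,-1,-2,\dots\}$. -}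

module Defs where

open import Data.Nat as ℕ using (ℕ; zero; suc; _!; _∸_; _<ᵇ_)
open import Data.Nat.Properties using (_!≢0; m^n≢0)
open import Data.Integer as ℤ using (ℤ; +_; -[1+_])
open import Data.Rational as ℚ using (ℚ; 0ℚ; 1ℚ; _+_; _*_; -_; _/_)
open import Data.Fin using (Fin; toℕ; punchIn; splitAt)
import Data.Fin as F
open import Data.Sum using (inj₁; inj₂)
open import Data.Bool using (if_then_else_)
open import Data.List using (List; []; _∷_; length; replicate; concatMap; deduplicate; foldr; _++_)
open import Data.List.Properties using (≡-dec)

sumℚ : List ℚ → ℚ
sumℚ = foldr _+_ 0ℚ

Σℚ : (n : ℕ) → (Fin n → ℚ) → ℚ
Σℚ zero    f = 0ℚ
Σℚ (suc n) f = f F.zero + Σℚ n (λ i → f (F.suc i))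

Πℚ : (n : ℕ) → (ℕ → ℚ) → ℚ
Πℚ zero    f = 1ℚ
Πℚ (suc n) f = Πℚ n f * f n

sgn : ℕ → ℚ
sgn zero    = 1ℚ
sgn (suc n) = - sgn n

det : (n : ℕ) → (Fin n → Fin n → ℚ) → ℚ
det zero    A = 1ℚ
det (suc n) A =
  Σℚ (suc n) (λ j → sgn (toℕ j) * A F.zero j * det n (λ i' j' → A (F.suc i') (punchIn j j')))

recipΓ : ℤ → ℚ
recipΓ (+ zero)    = 0ℚ
recipΓ (+ suc n)   = _/_ (+ 1) (n !) {{n !≢0}}
recipΓ -[1+ n ]    = 0ℚ

at : List ℕ → ℕ → ℕ
at []       _       = 0
at (x ∷ xs) zero    = x
at (x ∷ xs) (suc i) = at xs i

pad : ℕ → List ℕ → List ℕ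
pad k xs = xs ++ replicate (k ∸ length xs) 0

sumℕ : List ℕ → ℕ
sumℕ = foldr ℕ._+_ 0

insertAll : ℕ → List ℕ → List (List ℕ)
insertAll x []       = (x ∷ []) ∷ []
insertAll x (y ∷ ys) = (x ∷ y ∷ ys) ∷ Data.List.map (y ∷_) (insertAll x ys)

perms : List ℕ → List (List ℕ)
perms []       = [] ∷ []
perms (x ∷ xs) = concatMap (insertAll x) (perms xs)

rearrangements : List ℕ → List (List ℕ)
rearrangements xs = deduplicate (≡-dec ℕ._≟_) (perms xs)

-- the 2k×2k matrix M (0-based indices: with i,j 1-based in the paper,
-- 2k-i-j+2-a_i becomes 2k - i0 - j0 - a_i and (-1)^(i+j-1) becomes (-1)^(i0+j0+1))
Mmat : (k : ℕ) → List ℕ → List ℕ → Fin (k ℕ.+ k) → Fin (k ℕ.+ k) → ℚ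
Mmat k a b r j with splitAt k r
... | inj₁ i = recipΓ ((+ (2 ℕ.* k)) ℤ.- (+ toℕ i) ℤ.- (+ toℕ j) ℤ.- (+ at a (toℕ i)))
... | inj₂ i = sgn (toℕ i ℕ.+ toℕ j ℕ.+ 1)
               * recipΓ ((+ (2 ℕ.* k)) ℤ.- (+ toℕ i) ℤ.- (+ toℕ j) ℤ.- (+ at b (toℕ i)))

Mtilde : (k : ℕ) → List ℕ → List ℕ → ℚ
Mtilde k a b = sgn (sumℕ b) * det (k ℕ.+ k) (Mmat k a b)

-- (∏_{l=0}^{k-1} l!/(k+l)!)^{-1} = ∏_{l=0}^{k-1} (k+l)!/l!
invProd : ℕ → ℚ
invProd k = Πℚ k (λ l → _/_ (+ ((k ℕ.+ l) !)) (l !) {{l !≢0}})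

-- 1 / 2^{k^2 - r} = 2^r / 2^{k^2}
twoFactor : ℕ → ℕ → ℚ
twoFactor k r = _/_ (+ (2 ℕ.^ r)) (2 ℕ.^ (k ℕ.* k)) {{m^n≢0 2 (k ℕ.* k)}}

-- N_k(α;β); α, β given by their lists of nonzero entries
N : ℕ → List ℕ → List ℕ → ℚ
N k α β =
  twoFactor k (sumℕ α ℕ.+ sumℕ β) * invProd k *
  sumℚ (concatMap (λ σα → Data.List.map (λ τβ → Mtilde k σα τβ) (rearrangements (pad k β)))
                  (rearrangements (pad k α)))

evalPoly : List ℚ → ℕ → ℚ
evalPoly []       x = 0ℚ
evalPoly (c ∷ cs) x = c + (+ x / 1) * evalPoly cs x

{-# OPTIONS --safe #-}
module Submission where

-- With δ = (0, …, k - 1), column j read as the coefficient of x ^ (2k - 1 - j) and computing modulo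
-- x ^ 2k, M̃_k(a, b) becomes E(δ + a, δ + b), where E(c, d) is the determinant with rows
-- x ^ c_i exp(x) and x ^ d_i exp(-x).  Let p_r act on E by Σ_i (c_i ↦ c_i + r).  For a linear map X,
-- the determinants obtained by applying X to one row add up to tr X times the determinant.  For
-- X = x ^ r (r > 0) this shows that p_r acting on d is - p_r acting on c.  For X = x ^ (s + 1) d/dx,
-- together with the action of the same derivation on the Vandermonde determinant, it gives for
-- ⟨λ⟩ = (Π_j p_{λ_j} E)(δ, δ) the recursion
--   2 ⟨1, λ⟩     = k² ⟨λ⟩ - |λ| ⟨λ⟩,
--   2 ⟨s + 1, λ⟩ = - Σ_{a + b = s; a, b > 0} ⟨a, b, λ⟩ - Σ_j λ_j ⟨λ with λ_j + s in place of λ_j⟩   (s > 0).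
-- So 2 ^ |λ| ⟨λ⟩ / E(δ, δ) is a polynomial in k of degree at most 2 |λ|.  The monomial symmetric functions
-- m_α, m_β are combinations of products of power sums with coefficients independent of k, and
-- E(δ, δ) = 2 ^ k² Π_l l! / (k + l)!.

open import Defs

module _ where

  open import Algebra.Bundles using (CommutativeRing)
  open import Data.Fin as F using (Fin; zero; suc; toℕ; fromℕ; fromℕ<; inject₁; punchIn; splitAt; _↑ˡ_; _↑ʳ_)
  import Data.Fin.Properties as FP
  open import Data.Fin.Permutation using (Permutation′; transpose; _⟨$⟩ʳ_)
  import Data.Fin.Permutation.Components as PC
  import Data.Integer as ℤ
  open ℤ using () renaming (+_ to pos)
  import Data.Integer.Properties as ℤP
  import Data.Integer.Tactic.RingSolver as ℤ-Solver
  open import Data.List using (List; []; _∷_; _++_; length; map; replicate; concatMap; filter)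
  import Data.List.Properties as ListP
  open import Data.List.Membership.Propositional using (_∈_; find; lose)
  import Data.List.Membership.Propositional.Properties as ∈P
  open import Data.List.Membership.Propositional.Properties.WithK using (unique∧set⇒bag)
  open import Data.List.Relation.Binary.BagAndSetEquality using (∼bag⇒↭)
  open import Data.List.Relation.Binary.Permutation.Propositional as ↭
    using (_↭_; ↭-refl; ↭-sym; ↭-trans; ↭-prep; ↭-swap; ↭-reflexive)
  import Data.List.Relation.Binary.Permutation.Propositional.Properties as ↭P
  open import Data.List.Relation.Unary.All as All using (All; []; _∷_)
  import Data.List.Relation.Unary.All.Properties as AllP
  open import Data.List.Relation.Unary.AllPairs using ([]; _∷_)
  open import Data.List.Relation.Unary.Any using (here; there)
  open import Data.List.Relation.Unary.Unique.Propositional using (Unique)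
  import Data.List.Relation.Unary.Unique.Propositional.Properties as UniqueP
  import Data.List.Relation.Unary.Unique.DecPropositional.Properties as DecUnique
  open import Data.Nat as ℕ using (ℕ; _≤_; _<_; zero; suc; z≤n; s≤s; _!; _∸_; pred)
  import Data.Nat.Properties as ℕP
  open import Data.Product using (Σ; _×_; _,_; proj₁; proj₂)
  open import Data.Rational using (ℚ; 0ℚ; 1ℚ; ½; _+_; _*_; -_; _/_; toℚᵘ)
  import Data.Rational.Properties as ℚP
  import Data.Rational.Unnormalised as ℚᵘ
  import Data.Rational.Unnormalised.Properties as ℚᵘP
  open import Data.Sum using (inj₁; inj₂)
  open import Data.Vec.Functional using (updateAt) renaming (_∷_ to _∷ᶠ_; _++_ to _++ᶠ_)
  open import Data.Vec.Functional.Properties using (updateAt-updates; updateAt-minimal; lookup-++ˡ; lookup-++ʳ)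
  open import Function using (_∘_; const; mk⇔)
  open import Relation.Binary.Definitions using (tri<; tri≈; tri>)
  open import Relation.Binary.PropositionalEquality
  open import Relation.Nullary using (¬_; Dec; yes; no; contradiction; dec⇒maybe)
  open import Relation.Unary using (Decidable)
  open import Tactic.RingSolver using (solve-∀)
  import Tactic.RingSolver.Core.AlmostCommutativeRing as ACR
  import Algebra.Properties.Semiring.Sum (CommutativeRing.semiring ℚP.+-*-commutativeRing) as Sum
  open ≡-Reasoning

  -- The size of the determinant grows with k, so everything has to come from identities valid for
  -- all k in which k occurs only as a coefficient. The trace identity for x ^ (s + 1) d/dx does not
  -- close up by itself: it contains Σ_i c_i E(c + s e_i, d) and its counterpart in d, which are not
  -- power sums acting on E. At c = d = δ antisymmetry turns them into Σ p_a p_b plus terms linear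
  -- in p_s whose coefficients involve k. As p_s on d is minus p_s on c, the linear terms of the two
  -- halves cancel, whereas p_a p_b changes sign twice and the two halves agree. So k disappears for
  -- s > 0. For s = 0 the trace 0 + ... + (2k - 1), less the sum 0 + ... + (k - 1) from each half,
  -- leaves k². Since this evaluation is available at δ only, the p_λ must be applied before
  -- specialising, and moving them past the derivation produces the terms with λ_j. Each use of the
  -- recursion lowers |λ| by one and costs at most a factor k², whence the degree 2 |λ|.

  ℚ-ring : ACR.AlmostCommutativeRing _ _
  ℚ-ring = ACR.fromCommutativeRing ℚP.+-*-commutativeRing (λ x → dec⇒maybe (0ℚ ℚP.≟ x))

  -- Finite sums of rationals

  Σ≡sum : ∀ n (f : Fin n → ℚ) → Σℚ n f ≡ Sum.sum f
  Σ≡sum zero    f = refl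
  Σ≡sum (suc n) f = cong (f zero +_) (Σ≡sum n (f ∘ suc))

  Σ-cong : ∀ {n} {f g : Fin n → ℚ} → (∀ i → f i ≡ g i) → Σℚ n f ≡ Σℚ n g
  Σ-cong {zero}  h = refl
  Σ-cong {suc n} h = cong₂ _+_ (h zero) (Σ-cong (h ∘ suc))

  Σ-zero : ∀ {n} {f : Fin n → ℚ} → (∀ i → f i ≡ 0ℚ) → Σℚ n f ≡ 0ℚ
  Σ-zero {zero}  h = refl
  Σ-zero {suc n} h = trans (cong₂ _+_ (h zero) (Σ-zero (h ∘ suc))) (ℚP.+-identityʳ 0ℚ)

  Σ-+ : ∀ {n} (f g : Fin n → ℚ) → Σℚ n (λ i → f i + g i) ≡ Σℚ n f + Σℚ n g
  Σ-+ {n} f g rewrite Σ≡sum n f | Σ≡sum n g | Σ≡sum n (λ i → f i + g i) = Sum.∑-distrib-+ f g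

  Σ-*ˡ : ∀ {n} x (f : Fin n → ℚ) → Σℚ n (λ i → x * f i) ≡ x * Σℚ n f
  Σ-*ˡ {n} x f rewrite Σ≡sum n f | Σ≡sum n (λ i → x * f i) = sym (Sum.*-distribˡ-sum x f)

  Σ-*ʳ : ∀ {n} x (f : Fin n → ℚ) → Σℚ n (λ i → f i * x) ≡ Σℚ n f * x
  Σ-*ʳ {n} x f rewrite Σ≡sum n f | Σ≡sum n (λ i → f i * x) = sym (Sum.*-distribʳ-sum x f)

  x≡[x+y]-y : ∀ x y → x ≡ (x + y) + - y
  x≡[x+y]-y = solve-∀ ℚ-ring

  neg≡-1* : ∀ x → - x ≡ (- 1ℚ) * x
  neg≡-1* = solve-∀ ℚ-ring

  Σ-neg : ∀ {n} (f : Fin n → ℚ) → Σℚ n (λ i → - f i) ≡ - Σℚ n f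
  Σ-neg {n} f = trans (Σ-cong (λ i → neg≡-1* (f i))) (trans (Σ-*ˡ (- 1ℚ) f) (sym (neg≡-1* (Σℚ n f))))

  Σ-comm : ∀ {m n} (f : Fin m → Fin n → ℚ) →
           Σℚ m (λ i → Σℚ n (f i)) ≡ Σℚ n (λ j → Σℚ m (λ i → f i j))
  Σ-comm {m} {n} f = begin
    Σℚ m (λ i → Σℚ n (f i))            ≡⟨ Σ-cong (λ i → Σ≡sum n (f i)) ⟩
    Σℚ m (λ i → Sum.sum (f i))          ≡⟨ Σ≡sum m _ ⟩
    Sum.sum (λ i → Sum.sum (f i))       ≡⟨ Sum.∑-comm f ⟩
    Sum.sum (λ j → Sum.sum (λ i → f i j)) ≡⟨ Σ≡sum n _ ⟨
    Σℚ n (λ j → Sum.sum (λ i → f i j))  ≡⟨ Σ-cong {n} (λ j → sym (Σ≡sum m (λ i → f i j))) ⟩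
    Σℚ n (λ j → Σℚ m (λ i → f i j))    ∎

  Σ-permute : ∀ {n} (f : Fin n → ℚ) (π : Permutation′ n) → Σℚ n f ≡ Σℚ n (λ i → f (π ⟨$⟩ʳ i))
  Σ-permute {n} f π rewrite Σ≡sum n f | Σ≡sum n (λ i → f (π ⟨$⟩ʳ i)) = Sum.sum-permute f π

  Σ-single : ∀ {n} (f : Fin n → ℚ) i → (∀ j → j ≢ i → f j ≡ 0ℚ) → Σℚ n f ≡ f i
  Σ-single {suc n} f zero    h =
    trans (cong (f zero +_) (Σ-zero (λ j → h (suc j) (λ ())))) (ℚP.+-identityʳ _)
  Σ-single {suc n} f (suc i) h =
    trans (cong₂ _+_ (h zero (λ ())) (Σ-single (f ∘ suc) i (λ j j≢i → h (suc j) (j≢i ∘ FP.suc-injective))))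
          (ℚP.+-identityˡ _)

  Σ-↑ : ∀ m n (f : Fin (m ℕ.+ n) → ℚ) →
        Σℚ (m ℕ.+ n) f ≡ Σℚ m (λ i → f (i ↑ˡ n)) + Σℚ n (λ i → f (m ↑ʳ i))
  Σ-↑ zero    n f = sym (ℚP.+-identityˡ _)
  Σ-↑ (suc m) n f = trans (cong (f zero +_) (Σ-↑ m n (f ∘ suc))) (sym (ℚP.+-assoc (f zero) _ _))

  Σ-last : ∀ n (f : ℕ → ℚ) → Σℚ (suc n) (λ i → f (toℕ i)) ≡ Σℚ n (λ i → f (toℕ i)) + f n
  Σ-last zero    f = ℚP.+-comm (f 0) 0ℚ
  Σ-last (suc n) f = trans (cong (f 0 +_) (Σ-last n (f ∘ suc))) (sym (ℚP.+-assoc (f 0) _ _))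

  Σ-reverse : ∀ n (f : ℕ → ℚ) → Σℚ n (λ i → f (toℕ i)) ≡ Σℚ n (λ i → f (n ℕ.∸ suc (toℕ i)))
  Σ-reverse zero    f = refl
  Σ-reverse (suc n) f = begin
    Σℚ (suc n) (λ i → f (toℕ i))             ≡⟨ Σ-last n f ⟩
    Σℚ n (λ i → f (toℕ i)) + f n             ≡⟨ ℚP.+-comm _ (f n) ⟩
    f n + Σℚ n (λ i → f (toℕ i))             ≡⟨ cong (f n +_) (Σ-reverse n f) ⟩
    f n + Σℚ n (λ i → f (n ℕ.∸ suc (toℕ i))) ∎

  double≡0 : ∀ {x} → x + x ≡ 0ℚ → x ≡ 0ℚ
  double≡0 {x} h = begin
    x              ≡⟨ halves x ⟨
    ½ * (x + x)    ≡⟨ cong (½ *_) h ⟩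
    ½ * 0ℚ         ≡⟨⟩
    0ℚ             ∎
    where
    halves : ∀ x → ½ * (x + x) ≡ x
    halves x = begin
      ½ * (x + x)   ≡⟨ ℚP.*-distribˡ-+ ½ x x ⟩
      ½ * x + ½ * x ≡⟨ ℚP.*-distribʳ-+ x ½ ½ ⟨
      1ℚ * x        ≡⟨ ℚP.*-identityˡ x ⟩
      x             ∎

  x≡-x⇒x≡0 : ∀ {x} → x ≡ - x → x ≡ 0ℚ
  x≡-x⇒x≡0 {x} h = double≡0 (trans (cong (_+ x) h) (ℚP.+-inverseˡ x))

  -- The natural numbers in ℚ and the cancellation of denominators

  -- Repeated addition reduces on `suc`, which the inductions rely on; `ι≡/1` links it to the
  -- argument of `evalPoly`, and `/-cancel` to the fractions in `invProd` and `twoFactor`.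
  ι : ℕ → ℚ
  ι zero    = 0ℚ
  ι (suc n) = 1ℚ + ι n

  ι-+ : ∀ m n → ι (m ℕ.+ n) ≡ ι m + ι n
  ι-+ zero    n = sym (ℚP.+-identityˡ _)
  ι-+ (suc m) n = trans (cong (1ℚ +_) (ι-+ m n)) (sym (ℚP.+-assoc 1ℚ (ι m) (ι n)))

  ι-* : ∀ m n → ι (m ℕ.* n) ≡ ι m * ι n
  ι-* zero    n = sym (ℚP.*-zeroˡ (ι n))
  ι-* (suc m) n = trans (ι-+ n (m ℕ.* n)) (trans (cong (ι n +_) (ι-* m n)) (aux (ι m) (ι n)))
    where
    aux : ∀ a b → b + a * b ≡ (1ℚ + a) * b
    aux = solve-∀ ℚ-ring

  /-≃ : ∀ n d .{{_ : ℕ.NonZero d}} → toℚᵘ (pos n / d) ℚᵘ.≃ (pos n ℚᵘ./ d)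
  /-≃ n (suc d) = ℚP.toℚᵘ-fromℚᵘ (ℚᵘ.mkℚᵘ (pos n) d)

  ι≡/1 : ∀ n → ι n ≡ pos n / 1
  ι≡/1 zero    = refl
  ι≡/1 (suc n) = ℚP.toℚᵘ-injective goal
    where
    open ℚᵘP.≃-Reasoning using (step-≈-⟩; step-≈-⟨) renaming (begin_ to begin′_; _∎ to _∎′)
    goal : toℚᵘ (1ℚ + ι n) ℚᵘ.≃ toℚᵘ (pos (suc n) / 1)
    goal = begin′
      toℚᵘ (1ℚ + ι n)             ≈⟨ ℚP.toℚᵘ-homo-+ 1ℚ (ι n) ⟩
      ℚᵘ.1ℚᵘ ℚᵘ.+ toℚᵘ (ι n)      ≈⟨ ℚᵘP.≃-reflexive (cong (λ x → ℚᵘ.1ℚᵘ ℚᵘ.+ toℚᵘ x) (ι≡/1 n)) ⟩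
      ℚᵘ.1ℚᵘ ℚᵘ.+ toℚᵘ (pos n / 1)  ≈⟨ ℚᵘP.+-congʳ ℚᵘ.1ℚᵘ (/-≃ n 1) ⟩
      ℚᵘ.1ℚᵘ ℚᵘ.+ (pos n ℚᵘ./ 1)                  ≈⟨ ℚᵘ.*≡* (cong (ℤ._* pos 1) (cong (λ x → pos 1 ℤ.+ x) (ℤP.*-identityʳ (pos n)))) ⟩
      (pos (suc n) ℚᵘ./ 1)                          ≈⟨ /-≃ (suc n) 1 ⟨
      toℚᵘ (pos (suc n) / 1)          ∎′

  /-cancel : ∀ n d .{{_ : ℕ.NonZero d}} → (pos n / d) * ι d ≡ ι n
  /-cancel n d@(suc d-1) rewrite ι≡/1 d | ι≡/1 n = ℚP.toℚᵘ-injective goal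
    where
    open ℚᵘP.≃-Reasoning using (step-≈-⟩; step-≈-⟨) renaming (begin_ to begin′_; _∎ to _∎′)
    goal : toℚᵘ ((pos n / d) * (pos d / 1)) ℚᵘ.≃ toℚᵘ (pos n / 1)
    goal = begin′
      toℚᵘ ((pos n / d) * (pos d / 1)) ≈⟨ ℚP.toℚᵘ-homo-* (pos n / d) (pos d / 1) ⟩
      toℚᵘ (pos n / d) ℚᵘ.* toℚᵘ (pos d / 1) ≈⟨ ℚᵘP.*-cong (/-≃ n d) (/-≃ d 1) ⟩
      (pos n ℚᵘ./ d) ℚᵘ.* (pos d ℚᵘ./ 1) ≈⟨ ℚᵘ.*≡* (trans (ℤP.*-identityʳ _) (cong (pos n ℤ.*_) (sym (ℤP.*-identityʳ (pos d))))) ⟩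
      (pos n ℚᵘ./ 1) ≈⟨ /-≃ n 1 ⟨
      toℚᵘ (pos n / 1) ∎′

  recip : ∀ d .{{_ : ℕ.NonZero d}} → ℚ
  recip d = pos 1 / d

  recip-*ι : ∀ d .{{_ : ℕ.NonZero d}} → recip d * ι d ≡ 1ℚ
  recip-*ι d = /-cancel 1 d

  ι-cancel : ∀ d .{{_ : ℕ.NonZero d}} {x y} → ι d * x ≡ ι d * y → x ≡ y
  ι-cancel d {x} {y} h = begin
    x                     ≡⟨ aux x ⟩
    recip d * (ι d * x)   ≡⟨ cong (recip d *_) h ⟩
    recip d * (ι d * y)   ≡⟨ aux y ⟨
    y                     ∎
    where
    aux : ∀ z → z ≡ recip d * (ι d * z)
    aux z = trans (sym (ℚP.*-identityˡ z)) (trans (cong (_* z) (sym (recip-*ι d))) (ℚP.*-assoc (recip d) (ι d) z))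

  Σ-const : ∀ n x → Σℚ n (λ _ → x) ≡ ι n * x
  Σ-const zero    x = sym (ℚP.*-zeroˡ x)
  Σ-const (suc n) x = trans (cong (x +_) (Σ-const n x)) (ring (ι n) x)
    where
    ring : ∀ a b → b + a * b ≡ (1ℚ + a) * b
    ring = solve-∀ ℚ-ring

  -- Determinants as alternating multilinear functions of the rows

  Row : ℕ → Set
  Row n = Fin n → ℚ

  Matrix : ℕ → ℕ → Set
  Matrix m n = Fin m → Row n

  infix 4 _≐_
  _≐_ : ∀ {m n} → Matrix m n → Matrix m n → Set
  A ≐ B = ∀ i j → A i j ≡ B i j

  infixl 6 _⟨_⟩≔_
  _⟨_⟩≔_ : ∀ {m n} → Matrix m n → Fin m → Row n → Matrix m n
  A ⟨ r ⟩≔ v = updateAt A r (const v)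

  ≔-updates : ∀ {m n} (A : Matrix m n) r (v : Row n) j → (A ⟨ r ⟩≔ v) r j ≡ v j
  ≔-updates A r v j = cong (λ w → w j) (updateAt-updates r A)

  ≔-minimal : ∀ {m n} (A : Matrix m n) {r s} (v : Row n) → s ≢ r → ∀ j → (A ⟨ r ⟩≔ v) s j ≡ A s j
  ≔-minimal A {r} {s} v s≢r j = cong (λ w → w j) (updateAt-minimal s r A s≢r)

  ≔-char : ∀ {m n} {A B : Matrix m n} {r} {v : Row n} →
           (∀ j → B r j ≡ v j) → (∀ s → s ≢ r → ∀ j → B s j ≡ A s j) → B ≐ A ⟨ r ⟩≔ v
  ≔-char {A = A} {B} {r} {v} h₁ h₂ s j with s FP.≟ r
  ... | yes refl = trans (h₁ j) (sym (≔-updates A r v j))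
  ... | no  s≢r  = trans (h₂ s s≢r j) (sym (≔-minimal A v s≢r j))

  ≔-cong : ∀ {m n} {A B : Matrix m n} {r} {v w : Row n} →
           (∀ s → s ≢ r → ∀ j → A s j ≡ B s j) → (∀ j → v j ≡ w j) → A ⟨ r ⟩≔ v ≐ B ⟨ r ⟩≔ w
  ≔-cong {A = A} {B} {r} {v} {w} h₁ h₂ =
    ≔-char (λ j → trans (≔-updates A r v j) (h₂ j))
           (λ s s≢r j → trans (≔-minimal A v s≢r j) (h₁ s s≢r j))

  ≔-self : ∀ {m n} (A : Matrix m n) r → A ≐ A ⟨ r ⟩≔ A r
  ≔-self A r = ≔-char (λ _ → refl) (λ _ _ _ → refl)

  ≔-comm : ∀ {m n} (A : Matrix m n) {r s} u v → r ≢ s →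
           (A ⟨ r ⟩≔ u) ⟨ s ⟩≔ v ≐ (A ⟨ s ⟩≔ v) ⟨ r ⟩≔ u
  ≔-comm A {r} {s} u v r≢s = ≔-char
    (λ j → trans (≔-minimal (A ⟨ r ⟩≔ u) v r≢s j) (≔-updates A r u j))
    λ t t≢r j → aux t t≢r j (t FP.≟ s)
    where
    aux : ∀ t → t ≢ r → ∀ j → Dec (t ≡ s) → ((A ⟨ r ⟩≔ u) ⟨ s ⟩≔ v) t j ≡ (A ⟨ s ⟩≔ v) t j
    aux t t≢r j (yes refl) = trans (≔-updates (A ⟨ r ⟩≔ u) t v j) (sym (≔-updates A t v j))
    aux t t≢r j (no t≢s) = trans (≔-minimal (A ⟨ r ⟩≔ u) v t≢s j)
      (trans (≔-minimal A u t≢r j) (sym (≔-minimal A v t≢s j)))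

  -- Rows and columns are counted separately, because `fix-row` freezes rows one by one while `ins0`
  -- changes the length of the rows. Matrices are functions, so `φ-cong` has to be carried along
  -- explicitly.
  record Multilinear {m n} (φ : Matrix m n → ℚ) : Set where
    field
      φ-cong : ∀ {A B} → A ≐ B → φ A ≡ φ B
      φ-lin  : ∀ A r t u v → φ (A ⟨ r ⟩≔ (λ j → t * u j + v j)) ≡ t * φ (A ⟨ r ⟩≔ u) + φ (A ⟨ r ⟩≔ v)

    φ-0row : ∀ A r → φ (A ⟨ r ⟩≔ (λ _ → 0ℚ)) ≡ 0ℚ
    φ-0row A r = trans (x≡[x+y]-y x x) (trans (cong (_+ - x) (sym eq)) (ℚP.+-inverseʳ x))
      where
      x = φ (A ⟨ r ⟩≔ (λ _ → 0ℚ))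
      eq : x ≡ x + x
      eq = trans (φ-lin A r 1ℚ (λ _ → 0ℚ) (λ _ → 0ℚ)) (cong (_+ x) (ℚP.*-identityˡ x))

    φ-+ : ∀ A r u v → φ (A ⟨ r ⟩≔ (λ j → u j + v j)) ≡ φ (A ⟨ r ⟩≔ u) + φ (A ⟨ r ⟩≔ v)
    φ-+ A r u v = begin
      φ (A ⟨ r ⟩≔ (λ j → u j + v j))          ≡⟨ φ-cong (≔-cong (λ _ _ _ → refl) (λ j → cong (_+ v j) (sym (ℚP.*-identityˡ (u j))))) ⟩
      φ (A ⟨ r ⟩≔ (λ j → 1ℚ * u j + v j))     ≡⟨ φ-lin A r 1ℚ u v ⟩
      1ℚ * φ (A ⟨ r ⟩≔ u) + φ (A ⟨ r ⟩≔ v)    ≡⟨ cong (_+ φ (A ⟨ r ⟩≔ v)) (ℚP.*-identityˡ (φ (A ⟨ r ⟩≔ u))) ⟩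
      φ (A ⟨ r ⟩≔ u) + φ (A ⟨ r ⟩≔ v)         ∎

    φ-* : ∀ A r t u → φ (A ⟨ r ⟩≔ (λ j → t * u j)) ≡ t * φ (A ⟨ r ⟩≔ u)
    φ-* A r t u = begin
      φ (A ⟨ r ⟩≔ (λ j → t * u j))           ≡⟨ φ-cong (≔-cong (λ _ _ _ → refl) (λ j → sym (ℚP.+-identityʳ (t * u j)))) ⟩
      φ (A ⟨ r ⟩≔ (λ j → t * u j + 0ℚ))      ≡⟨ φ-lin A r t u (λ _ → 0ℚ) ⟩
      t * φ (A ⟨ r ⟩≔ u) + φ (A ⟨ r ⟩≔ (λ _ → 0ℚ)) ≡⟨ cong (t * φ (A ⟨ r ⟩≔ u) +_) (φ-0row A r) ⟩
      t * φ (A ⟨ r ⟩≔ u) + 0ℚ                ≡⟨ ℚP.+-identityʳ _ ⟩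
      t * φ (A ⟨ r ⟩≔ u)                     ∎

    φ-Σ : ∀ {p} A r (t : Fin p → ℚ) (u : Fin p → Row n) →
          φ (A ⟨ r ⟩≔ (λ j → Σℚ p (λ q → t q * u q j))) ≡ Σℚ p (λ q → t q * φ (A ⟨ r ⟩≔ u q))
    φ-Σ {zero}  A r t u = φ-0row A r
    φ-Σ {suc p} A r t u = trans (φ-lin A r (t zero) (u zero) _)
      (cong (t zero * φ (A ⟨ r ⟩≔ u zero) +_) (φ-Σ A r (t ∘ suc) (u ∘ suc)))

  record Alternating {m n} (φ : Matrix m n → ℚ) : Set where
    field
      multilinear : Multilinear φ
      φ-alt : ∀ A {r s} → r ≢ s → (∀ j → A r j ≡ A s j) → φ A ≡ 0ℚ

  open Multilinear
  open Alternating

  -- With x and y in place of two equal rows, 0 = φ(x + y, x + y) expands to φ(x, y) + φ(y, x).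
  antisym : ∀ {m n} {φ : Matrix m n → ℚ} (ml : Multilinear φ) {r s} → r ≢ s →
            (∀ A → (∀ j → A r j ≡ A s j) → φ A ≡ 0ℚ) →
            ∀ A u v → φ ((A ⟨ r ⟩≔ u) ⟨ s ⟩≔ v) ≡ - φ ((A ⟨ r ⟩≔ v) ⟨ s ⟩≔ u)
  antisym {m} {n} {φ} ml {r} {s} r≢s alt A u v = begin
    φ (M u v)                    ≡⟨ x≡[x+y]-y (φ (M u v)) (φ (M v u)) ⟩
    (φ (M u v) + φ (M v u)) + - φ (M v u) ≡⟨ cong (_+ - φ (M v u)) (sym key) ⟩
    0ℚ + - φ (M v u)             ≡⟨ ℚP.+-identityˡ _ ⟩
    - φ (M v u)                  ∎
    where
    M : Row n → Row n → Matrix m n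
    M u v = (A ⟨ r ⟩≔ u) ⟨ s ⟩≔ v
    u+v : Row n
    u+v j = u j + v j
    diag : ∀ w → φ (M w w) ≡ 0ℚ
    diag w = alt (M w w) λ j → trans (≔-minimal (A ⟨ r ⟩≔ w) w r≢s j)
      (trans (≔-updates A r w j) (sym (≔-updates (A ⟨ r ⟩≔ w) s w j)))
    flip : ∀ u v → φ (M u v) ≡ φ ((A ⟨ s ⟩≔ v) ⟨ r ⟩≔ u)
    flip u v = φ-cong ml (≔-comm A u v r≢s)
    expand : ∀ w → φ (M u+v w) ≡ φ (M u w) + φ (M v w)
    expand w = trans (flip u+v w) (trans (φ-+ ml (A ⟨ s ⟩≔ w) r u v) (sym (cong₂ _+_ (flip u w) (flip v w))))
    key : 0ℚ ≡ φ (M u v) + φ (M v u)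
    key = begin
      0ℚ                                                ≡⟨ diag u+v ⟨
      φ (M u+v u+v)                                     ≡⟨ φ-+ ml (A ⟨ r ⟩≔ u+v) s u v ⟩
      φ (M u+v u) + φ (M u+v v)                         ≡⟨ cong₂ _+_ (expand u) (expand v) ⟩
      (φ (M u u) + φ (M v u)) + (φ (M u v) + φ (M v v)) ≡⟨ cong₂ _+_ (cong (_+ φ (M v u)) (diag u)) (cong (φ (M u v) +_) (diag v)) ⟩
      (0ℚ + φ (M v u)) + (φ (M u v) + 0ℚ)               ≡⟨ ring₂ (φ (M v u)) (φ (M u v)) ⟩
      φ (M u v) + φ (M v u)                             ∎
      where
      ring₂ : ∀ a b → (0ℚ + a) + (b + 0ℚ) ≡ b + a
      ring₂ = solve-∀ ℚ-ring

  swap-rows : ∀ {m n} {φ : Matrix m n → ℚ} → Alternating φ → ∀ {r s} → r ≢ s → ∀ {A B} →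
              (∀ j → B r j ≡ A s j) → (∀ j → B s j ≡ A r j) →
              (∀ q → q ≢ r → q ≢ s → ∀ j → B q j ≡ A q j) → φ B ≡ - φ A
  swap-rows {φ = φ} al {r} {s} r≢s {A} {B} h₁ h₂ h₃ = begin
    φ B                                  ≡⟨ φ-cong (multilinear al) (≔-char h₂ λ q q≢s j → aux q q≢s j (q FP.≟ r)) ⟩
    φ ((A ⟨ r ⟩≔ A s) ⟨ s ⟩≔ A r)        ≡⟨ antisym (multilinear al) r≢s (λ A → φ-alt al A r≢s) A (A s) (A r) ⟩
    - φ ((A ⟨ r ⟩≔ A r) ⟨ s ⟩≔ A s)      ≡⟨ cong -_ (φ-cong (multilinear al) (≔-char {A = A ⟨ r ⟩≔ A r} (λ _ → refl) (λ q q≢s → ≔-self A r q))) ⟨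
    - φ A                                ∎
    where
    aux : ∀ q → q ≢ s → ∀ j → Dec (q ≡ r) → B q j ≡ (A ⟨ r ⟩≔ A s) q j
    aux q q≢s j (yes refl) = trans (h₁ j) (sym (≔-updates A q (A s) j))
    aux q q≢s j (no q≢r)   = trans (h₃ q q≢r q≢s j) (sym (≔-minimal A (A s) q≢r j))

  scaled-rows : ∀ {m n} {φ : Matrix m n → ℚ} → Alternating φ → ∀ t {A r s} → r ≢ s →
                (∀ j → A r j ≡ t * A s j) → φ A ≡ 0ℚ
  scaled-rows {φ = φ} al t {A} {r} {s} r≢s h = begin
    φ A                              ≡⟨ φ-cong ml (≔-char {A = A} {r = r} h (λ _ _ _ → refl)) ⟩
    φ (A ⟨ r ⟩≔ (λ j → t * A s j))   ≡⟨ φ-* ml A r t (A s) ⟩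
    t * φ (A ⟨ r ⟩≔ A s)             ≡⟨ cong (t *_) (φ-alt al (A ⟨ r ⟩≔ A s) r≢s
                                         (λ j → trans (≔-updates A r (A s) j) (sym (≔-minimal A (A s) (r≢s ∘ sym) j)))) ⟩
    t * 0ℚ                           ≡⟨ ℚP.*-zeroʳ t ⟩
    0ℚ                               ∎
    where ml = multilinear al

  zero-row : ∀ {m n} {φ : Matrix m n → ℚ} → Multilinear φ → ∀ {A} r → (∀ j → A r j ≡ 0ℚ) → φ A ≡ 0ℚ
  zero-row ml {A} r h = trans (φ-cong ml (≔-char {A = A} {r = r} h (λ _ _ _ → refl))) (φ-0row ml A r)

  minor : ∀ {m n} → Matrix (suc m) (suc n) → Fin (suc n) → Matrix m n
  minor A j i x = A (suc i) (punchIn j x)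

  det-cong : ∀ n {A B : Matrix n n} → A ≐ B → det n A ≡ det n B
  det-cong zero    h = refl
  det-cong (suc n) h = Σ-cong λ j →
    cong₂ (λ a d → sgn (toℕ j) * a * d) (h zero j) (det-cong n (λ i x → h (suc i) (punchIn j x)))

  minor-≔ : ∀ {m n} (A : Matrix (suc m) (suc n)) j r v →
            minor (A ⟨ suc r ⟩≔ v) j ≐ minor A j ⟨ r ⟩≔ (v ∘ punchIn j)
  minor-≔ A j r v = ≔-char (λ x → ≔-updates (A ∘ suc) r v (punchIn j x))
                           (λ s s≢r x → ≔-minimal (A ∘ suc) v s≢r (punchIn j x))

  det-lin : ∀ n (A : Matrix n n) r t u v →
            det n (A ⟨ r ⟩≔ (λ j → t * u j + v j)) ≡ t * det n (A ⟨ r ⟩≔ u) + det n (A ⟨ r ⟩≔ v)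
  det-lin (suc n) A r t u v = begin
    Σℚ (suc n) (term (λ j → t * u j + v j))              ≡⟨ Σ-cong (termwise r) ⟩
    Σℚ (suc n) (λ j → t * term u j + term v j)           ≡⟨ Σ-+ (λ j → t * term u j) (term v) ⟩
    Σℚ (suc n) (λ j → t * term u j) + Σℚ (suc n) (term v) ≡⟨ cong (_+ Σℚ (suc n) (term v)) (Σ-*ˡ t (term u)) ⟩
    t * Σℚ (suc n) (term u) + Σℚ (suc n) (term v)        ∎
    where
    term′ : Fin (suc n) → Row (suc n) → Fin (suc n) → ℚ
    term′ r w j = sgn (toℕ j) * (A ⟨ r ⟩≔ w) zero j * det n (minor (A ⟨ r ⟩≔ w) j)
    term : Row (suc n) → Fin (suc n) → ℚ
    term = term′ r
    ring₀ : ∀ s t a b d → s * (t * a + b) * d ≡ t * (s * a * d) + s * b * d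
    ring₀ = solve-∀ ℚ-ring
    ring₁ : ∀ s t a b → s * (t * a + b) ≡ t * (s * a) + s * b
    ring₁ = solve-∀ ℚ-ring
    termwise : ∀ r j → term′ r (λ j → t * u j + v j) j ≡ t * term′ r u j + term′ r v j
    termwise zero    j = ring₀ (sgn (toℕ j)) t (u j) (v j) _
    termwise (suc r) j = begin
      x * det n (minor (A ⟨ suc r ⟩≔ (λ j → t * u j + v j)) j)
        ≡⟨ cong (x *_) (det-cong n (minor-≔ A j r (λ j → t * u j + v j))) ⟩
      x * det n (minor A j ⟨ r ⟩≔ (λ i → t * u (punchIn j i) + v (punchIn j i)))
        ≡⟨ cong (x *_) (det-lin n (minor A j) r t (u ∘ punchIn j) (v ∘ punchIn j)) ⟩
      x * (t * det n (minor A j ⟨ r ⟩≔ (u ∘ punchIn j)) + det n (minor A j ⟨ r ⟩≔ (v ∘ punchIn j)))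
        ≡⟨ ring₁ x t _ _ ⟩
      t * (x * det n (minor A j ⟨ r ⟩≔ (u ∘ punchIn j))) + x * det n (minor A j ⟨ r ⟩≔ (v ∘ punchIn j))
        ≡⟨ cong₂ (λ a b → t * (x * a) + x * b) (det-cong n (minor-≔ A j r u)) (det-cong n (minor-≔ A j r v)) ⟨
      t * term′ (suc r) u j + term′ (suc r) v j ∎
      where x = sgn (toℕ j) * A zero j

  det-multilinear : ∀ n → Multilinear (det n)
  det-multilinear n = record { φ-cong = det-cong n ; φ-lin = det-lin n }

  -- Pairing (j , l) with (suc l , j) for j ≤ l exhausts the pairs once each.
  Σ-pairs : ∀ n (t : Fin (suc n) → Fin n → ℚ) →
            (∀ j l → j F.≤ l → t (inject₁ j) l + t (suc l) j ≡ 0ℚ) →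
            Σℚ (suc n) (λ j → Σℚ n (t j)) ≡ 0ℚ
  Σ-pairs zero    t h = refl
  Σ-pairs (suc n) t h = begin
    Σℚ (suc n) (t zero) + Σℚ (suc n) (λ j → t (suc j) zero + Σℚ n (λ l → t (suc j) (suc l)))
      ≡⟨ cong (Σℚ (suc n) (t zero) +_) (Σ-+ (λ j → t (suc j) zero) inner) ⟩
    Σℚ (suc n) (t zero) + (Σℚ (suc n) (λ j → t (suc j) zero) + rest)
      ≡⟨ ℚP.+-assoc (Σℚ (suc n) (t zero)) (Σℚ (suc n) (λ j → t (suc j) zero)) rest ⟨
    (Σℚ (suc n) (t zero) + Σℚ (suc n) (λ j → t (suc j) zero)) + rest
      ≡⟨ cong (_+ rest) (Σ-+ (t zero) (λ j → t (suc j) zero)) ⟨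
    Σℚ (suc n) (λ j → t zero j + t (suc j) zero) + rest
      ≡⟨ cong₂ _+_ (Σ-zero (λ l → h zero l z≤n)) (Σ-pairs n (λ j l → t (suc j) (suc l)) (λ j l j≤l → h (suc j) (suc l) (s≤s j≤l))) ⟩
    0ℚ + 0ℚ
      ≡⟨⟩
    0ℚ ∎
    where
    inner : Fin (suc n) → ℚ
    inner j = Σℚ n (λ l → t (suc j) (suc l))
    rest : ℚ
    rest = Σℚ (suc n) inner

  punchIn-inject₁ : ∀ {n} (j l : Fin n) → j F.≤ l → punchIn (inject₁ j) l ≡ suc l
  punchIn-inject₁ zero    l         _         = refl
  punchIn-inject₁ (suc j) (suc l) (s≤s j≤l) = cong suc (punchIn-inject₁ j l j≤l)

  punchIn-suc : ∀ {n} (j l : Fin n) → j F.≤ l → punchIn (suc l) j ≡ inject₁ j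
  punchIn-suc zero    l         _         = refl
  punchIn-suc (suc j) (suc l) (s≤s j≤l) = cong suc (punchIn-suc j l j≤l)

  punchIn-punchIn : ∀ {n} (j l : Fin (suc n)) → j F.≤ l → ∀ x →
                    punchIn (inject₁ j) (punchIn l x) ≡ punchIn (suc l) (punchIn j x)
  punchIn-punchIn zero    l         _         x         = refl
  punchIn-punchIn (suc j) (suc l) (s≤s j≤l) zero    = refl
  punchIn-punchIn (suc j) (suc l) (s≤s j≤l) (suc x) = cong suc (punchIn-punchIn j l j≤l x)

  -- Expand along both rows: choosing the same two columns in either order gives the same second
  -- minor, equal products of entries, and opposite signs.
  det-alt₀₁ : ∀ n (A : Matrix (suc (suc n)) (suc (suc n))) →
              (∀ j → A zero j ≡ A (suc zero) j) → det (suc (suc n)) A ≡ 0ℚ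
  det-alt₀₁ n A h = begin
    Σℚ (2 ℕ.+ n) (λ j → sgn (toℕ j) * A zero j * det (suc n) (minor A j))
      ≡⟨ Σ-cong (λ j → sym (Σ-*ˡ {suc n} (sgn (toℕ j) * A zero j) (λ l → sgn (toℕ l) * A (suc zero) (punchIn j l) * d j l))) ⟩
    Σℚ (2 ℕ.+ n) (λ j → Σℚ (suc n) (t j))
      ≡⟨ Σ-pairs (suc n) t cancel ⟩
    0ℚ ∎
    where
    d : Fin (2 ℕ.+ n) → Fin (suc n) → ℚ
    d j l = det n (minor (minor A j) l)
    t : Fin (2 ℕ.+ n) → Fin (suc n) → ℚ
    t j l = (sgn (toℕ j) * A zero j) * (sgn (toℕ l) * A (suc zero) (punchIn j l) * d j l)
    ring : ∀ s a s′ b d → (s * a) * (s′ * b * d) + (- s′ * b) * (s * a * d) ≡ 0ℚ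
    ring = solve-∀ ℚ-ring
    cancel : ∀ j l → j F.≤ l → t (inject₁ j) l + t (suc l) j ≡ 0ℚ
    cancel j l j≤l = begin
      t (inject₁ j) l + t (suc l) j
        ≡⟨ cong₂ _+_
            (cong₂ (λ s b → (s * A zero (inject₁ j)) * (sgn (toℕ l) * b * d (inject₁ j) l))
              (cong sgn (FP.toℕ-inject₁ j)) (cong (A (suc zero)) (punchIn-inject₁ j l j≤l)))
            (cong₂ (λ a b → (- sgn (toℕ l) * a) * (sgn (toℕ j) * b * d (suc l) j))
              (h (suc l)) (trans (cong (A (suc zero)) (punchIn-suc j l j≤l)) (sym (h (inject₁ j))))) ⟩
      (sgn (toℕ j) * a₀) * (sgn (toℕ l) * a₁ * d (inject₁ j) l) + (- sgn (toℕ l) * a₁) * (sgn (toℕ j) * a₀ * d (suc l) j)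
        ≡⟨ cong (λ x → (sgn (toℕ j) * a₀) * (sgn (toℕ l) * a₁ * d (inject₁ j) l) + (- sgn (toℕ l) * a₁) * (sgn (toℕ j) * a₀ * x))
            (det-cong n (λ i x → cong (A (suc (suc i))) (sym (punchIn-punchIn j l j≤l x)))) ⟩
      (sgn (toℕ j) * a₀) * (sgn (toℕ l) * a₁ * d (inject₁ j) l) + (- sgn (toℕ l) * a₁) * (sgn (toℕ j) * a₀ * d (inject₁ j) l)
        ≡⟨ ring (sgn (toℕ j)) a₀ (sgn (toℕ l)) a₁ _ ⟩
      0ℚ ∎
      where
      a₀ = A zero (inject₁ j)
      a₁ = A (suc zero) (suc l)

  -- Two rows below the first remain equal in every minor, so induction applies. Rows 0 and 1 are
  -- settled by double expansion. For rows 0 and s + 2, exchange rows 1 and s + 2 first; both lie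
  -- below row 0, where antisymmetry is already known.
  det-alt : ∀ n (A : Matrix n n) {r s} → r ≢ s → (∀ j → A r j ≡ A s j) → det n A ≡ 0ℚ
  det-alt-suc : ∀ n (A : Matrix (suc n) (suc n)) {r s} → r ≢ s →
                (∀ j → A (suc r) j ≡ A (suc s) j) → det (suc n) A ≡ 0ℚ
  det-alt₀ₛ : ∀ n (A : Matrix (suc n) (suc n)) s →
              (∀ j → A zero j ≡ A (suc s) j) → det (suc n) A ≡ 0ℚ

  det-alt (suc n) A {zero}  {zero}  r≢s h = contradiction refl r≢s
  det-alt (suc n) A {zero}  {suc s} r≢s h = det-alt₀ₛ n A s h
  det-alt (suc n) A {suc r} {zero}  r≢s h = det-alt₀ₛ n A r (sym ∘ h)
  det-alt (suc n) A {suc r} {suc s} r≢s h = det-alt-suc n A (r≢s ∘ cong suc) h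

  det-alt-suc n A r≢s h = Σ-zero λ j →
    trans (cong (sgn (toℕ j) * A zero j *_) (det-alt n (minor A j) r≢s (h ∘ punchIn j)))
          (ℚP.*-zeroʳ (sgn (toℕ j) * A zero j))

  det-alt₀ₛ (suc n) A zero    h = det-alt₀₁ n A h
  det-alt₀ₛ (suc n) A (suc s) h = begin
    det (2 ℕ.+ n) A
      ≡⟨ det-cong (2 ℕ.+ n) {A} {(A ⟨ S₀ ⟩≔ A S₀) ⟨ S₁ ⟩≔ A S₁} (≔-char {r = S₁} (λ _ → refl) (λ s _ → ≔-self A S₀ s)) ⟩
    det (2 ℕ.+ n) ((A ⟨ S₀ ⟩≔ A S₀) ⟨ S₁ ⟩≔ A S₁)
      ≡⟨ antisym (det-multilinear (2 ℕ.+ n)) {S₀} {S₁} (λ ()) (λ B → det-alt-suc (suc n) B {zero} {suc s} (λ ())) A (A S₀) (A S₁) ⟩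
    - det (2 ℕ.+ n) ((A ⟨ S₀ ⟩≔ A S₁) ⟨ S₁ ⟩≔ A S₀)
      ≡⟨ cong -_ (det-alt₀₁ n ((A ⟨ S₀ ⟩≔ A S₁) ⟨ S₁ ⟩≔ A S₀) h) ⟩
    0ℚ ∎
    where
    S₀ S₁ : Fin (2 ℕ.+ n)
    S₀ = suc zero
    S₁ = suc (suc s)

  det-alternating : ∀ n → Alternating (det n)
  det-alternating n = record { multilinear = det-multilinear n ; φ-alt = det-alt n }

  -- Triangular reduction and uniqueness of the determinant

  Π : ∀ {n} → (Fin n → ℚ) → ℚ
  Π {zero}  t = 1ℚ
  Π {suc n} t = t zero * Π (t ∘ suc)

  fix-row : ∀ {m n} {φ : Matrix (suc m) n → ℚ} → Multilinear φ → ∀ v → Multilinear (λ B → φ (v ∷ᶠ B))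
  fix-row {φ = φ} ml v = record
    { φ-cong = λ h → φ-cong ml λ where
        zero    j → refl
        (suc i) j → h i j
    ; φ-lin = λ A r t u w → begin
        φ (v ∷ᶠ A ⟨ r ⟩≔ (λ j → t * u j + w j))                   ≡⟨ push A r (λ j → t * u j + w j) ⟩
        φ ((v ∷ᶠ A) ⟨ suc r ⟩≔ (λ j → t * u j + w j))           ≡⟨ φ-lin ml (v ∷ᶠ A) (suc r) t u w ⟩
        t * φ ((v ∷ᶠ A) ⟨ suc r ⟩≔ u) + φ ((v ∷ᶠ A) ⟨ suc r ⟩≔ w) ≡⟨ cong₂ (λ a b → t * a + b) (push A r u) (push A r w) ⟨
        t * φ (v ∷ᶠ A ⟨ r ⟩≔ u) + φ (v ∷ᶠ A ⟨ r ⟩≔ w)              ∎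
    }
    where
    push : ∀ A r u → φ (v ∷ᶠ A ⟨ r ⟩≔ u) ≡ φ ((v ∷ᶠ A) ⟨ suc r ⟩≔ u)
    push A r u = φ-cong ml λ where
      zero    j → refl
      (suc i) j → refl

  fix-row-alt : ∀ {m n} {φ : Matrix (suc m) n → ℚ} → Alternating φ → ∀ v → Alternating (λ B → φ (v ∷ᶠ B))
  fix-row-alt al v = record
    { multilinear = fix-row (multilinear al) v
    ; φ-alt = λ A r≢s h → φ-alt al (v ∷ᶠ A) (r≢s ∘ FP.suc-injective) h
    }

  -- Replace the rows from the top down. When row r is reached, the rows above it are those of `g`,
  -- so the remainder `z r` may be discarded. In the applications it is zero or a multiple of a row
  -- that is already in place.
  triangular : ∀ {m n} {φ : Matrix m n → ℚ} → Multilinear φ → ∀ (g z w : Matrix m n) (t : Fin m → ℚ) →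
               (∀ r j → w r j ≡ t r * g r j + z r j) →
               (∀ r A → (∀ q → q F.< r → ∀ j → A q j ≡ g q j) → (∀ j → A r j ≡ z r j) → φ A ≡ 0ℚ) →
               φ w ≡ Π t * φ g
  triangular {zero} {φ = φ} ml g z w t h k = trans (φ-cong ml (λ ())) (sym (ℚP.*-identityˡ (φ g)))
  triangular {suc m} {n} {φ} ml g z w t h k = begin
    φ w
      ≡⟨ φ-cong ml (≔-char {A = w} {r = zero} (h zero) (λ _ _ _ → refl)) ⟩
    φ (w ⟨ zero ⟩≔ (λ j → t₀ * g zero j + z zero j))
      ≡⟨ φ-lin ml w zero t₀ (g zero) (z zero) ⟩
    t₀ * φ (w ⟨ zero ⟩≔ g zero) + φ (w ⟨ zero ⟩≔ z zero)
      ≡⟨ cong₂ (λ a b → t₀ * a + b)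
          (φ-cong ml (λ { zero j → refl ; (suc i) j → refl }))
          (k zero (w ⟨ zero ⟩≔ z zero) (λ _ ()) (λ _ → refl)) ⟩
    t₀ * φ (g zero ∷ᶠ w ∘ suc) + 0ℚ
      ≡⟨ cong (λ a → t₀ * a + 0ℚ) (triangular (fix-row ml (g zero)) (g ∘ suc) (z ∘ suc) (w ∘ suc) (t ∘ suc) (h ∘ suc) k′) ⟩
    t₀ * (Π (t ∘ suc) * φ (g zero ∷ᶠ g ∘ suc)) + 0ℚ
      ≡⟨ ring t₀ (Π (t ∘ suc)) _ ⟩
    Π t * φ (g zero ∷ᶠ g ∘ suc)
      ≡⟨ cong (Π t *_) (φ-cong ml (λ { zero j → refl ; (suc i) j → refl })) ⟩
    Π t * φ g ∎
    where
    t₀ = t zero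
    ring : ∀ a b c → a * (b * c) + 0ℚ ≡ (a * b) * c
    ring = solve-∀ ℚ-ring
    k′ : ∀ r A → (∀ q → q F.< r → ∀ j → A q j ≡ g (suc q) j) → (∀ j → A r j ≡ z (suc r) j) →
         φ (g zero ∷ᶠ A) ≡ 0ℚ
    k′ r A h₁ h₂ = k (suc r) (g zero ∷ᶠ A) before h₂
      where
      before : ∀ q → q F.< suc r → ∀ j → (g zero ∷ᶠ A) q j ≡ g q j
      before zero    _         j = refl
      before (suc q) (s≤s q<r) j = h₁ q q<r j

  Π-1 : ∀ {n} → Π {n} (λ _ → 1ℚ) ≡ 1ℚ
  Π-1 {zero}  = refl
  Π-1 {suc n} = trans (ℚP.*-identityˡ (Π {n} (λ _ → 1ℚ))) (Π-1 {n})

  e : ∀ {n} → Fin n → Row n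
  e zero    zero    = 1ℚ
  e zero    (suc j) = 0ℚ
  e (suc i) zero    = 0ℚ
  e (suc i) (suc j) = e i j

  e-diag : ∀ {n} (i : Fin n) → e i i ≡ 1ℚ
  e-diag zero    = refl
  e-diag (suc i) = e-diag i

  e-off : ∀ {n} (i j : Fin n) → i ≢ j → e i j ≡ 0ℚ
  e-off zero    zero    h = contradiction refl h
  e-off zero    (suc j) h = refl
  e-off (suc i) zero    h = refl
  e-off (suc i) (suc j) h = e-off i j (h ∘ cong suc)

  row-expand : ∀ {n} (v : Row n) j → Σℚ n (λ q → v q * e q j) ≡ v j
  row-expand {n} v j = trans
    (Σ-single (λ q → v q * e q j) j (λ q q≢j → trans (cong (v q *_) (e-off q j q≢j)) (ℚP.*-zeroʳ (v q))))
    (trans (cong (v j *_) (e-diag j)) (ℚP.*-identityʳ (v j)))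

  Σ-e : ∀ {n} (i : Fin n) x → Σℚ n (λ j → e i j * x) ≡ x
  Σ-e {n} i x = trans (Σ-*ʳ x (e i)) (trans (cong (_* x)
    (trans (Σ-single (e i) i (λ j j≢i → e-off i j (j≢i ∘ sym))) (e-diag i))) (ℚP.*-identityˡ x))

  -- Undoes the deletion of column j up to the deleted entry. Composition with it makes a form on
  -- rows of length n + 1 into one on the rows of a minor.
  ins0 : ∀ {n} → Fin (suc n) → Row n → Row (suc n)
  ins0 zero    v zero    = 0ℚ
  ins0 zero    v (suc x) = v x
  ins0 {suc n} (suc j) v zero    = v zero
  ins0 {suc n} (suc j) v (suc x) = ins0 j (v ∘ suc) x

  ins0-cong : ∀ {n} (j : Fin (suc n)) {v w : Row n} → (∀ x → v x ≡ w x) → ∀ x → ins0 j v x ≡ ins0 j w x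
  ins0-cong zero h zero    = refl
  ins0-cong zero h (suc x) = h x
  ins0-cong {suc n} (suc j) h zero    = h zero
  ins0-cong {suc n} (suc j) h (suc x) = ins0-cong j (h ∘ suc) x

  ins0-lin : ∀ {n} (j : Fin (suc n)) t (u v : Row n) x →
            ins0 j (λ i → t * u i + v i) x ≡ t * ins0 j u x + ins0 j v x
  ins0-lin zero t u v zero    = sym (trans (cong (_+ 0ℚ) (ℚP.*-zeroʳ t)) (ℚP.+-identityʳ 0ℚ))
  ins0-lin zero t u v (suc x) = refl
  ins0-lin {suc n} (suc j) t u v zero    = refl
  ins0-lin {suc n} (suc j) t u v (suc x) = ins0-lin j t (u ∘ suc) (v ∘ suc) x

  ins0-e : ∀ {n} (j : Fin (suc n)) i x → ins0 j (e i) x ≡ e (punchIn j i) x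
  ins0-e zero    i zero    = refl
  ins0-e zero    i (suc x) = refl
  ins0-e (suc j) zero    zero    = refl
  ins0-e (suc j) zero    (suc x) = ins0-0 j x
    where
    ins0-0 : ∀ {n} (j : Fin (suc n)) x → ins0 j (λ _ → 0ℚ) x ≡ 0ℚ
    ins0-0 zero zero    = refl
    ins0-0 zero (suc x) = refl
    ins0-0 {suc n} (suc j) zero    = refl
    ins0-0 {suc n} (suc j) (suc x) = ins0-0 j x
  ins0-e (suc j) (suc i) zero    = refl
  ins0-e (suc j) (suc i) (suc x) = ins0-e j i x

  ins0-minor : ∀ {n} (j : Fin (suc n)) (v : Row (suc n)) x →
              v x ≡ 1ℚ * ins0 j (v ∘ punchIn j) x + v j * e j x
  ins0-minor zero v zero    = ring (v zero)
    where
    ring : ∀ a → a ≡ 1ℚ * 0ℚ + a * 1ℚ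
    ring = solve-∀ ℚ-ring
  ins0-minor zero v (suc x) = ring (v (suc x)) (v zero)
    where
    ring : ∀ a b → a ≡ 1ℚ * a + b * 0ℚ
    ring = solve-∀ ℚ-ring
  ins0-minor {suc n} (suc j) v zero = ring (v zero) (v (suc j))
    where
    ring : ∀ a b → a ≡ 1ℚ * a + b * 0ℚ
    ring = solve-∀ ℚ-ring
  ins0-minor {suc n} (suc j) v (suc x) = ins0-minor j (v ∘ suc) x

  ins0-alternating : ∀ {m n} {φ : Matrix m (suc n) → ℚ} → Alternating φ → ∀ j →
                    Alternating (λ B → φ (λ i → ins0 j (B i)))
  ins0-alternating {φ = φ} al j = record
    { multilinear = record
      { φ-cong = λ h → φ-cong ml (λ i → ins0-cong j (h i))
      ; φ-lin  = λ A r t u v → begin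
          φ (λ i → ins0 j ((A ⟨ r ⟩≔ (λ x → t * u x + v x)) i))
            ≡⟨ push A r (λ x → t * u x + v x) ⟩
          φ ((λ i → ins0 j (A i)) ⟨ r ⟩≔ ins0 j (λ x → t * u x + v x))
            ≡⟨ φ-cong ml (≔-cong (λ _ _ _ → refl) (ins0-lin j t u v)) ⟩
          φ ((λ i → ins0 j (A i)) ⟨ r ⟩≔ (λ x → t * ins0 j u x + ins0 j v x))
            ≡⟨ φ-lin ml _ r t (ins0 j u) (ins0 j v) ⟩
          t * φ ((λ i → ins0 j (A i)) ⟨ r ⟩≔ ins0 j u) + φ ((λ i → ins0 j (A i)) ⟨ r ⟩≔ ins0 j v)
            ≡⟨ cong₂ (λ a b → t * a + b) (push A r u) (push A r v) ⟨
          t * φ (λ i → ins0 j ((A ⟨ r ⟩≔ u) i)) + φ (λ i → ins0 j ((A ⟨ r ⟩≔ v) i)) ∎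
      }
    ; φ-alt = λ A r≢s h → φ-alt al _ r≢s (ins0-cong j h)
    }
    where
    ml = multilinear al
    push : ∀ A r u → φ (λ i → ins0 j ((A ⟨ r ⟩≔ u) i)) ≡ φ ((λ i → ins0 j (A i)) ⟨ r ⟩≔ ins0 j u)
    push A r u = φ-cong ml (≔-char (ins0-cong j (≔-updates A r u)) (λ s s≢r → ins0-cong j (≔-minimal A u s≢r)))

  front : ∀ {n} → Fin (suc n) → Matrix (suc n) (suc n)
  front j = e j ∷ᶠ (e ∘ punchIn j)

  -- Passing from `front (inject₁ j)` to `front (suc j)` exchanges rows 0 and `suc j`, so the sign
  -- changes at each step. The induction runs on m because `inject₁ j` is not a subterm of `suc j`.
  φ-front : ∀ {n} {φ : Matrix (suc n) (suc n) → ℚ} → Alternating φ → ∀ m (j : Fin (suc n)) → toℕ j ≡ m →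
            φ (front j) ≡ sgn m * φ e
  φ-front {φ = φ} al zero zero _ = trans
    (φ-cong (multilinear al) (λ { zero x → refl ; (suc i) x → refl })) (sym (ℚP.*-identityˡ (φ e)))
  φ-front {suc n} {φ} al (suc m) (suc j) eq = begin
    φ (front (suc j))          ≡⟨ swap-rows al {zero} {suc j} (λ ()) {front (inject₁ j)} {front (suc j)}
                                     (λ x → cong (λ i → e i x) (sym (punchIn-inject₁ j j FP.≤-refl)))
                                     (λ x → cong (λ i → e i x) (punchIn-suc j j FP.≤-refl))
                                     others ⟩
    - φ (front (inject₁ j))      ≡⟨ cong -_ (φ-front al m (inject₁ j) (trans (FP.toℕ-inject₁ j) (ℕP.suc-injective eq))) ⟩
    - (sgn m * φ e)              ≡⟨ ℚP.neg-distribˡ-* (sgn m) (φ e) ⟩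
    - sgn m * φ e                ∎
    where
    same : ∀ {n} (j i : Fin n) → i ≢ j → punchIn (suc j) i ≡ punchIn (inject₁ j) i
    same zero    zero    h = contradiction refl h
    same zero    (suc i) h = refl
    same (suc j) zero    h = refl
    same (suc j) (suc i) h = cong suc (same j i (h ∘ cong suc))
    others : ∀ q → q ≢ zero → q ≢ suc j → ∀ x → front (suc j) q x ≡ front (inject₁ j) q x
    others zero    h _ x = contradiction refl h
    others (suc i) _ h x = cong (λ i → e i x) (same j i (h ∘ cong suc))

  -- Expand the first row in unit vectors. Once it is e_j, column j of the other rows can be
  -- cleared, and what remains is an alternating form in the minor, to which induction applies.
  det-unique : ∀ n {φ : Matrix n n → ℚ} → Alternating φ → ∀ A → φ A ≡ φ e * det n A
  det-unique zero {φ} al A = trans (φ-cong (multilinear al) (λ ())) (sym (ℚP.*-identityʳ (φ e)))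
  det-unique (suc n) {φ} al A = begin
    φ A
      ≡⟨ φ-cong ml (≔-char {A = A} {r = zero} (λ j → sym (row-expand (A zero) j)) (λ _ _ _ → refl)) ⟩
    φ (A ⟨ zero ⟩≔ (λ j → Σℚ (suc n) (λ q → A zero q * e q j)))
      ≡⟨ φ-Σ ml A zero (A zero) e ⟩
    Σℚ (suc n) (λ j → A zero j * φ (A ⟨ zero ⟩≔ e j))
      ≡⟨ Σ-cong (λ j → trans (cong (A zero j *_) (reduce j)) (ring (A zero j) (sgn (toℕ j)) (φ e) (det n (minor A j)))) ⟩
    Σℚ (suc n) (λ j → φ e * (sgn (toℕ j) * A zero j * det n (minor A j)))
      ≡⟨ Σ-*ˡ (φ e) (λ j → sgn (toℕ j) * A zero j * det n (minor A j)) ⟩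
    φ e * det (suc n) A ∎
    where
    ml = multilinear al
    ring : ∀ a s f d → a * (s * f * d) ≡ f * (s * a * d)
    ring = solve-∀ ℚ-ring
    -- Multiples of the first row e j clear column j of the other rows.
    reduce : ∀ j → φ (A ⟨ zero ⟩≔ e j) ≡ sgn (toℕ j) * φ e * det n (minor A j)
    reduce j = begin
      φ (A ⟨ zero ⟩≔ e j)
        ≡⟨ φ-cong ml (λ { zero x → refl ; (suc i) x → refl }) ⟩
      φ (e j ∷ᶠ (A ∘ suc))
        ≡⟨ triangular (fix-row ml (e j)) (λ i → ins0 j (minor A j i)) (λ i x → A (suc i) j * e j x) (A ∘ suc)
             (λ _ → 1ℚ) (λ i → ins0-minor j (A (suc i))) killed ⟩
      Π {n} (λ _ → 1ℚ) * φ (e j ∷ᶠ (λ i → ins0 j (minor A j i)))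
        ≡⟨ trans (cong (_* φ (e j ∷ᶠ (λ i → ins0 j (minor A j i)))) (Π-1 {n})) (ℚP.*-identityˡ _) ⟩
      φ (e j ∷ᶠ (λ i → ins0 j (minor A j i)))
        ≡⟨ det-unique n (ins0-alternating (fix-row-alt al (e j)) j) (minor A j) ⟩
      φ (e j ∷ᶠ (λ i → ins0 j (e i))) * det n (minor A j)
        ≡⟨ cong (_* det n (minor A j)) (φ-cong ml (λ { zero x → refl ; (suc i) x → ins0-e j i x })) ⟩
      φ (front j) * det n (minor A j)
        ≡⟨ cong (_* det n (minor A j)) (φ-front al (toℕ j) j refl) ⟩
      sgn (toℕ j) * φ e * det n (minor A j) ∎
      where
      killed : ∀ r B → (∀ q → q F.< r → ∀ x → B q x ≡ ins0 j (minor A j q) x) →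
               (∀ x → B r x ≡ A (suc r) j * e j x) → φ (e j ∷ᶠ B) ≡ 0ℚ
      killed r B _ h = scaled-rows al (A (suc r) j) {e j ∷ᶠ B} {suc r} {zero} (λ ()) h

  det-e : ∀ n → det n e ≡ 1ℚ
  det-e zero    = refl
  det-e (suc n) = begin
    Σℚ (suc n) (λ j → sgn (toℕ j) * e zero j * det n (minor e j))
      ≡⟨ Σ-single (λ j → sgn (toℕ j) * e zero j * det n (minor e j)) zero off ⟩
    1ℚ * 1ℚ * det n (minor e zero)
      ≡⟨ cong (1ℚ * 1ℚ *_) (det-e n) ⟩
    1ℚ ∎
    where
    ring : ∀ a b → a * 0ℚ * b ≡ 0ℚ
    ring = solve-∀ ℚ-ring
    off : ∀ j → j ≢ zero → sgn (toℕ j) * e zero j * det n (minor e j) ≡ 0ℚ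
    off zero    h = contradiction refl h
    off (suc j) h = ring (sgn (toℕ (suc j))) (det n (minor e (suc j)))

  -- Product and trace formulas for a linear map acting on the rows

  record Linear {m n} (X : Row m → Row n) : Set where
    field
      X-cong : ∀ {u v} → (∀ j → u j ≡ v j) → ∀ j → X u j ≡ X v j
      X-lin  : ∀ t u v j → X (λ i → t * u i + v i) j ≡ t * X u j + X v j
  open Linear

  -- The left-hand side is alternating in A, so `det-unique` applies. This is multiplicativity of
  -- the determinant with the linear map X in the role of the right factor.
  det-* : ∀ n {X : Row n → Row n} → Linear X → ∀ A → det n (λ i → X (A i)) ≡ det n (λ i → X (e i)) * det n A
  det-* n {X} lin = det-unique n record
    { multilinear = record
      { φ-cong = λ h → det-cong n (λ i → X-cong lin (h i))
      ; φ-lin  = λ A r t u v → begin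
          det n (λ i → X ((A ⟨ r ⟩≔ (λ j → t * u j + v j)) i))
            ≡⟨ push A r (λ j → t * u j + v j) ⟩
          det n ((λ i → X (A i)) ⟨ r ⟩≔ X (λ j → t * u j + v j))
            ≡⟨ det-cong n (≔-cong (λ _ _ _ → refl) (X-lin lin t u v)) ⟩
          det n ((λ i → X (A i)) ⟨ r ⟩≔ (λ j → t * X u j + X v j))
            ≡⟨ det-lin n (λ i → X (A i)) r t (X u) (X v) ⟩
          t * det n ((λ i → X (A i)) ⟨ r ⟩≔ X u) + det n ((λ i → X (A i)) ⟨ r ⟩≔ X v)
            ≡⟨ cong₂ (λ a b → t * a + b) (push A r u) (push A r v) ⟨
          t * det n (λ i → X ((A ⟨ r ⟩≔ u) i)) + det n (λ i → X ((A ⟨ r ⟩≔ v) i)) ∎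
      }
    ; φ-alt = λ A r≢s h → det-alt n (λ i → X (A i)) r≢s (X-cong lin h)
    }
    where
    push : ∀ A r u → det n (λ i → X ((A ⟨ r ⟩≔ u) i)) ≡ det n ((λ i → X (A i)) ⟨ r ⟩≔ X u)
    push A r u = det-cong n (≔-char (X-cong lin (≔-updates A r u)) (λ s s≢r → X-cong lin (≔-minimal A u s≢r)))

  Σ-pair : ∀ {n} (f : Fin n → ℚ) {i j} → i ≢ j → (∀ q → q ≢ i → q ≢ j → f q ≡ 0ℚ) → Σℚ n f ≡ f i + f j
  Σ-pair {suc n} f {zero}  {zero}  i≢j h = contradiction refl i≢j
  Σ-pair {suc n} f {zero}  {suc j} i≢j h = cong (f zero +_)
    (Σ-single (f ∘ suc) j (λ q q≢j → h (suc q) (λ ()) (q≢j ∘ FP.suc-injective)))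
  Σ-pair {suc n} f {suc i} {zero}  i≢j h = trans (cong (f zero +_)
    (Σ-single (f ∘ suc) i (λ q q≢i → h (suc q) (q≢i ∘ FP.suc-injective) (λ ())))) (ℚP.+-comm (f zero) (f (suc i)))
  Σ-pair {suc n} f {suc i} {suc j} i≢j h = trans (cong₂ _+_ (h zero (λ ()) (λ ()))
    (Σ-pair (f ∘ suc) (i≢j ∘ cong suc) (λ q q≢i q≢j → h (suc q) (q≢i ∘ FP.suc-injective) (q≢j ∘ FP.suc-injective))))
    (ℚP.+-identityˡ _)

  -- The left-hand side is alternating multilinear in A, hence determined by its value at A = e.
  det-trace : ∀ n {X : Row n → Row n} → Linear X → ∀ A →
              Σℚ n (λ r → det n (A ⟨ r ⟩≔ X (A r))) ≡ Σℚ n (λ i → X (e i) i) * det n A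
  det-trace n {X} lin A = trans (det-unique n {φ} record
    { multilinear = record { φ-cong = cong-φ ; φ-lin = lin-φ } ; φ-alt = alt-φ } A)
    (cong (_* det n A) (Σ-cong at-e))
    where
    d : Matrix n n → Fin n → ℚ
    d A r = det n (A ⟨ r ⟩≔ X (A r))
    φ : Matrix n n → ℚ
    φ A = Σℚ n (d A)
    cong-φ : ∀ {A B} → A ≐ B → φ A ≡ φ B
    cong-φ h = Σ-cong λ r → det-cong n (≔-cong (λ s _ → h s) (X-cong lin (h r)))
    lin-d : ∀ A r t u v q → d (A ⟨ r ⟩≔ (λ j → t * u j + v j)) q ≡ t * d (A ⟨ r ⟩≔ u) q + d (A ⟨ r ⟩≔ v) q
    lin-d A r t u v q with q FP.≟ r
    ... | yes refl = begin
      d (A ⟨ r ⟩≔ w) r                                       ≡⟨ at-r w ⟩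
      det n (A ⟨ r ⟩≔ X w)                                    ≡⟨ det-cong n (≔-cong (λ _ _ _ → refl) (X-lin lin t u v)) ⟩
      det n (A ⟨ r ⟩≔ (λ j → t * X u j + X v j))              ≡⟨ det-lin n A r t (X u) (X v) ⟩
      t * det n (A ⟨ r ⟩≔ X u) + det n (A ⟨ r ⟩≔ X v)         ≡⟨ cong₂ (λ a b → t * a + b) (at-r u) (at-r v) ⟨
      t * d (A ⟨ r ⟩≔ u) r + d (A ⟨ r ⟩≔ v) r                 ∎
      where
      w = λ j → t * u j + v j
      at-r : ∀ w → d (A ⟨ r ⟩≔ w) r ≡ det n (A ⟨ r ⟩≔ X w)
      at-r w = det-cong n (≔-cong (λ s s≢r → ≔-minimal A w s≢r) (X-cong lin (≔-updates A r w)))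
    ... | no q≢r = begin
      d (A ⟨ r ⟩≔ w) q                                       ≡⟨ at-q w ⟩
      det n (A ⟨ q ⟩≔ X (A q) ⟨ r ⟩≔ w)                       ≡⟨ det-lin n (A ⟨ q ⟩≔ X (A q)) r t u v ⟩
      t * det n (A ⟨ q ⟩≔ X (A q) ⟨ r ⟩≔ u) + det n (A ⟨ q ⟩≔ X (A q) ⟨ r ⟩≔ v) ≡⟨ cong₂ (λ a b → t * a + b) (at-q u) (at-q v) ⟨
      t * d (A ⟨ r ⟩≔ u) q + d (A ⟨ r ⟩≔ v) q                 ∎
      where
      w = λ j → t * u j + v j
      at-q : ∀ w → d (A ⟨ r ⟩≔ w) q ≡ det n (A ⟨ q ⟩≔ X (A q) ⟨ r ⟩≔ w)
      at-q w = trans (det-cong n (≔-cong (λ _ _ _ → refl) (X-cong lin (≔-minimal A w q≢r))))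
                     (det-cong n (≔-comm A w (X (A q)) (q≢r ∘ sym)))
    lin-φ : ∀ A r t u v → φ (A ⟨ r ⟩≔ (λ j → t * u j + v j)) ≡ t * φ (A ⟨ r ⟩≔ u) + φ (A ⟨ r ⟩≔ v)
    lin-φ A r t u v = begin
      Σℚ n (d (A ⟨ r ⟩≔ (λ j → t * u j + v j)))                        ≡⟨ Σ-cong (lin-d A r t u v) ⟩
      Σℚ n (λ q → t * d (A ⟨ r ⟩≔ u) q + d (A ⟨ r ⟩≔ v) q)             ≡⟨ Σ-+ (λ q → t * d (A ⟨ r ⟩≔ u) q) (d (A ⟨ r ⟩≔ v)) ⟩
      Σℚ n (λ q → t * d (A ⟨ r ⟩≔ u) q) + φ (A ⟨ r ⟩≔ v)               ≡⟨ cong (_+ φ (A ⟨ r ⟩≔ v)) (Σ-*ˡ t (d (A ⟨ r ⟩≔ u))) ⟩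
      t * φ (A ⟨ r ⟩≔ u) + φ (A ⟨ r ⟩≔ v)                              ∎
    alt-φ : ∀ A {r s} → r ≢ s → (∀ j → A r j ≡ A s j) → φ A ≡ 0ℚ
    alt-φ A {r} {s} r≢s h = begin
      -- Terms with q outside {r, s} still have two equal rows; the other two differ by exchanging
      -- rows r and s.
      φ A           ≡⟨ Σ-pair (d A) r≢s (λ q q≢r q≢s → det-alt n (A ⟨ q ⟩≔ X (A q)) r≢s (λ j →
                         trans (≔-minimal A (X (A q)) (q≢r ∘ sym) j) (trans (h j) (sym (≔-minimal A (X (A q)) (q≢s ∘ sym) j))))) ⟩
      d A r + d A s ≡⟨ cong (_+ d A s) (swap-rows (det-alternating n) r≢s {A ⟨ s ⟩≔ X (A s)} {A ⟨ r ⟩≔ X (A r)}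
                         (λ j → trans (≔-updates A r (X (A r)) j) (trans (X-cong lin h j) (sym (≔-updates A s (X (A s)) j))))
                         (λ j → trans (≔-minimal A (X (A r)) (r≢s ∘ sym) j) (trans (sym (h j)) (sym (≔-minimal A (X (A s)) r≢s j))))
                         (λ q q≢r q≢s j → trans (≔-minimal A (X (A r)) q≢r j) (sym (≔-minimal A (X (A s)) q≢s j)))) ⟩
      - d A s + d A s ≡⟨ ℚP.+-inverseˡ (d A s) ⟩
      0ℚ            ∎
    at-e : ∀ i → d e i ≡ X (e i) i
    at-e i = begin
      det n (e ⟨ i ⟩≔ X (e i))
        ≡⟨ det-cong n (≔-cong (λ _ _ _ → refl) (λ j → sym (row-expand (X (e i)) j))) ⟩
      det n (e ⟨ i ⟩≔ (λ j → Σℚ n (λ q → X (e i) q * e q j)))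
        ≡⟨ φ-Σ (det-multilinear n) e i (X (e i)) e ⟩
      Σℚ n (λ q → X (e i) q * det n (e ⟨ i ⟩≔ e q))
        ≡⟨ Σ-single (λ q → X (e i) q * det n (e ⟨ i ⟩≔ e q)) i (λ q q≢i → trans (cong (X (e i) q *_)
             (det-alt n (e ⟨ i ⟩≔ e q) (q≢i ∘ sym) (λ j → trans (≔-updates e i (e q) j) (sym (≔-minimal e (e q) q≢i j)))))
             (ℚP.*-zeroʳ (X (e i) q))) ⟩
      X (e i) i * det n (e ⟨ i ⟩≔ e i)
        ≡⟨ cong (X (e i) i *_) (trans (sym (det-cong n (≔-self e i))) (det-e n)) ⟩
      X (e i) i * 1ℚ
        ≡⟨ ℚP.*-identityʳ (X (e i) i) ⟩
      X (e i) i ∎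

  -- Rows x ^ c * exp (± x), and the trace identities

  recip! : ℕ → ℚ
  recip! m = recipΓ (pos (suc m))

  recip!-suc : ∀ m → ι (suc m) * recip! (suc m) ≡ recip! m
  recip!-suc m = ι-cancel (m !) {{m ℕP.!≢0}} (begin
    ι (m !) * (ι (suc m) * recip! (suc m)) ≡⟨ ring (ι (m !)) (ι (suc m)) (recip! (suc m)) ⟩
    recip! (suc m) * (ι (suc m) * ι (m !)) ≡⟨ cong (recip! (suc m) *_) (ι-* (suc m) (m !)) ⟨
    recip! (suc m) * ι ((suc m) !)         ≡⟨ recip-*ι ((suc m) !) {{suc m ℕP.!≢0}} ⟩
    1ℚ                                 ≡⟨ recip-*ι (m !) {{m ℕP.!≢0}} ⟨
    recip! m * ι (m !)                     ≡⟨ ℚP.*-comm (recip! m) (ι (m !)) ⟩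
    ι (m !) * recip! m                     ∎)
    where
    ring : ∀ a b c → a * (b * c) ≡ c * (b * a)
    ring = solve-∀ ℚ-ring

  pw : ℚ → ℕ → ℚ
  pw x zero    = 1ℚ
  pw x (suc n) = x * pw x n

  -- The coefficient of x ^ m in x ^ c * exp (ε x).
  coef : ℚ → ℕ → ℕ → ℚ
  coef ε zero    m       = pw ε m * recip! m
  coef ε (suc c) zero    = 0ℚ
  coef ε (suc c) (suc m) = coef ε c m

  -- x (d/dx) x ^ c * exp (ε x) = c x ^ c * exp (ε x) + ε x ^ (c + 1) * exp (ε x).
  coef-euler : ∀ ε c m → ι m * coef ε c m ≡ ι c * coef ε c m + ε * coef ε (suc c) m
  coef-euler ε zero    zero    = ring (coef ε 0 0) ε
    where
    ring : ∀ x ε → 0ℚ * x ≡ 0ℚ * x + ε * 0ℚ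
    ring = solve-∀ ℚ-ring
  coef-euler ε zero    (suc m) = begin
    ι (suc m) * ((ε * pw ε m) * recip! (suc m))    ≡⟨ ring (ι (suc m)) ε (pw ε m) (recip! (suc m)) ⟩
    0ℚ * ((ε * pw ε m) * recip! (suc m)) + ε * (pw ε m * (ι (suc m) * recip! (suc m)))
      ≡⟨ cong (λ x → 0ℚ * ((ε * pw ε m) * recip! (suc m)) + ε * (pw ε m * x)) (recip!-suc m) ⟩
    0ℚ * ((ε * pw ε m) * recip! (suc m)) + ε * (pw ε m * recip! m) ∎
    where
    ring : ∀ a ε p r → a * ((ε * p) * r) ≡ 0ℚ * ((ε * p) * r) + ε * (p * (a * r))
    ring = solve-∀ ℚ-ring
  coef-euler ε (suc c) zero    = ring (ι (suc c)) ε
    where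
    ring : ∀ x ε → 0ℚ * 0ℚ ≡ x * 0ℚ + ε * 0ℚ
    ring = solve-∀ ℚ-ring
  coef-euler ε (suc c) (suc m) = begin
    (1ℚ + ι m) * coef ε c m                             ≡⟨ ring₁ (ι m) (coef ε c m) ⟩
    coef ε c m + ι m * coef ε c m                       ≡⟨ cong (coef ε c m +_) (coef-euler ε c m) ⟩
    coef ε c m + (ι c * coef ε c m + ε * coef ε (suc c) m) ≡⟨ ring₂ (ι c) (coef ε c m) (ε * coef ε (suc c) m) ⟩
    (1ℚ + ι c) * coef ε c m + ε * coef ε (suc c) m      ∎
    where
    ring₁ : ∀ a b → (1ℚ + a) * b ≡ b + a * b
    ring₁ = solve-∀ ℚ-ring
    ring₂ : ∀ a b c → b + (a * b + c) ≡ (1ℚ + a) * b + c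
    ring₂ = solve-∀ ℚ-ring

  coef-shift : ∀ ε s c m → coef ε (s ℕ.+ c) (s ℕ.+ m) ≡ coef ε c m
  coef-shift ε zero    c m = refl
  coef-shift ε (suc s) c m = coef-shift ε s c m

  coef-low : ∀ ε s c m → m < s → coef ε (s ℕ.+ c) m ≡ 0ℚ
  coef-low ε (suc s) c zero    _         = refl
  coef-low ε (suc s) c (suc m) (s≤s m<s) = coef-low ε s c m m<s

  -- Column j of an n-column matrix holds the coefficient of x ^ (n - 1 - j).
  coefRow : ∀ {n} → ℚ → ℕ → Row n
  coefRow {n} ε c j = coef ε c (n ∸ suc (toℕ j))

  -- The value 0 beyond the last column is the coefficient of a negative power of x. Truncation at x
  -- ^ n, by contrast, takes place at the left end, where no column exists.
  get : ∀ {n} → Row n → ℕ → ℚ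
  get {zero}  f m       = 0ℚ
  get {suc n} f zero    = f zero
  get {suc n} f (suc m) = get (f ∘ suc) m

  get-cong : ∀ {n} {f g : Row n} → (∀ j → f j ≡ g j) → ∀ m → get f m ≡ get g m
  get-cong {zero}  h m       = refl
  get-cong {suc n} h zero    = h zero
  get-cong {suc n} h (suc m) = get-cong (h ∘ suc) m

  get-lin : ∀ {n} t (u v : Row n) m → get (λ j → t * u j + v j) m ≡ t * get u m + get v m
  get-lin {zero}  t u v m       = sym (trans (cong (_+ 0ℚ) (ℚP.*-zeroʳ t)) refl)
  get-lin {suc n} t u v zero    = refl
  get-lin {suc n} t u v (suc m) = get-lin t (u ∘ suc) (v ∘ suc) m

  get-< : ∀ {n} (h : ℕ → ℚ) m → m < n → get {n} (h ∘ toℕ) m ≡ h m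
  get-< {suc n} h zero    _         = refl
  get-< {suc n} h (suc m) (s≤s m<n) = get-< (h ∘ suc) m m<n

  get-≥ : ∀ {n} (f : Row n) m → n ≤ m → get f m ≡ 0ℚ
  get-≥ {zero}  f m       _         = refl
  get-≥ {suc n} f (suc m) (s≤s n≤m) = get-≥ (f ∘ suc) m n≤m

  get-toℕ : ∀ {n} (f : Row n) j → get f (toℕ j) ≡ f j
  get-toℕ f zero    = refl
  get-toℕ f (suc j) = get-toℕ (f ∘ suc) j

  get-e : ∀ {n} (i : Fin n) m → m ≢ toℕ i → get (e i) m ≡ 0ℚ
  get-e zero    zero    h = contradiction refl h
  get-e {suc n} zero (suc m) h = aux n m
    where
    aux : ∀ n m → get {n} (λ _ → 0ℚ) m ≡ 0ℚ
    aux zero    m       = refl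
    aux (suc n) zero    = refl
    aux (suc n) (suc m) = aux n m
  get-e (suc i) zero    h = refl
  get-e (suc i) (suc m) h = get-e i m (h ∘ cong suc)

  -- Multiplication by x ^ s.
  shift : ∀ {n} → ℕ → Row n → Row n
  shift s f j = get f (toℕ j ℕ.+ s)

  shift-linear : ∀ {n} s → Linear (shift {n} s)
  shift-linear s = record
    { X-cong = λ h j → get-cong h (toℕ j ℕ.+ s)
    ; X-lin  = λ t u v j → get-lin t u v (toℕ j ℕ.+ s)
    }

  shift-coefRow : ∀ {n} s ε c (j : Fin n) → shift s (coefRow ε c) j ≡ coefRow ε (s ℕ.+ c) j
  shift-coefRow {n} s ε c j with toℕ j ℕ.+ s ℕP.<? n
  ... | yes j+s<n = begin
    get {n} (coefRow ε c) (toℕ j ℕ.+ s)           ≡⟨ get-< (λ m → coef ε c (n ∸ suc m)) (toℕ j ℕ.+ s) j+s<n ⟩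
    coef ε c m                                    ≡⟨ coef-shift ε s c m ⟨
    coef ε (s ℕ.+ c) (s ℕ.+ m)                    ≡⟨ cong (coef ε (s ℕ.+ c)) m+s ⟩
    coef ε (s ℕ.+ c) (n ∸ suc (toℕ j))            ∎
    where
    m = n ∸ suc (toℕ j ℕ.+ s)
    m+s : s ℕ.+ m ≡ n ∸ suc (toℕ j)
    m+s = trans (cong (s ℕ.+_) (sym (ℕP.∸-+-assoc n (suc (toℕ j)) s)))
                (ℕP.m+[n∸m]≡n (ℕP.m+n≤o⇒m≤o∸n s (subst (ℕ._≤ n) (ℕP.+-comm (suc (toℕ j)) s) j+s<n)))
  ... | no j+s≮n = trans (get-≥ (coefRow ε c) (toℕ j ℕ.+ s) (ℕP.≮⇒≥ j+s≮n))
    (sym (coef-low ε s c (n ∸ suc (toℕ j)) low))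
    where
    low : n ∸ suc (toℕ j) < s
    low = ℕP.+-cancelˡ-< (suc (toℕ j)) _ _ (subst (ℕ._< suc (toℕ j) ℕ.+ s) (sym (ℕP.m+[n∸m]≡n (FP.toℕ<n j))) (s≤s (ℕP.≮⇒≥ j+s≮n)))

  -- Multiplication by a positive power of x strictly raises the degree, so its diagonal is zero.
  -- The same reason gives `deriv-trace`.
  shift-trace : ∀ {n} s (i : Fin n) → shift (suc s) (e i) i ≡ 0ℚ
  shift-trace s i = get-e i (toℕ i ℕ.+ suc s) (ℕP.m+1+n≢m (toℕ i))

  -- x ^ (s + 1) (d/dx).
  deriv : ∀ {n} → ℕ → Row n → Row n
  deriv {n} s f = shift s (λ j → ι (n ∸ suc (toℕ j)) * f j)

  deriv-linear : ∀ {n} s → Linear (deriv {n} s)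
  deriv-linear {n} s = record
    { X-cong = λ h → X-cong (shift-linear s) (λ j → cong (ι (n ∸ suc (toℕ j)) *_) (h j))
    ; X-lin  = λ t u v j → trans
        (X-cong (shift-linear s) (λ j → ring (ι (n ∸ suc (toℕ j))) t (u j) (v j)) j)
        (X-lin (shift-linear s) t (λ j → ι (n ∸ suc (toℕ j)) * u j) (λ j → ι (n ∸ suc (toℕ j)) * v j) j)
    }
    where
    ring : ∀ a t u v → a * (t * u + v) ≡ t * (a * u) + a * v
    ring = solve-∀ ℚ-ring

  deriv-coefRow : ∀ {n} s ε c (j : Fin n) →
                  deriv s (coefRow ε c) j ≡ ι c * coefRow ε (s ℕ.+ c) j + ε * coefRow ε (suc s ℕ.+ c) j
  deriv-coefRow {n} s ε c j = begin
    deriv s (coefRow ε c) j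
      ≡⟨ X-cong lin (λ i → coef-euler ε c (n ∸ suc (toℕ i))) j ⟩
    shift s (λ i → ι c * coefRow ε c i + ε * coefRow ε (suc c) i) j
      ≡⟨ X-lin lin (ι c) (coefRow ε c) (λ i → ε * coefRow ε (suc c) i) j ⟩
    ι c * shift s (coefRow ε c) j + shift s (λ i → ε * coefRow ε (suc c) i) j
      ≡⟨ cong₂ (λ a b → ι c * a + b) (shift-coefRow s ε c j) (trans (X-scale ε (coefRow ε (suc c)))
          (cong (ε *_) (trans (shift-coefRow s ε (suc c) j) (cong (λ c′ → coefRow ε c′ j) (ℕP.+-suc s c))))) ⟩
    ι c * coefRow ε (s ℕ.+ c) j + ε * coefRow ε (suc s ℕ.+ c) j ∎
    where
    lin : Linear (shift {n} s)
    lin = shift-linear s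
    X-scale : ∀ t (u : Row n) → shift s (λ i → t * u i) j ≡ t * shift s u j
    X-scale t u = get-scale u (toℕ j ℕ.+ s)
      where
      get-scale : ∀ {n} (u : Row n) m → get (λ i → t * u i) m ≡ t * get u m
      get-scale {zero}  u m       = sym (ℚP.*-zeroʳ t)
      get-scale {suc n} u zero    = refl
      get-scale {suc n} u (suc m) = get-scale (u ∘ suc) m

  deriv-trace : ∀ {n} s (i : Fin n) → deriv (suc s) (e i) i ≡ 0ℚ
  deriv-trace {n} s i = get-scaled (λ j → ι (n ∸ suc (toℕ j))) (e i) (toℕ i ℕ.+ suc s) (shift-trace s i)
    where
    get-scaled : ∀ {n} (a u : Row n) m → get u m ≡ 0ℚ → get (λ j → a j * u j) m ≡ 0ℚ
    get-scaled {zero}  a u m       h = refl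
    get-scaled {suc n} a u zero    h = trans (cong (a zero *_) h) (ℚP.*-zeroʳ (a zero))
    get-scaled {suc n} a u (suc m) h = get-scaled (a ∘ suc) (u ∘ suc) m h

  -- x d/dx is diagonal on monomials, with the degree as eigenvalue.
  deriv-trace₀ : ∀ {n} (i : Fin n) → deriv 0 (e i) i ≡ ι (n ∸ suc (toℕ i))
  deriv-trace₀ {n} i = begin
    get (λ j → ι (n ∸ suc (toℕ j)) * e i j) (toℕ i ℕ.+ 0) ≡⟨ cong (get (λ j → ι (n ∸ suc (toℕ j)) * e i j)) (ℕP.+-identityʳ (toℕ i)) ⟩
    get (λ j → ι (n ∸ suc (toℕ j)) * e i j) (toℕ i)       ≡⟨ get-toℕ (λ j → ι (n ∸ suc (toℕ j)) * e i j) i ⟩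
    ι (n ∸ suc (toℕ i)) * e i i                           ≡⟨ cong (ι (n ∸ suc (toℕ i)) *_) (e-diag i) ⟩
    ι (n ∸ suc (toℕ i)) * 1ℚ                              ≡⟨ ℚP.*-identityʳ _ ⟩
    ι (n ∸ suc (toℕ i))                                   ∎

  -- Exponent sequences and the determinant `E`

  Idx : ℕ → Set
  Idx k = Fin k → ℕ

  bump : ∀ {k} → Fin k → ℕ → Idx k
  bump zero    r zero    = r
  bump zero    r (suc x) = 0
  bump (suc i) r zero    = 0
  bump (suc i) r (suc x) = bump i r x

  bump-diag : ∀ {k} (i : Fin k) r → bump i r i ≡ r
  bump-diag zero    r = refl
  bump-diag (suc i) r = bump-diag i r

  bump-off : ∀ {k} (i : Fin k) r x → x ≢ i → bump i r x ≡ 0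
  bump-off zero    r zero    h = contradiction refl h
  bump-off zero    r (suc x) h = refl
  bump-off (suc i) r zero    h = refl
  bump-off (suc i) r (suc x) h = bump-off i r x (h ∘ cong suc)

  bump-+ : ∀ {k} (i : Fin k) r s x → bump i r x ℕ.+ bump i s x ≡ bump i (r ℕ.+ s) x
  bump-+ zero    r s zero    = refl
  bump-+ zero    r s (suc x) = refl
  bump-+ (suc i) r s zero    = refl
  bump-+ (suc i) r s (suc x) = bump-+ i r s x

  infixl 6 _[_]+_
  _[_]+_ : ∀ {k} → Idx k → Fin k → ℕ → Idx k
  (c [ i ]+ r) x = c x ℕ.+ bump i r x

  []+-diag : ∀ {k} (c : Idx k) i r → (c [ i ]+ r) i ≡ c i ℕ.+ r
  []+-diag c i r = cong (c i ℕ.+_) (bump-diag i r)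

  []+-off : ∀ {k} (c : Idx k) i r x → x ≢ i → (c [ i ]+ r) x ≡ c x
  []+-off c i r x h = trans (cong (c x ℕ.+_) (bump-off i r x h)) (ℕP.+-identityʳ (c x))

  ++-≔ˡ : ∀ {k l n} (u : Matrix k n) (v : Matrix l n) i w {B : Matrix k n} → B ≐ u ⟨ i ⟩≔ w →
          B ++ᶠ v ≐ (u ++ᶠ v) ⟨ i ↑ˡ l ⟩≔ w
  ++-≔ˡ {k} {l} u v i w {B} h = ≔-char
    (λ j → trans (cong (λ r → r j) (lookup-++ˡ B v i)) (trans (h i j) (≔-updates u i w j)))
    other
    where
    other : ∀ s → s ≢ i ↑ˡ l → ∀ j → (B ++ᶠ v) s j ≡ (u ++ᶠ v) s j
    other s s≢ j with splitAt k s in eq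
    ... | inj₁ i′ = trans (h i′ j) (≔-minimal u w (λ { refl → s≢ (sym (FP.splitAt⁻¹-↑ˡ eq)) }) j)
    ... | inj₂ _  = refl

  ++-≔ʳ : ∀ {k l n} (u : Matrix k n) (v : Matrix l n) i w {B : Matrix l n} → B ≐ v ⟨ i ⟩≔ w →
          u ++ᶠ B ≐ (u ++ᶠ v) ⟨ k ↑ʳ i ⟩≔ w
  ++-≔ʳ {k} {l} u v i w {B} h = ≔-char
    (λ j → trans (cong (λ r → r j) (lookup-++ʳ u B i)) (trans (h i j) (≔-updates v i w j)))
    other
    where
    other : ∀ s → s ≢ k ↑ʳ i → ∀ j → (u ++ᶠ B) s j ≡ (u ++ᶠ v) s j
    other s s≢ j with splitAt k s in eq
    ... | inj₁ _  = refl
    ... | inj₂ i′ = trans (h i′ j) (≔-minimal v w (λ { refl → s≢ (sym (FP.splitAt⁻¹-↑ʳ eq)) }) j)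

  coefRows : ∀ {k n} → ℚ → Idx k → Matrix k n
  coefRows ε c i = coefRow ε (c i)

  coefRows-bump : ∀ {k n} ε (c : Idx k) i s → coefRows {n = n} ε (c [ i ]+ s) ≐ coefRows ε c ⟨ i ⟩≔ coefRow ε (s ℕ.+ c i)
  coefRows-bump ε c i s = ≔-char
    (λ j → cong (λ a → coefRow ε a j) (trans ([]+-diag c i s) (ℕP.+-comm (c i) s)))
    (λ x x≢i j → cong (λ a → coefRow ε a j) ([]+-off c i s x x≢i))

  E : ∀ k → Idx k → Idx k → ℚ
  E k c d = det (k ℕ.+ k) (coefRows 1ℚ c ++ᶠ coefRows (- 1ℚ) d)

  module _ {k : ℕ} where
    private
      n = k ℕ.+ k
      A : Idx k → Idx k → Matrix n n
      A c d = coefRows 1ℚ c ++ᶠ coefRows (- 1ℚ) d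

    E-bumpˡ : ∀ c d i s → E k (c [ i ]+ s) d ≡ det n (A c d ⟨ i ↑ˡ k ⟩≔ coefRow 1ℚ (s ℕ.+ c i))
    E-bumpˡ c d i s = det-cong n (++-≔ˡ (coefRows 1ℚ c) (coefRows (- 1ℚ) d) i _ (coefRows-bump 1ℚ c i s))

    E-bumpʳ : ∀ c d i s → E k c (d [ i ]+ s) ≡ det n (A c d ⟨ k ↑ʳ i ⟩≔ coefRow (- 1ℚ) (s ℕ.+ d i))
    E-bumpʳ c d i s = det-cong n (++-≔ʳ (coefRows 1ℚ c) (coefRows (- 1ℚ) d) i _ (coefRows-bump (- 1ℚ) d i s))

    A-ˡ : ∀ c d i j → A c d (i ↑ˡ k) j ≡ coefRow 1ℚ (c i) j
    A-ˡ c d i j = cong (λ r → r j) (lookup-++ˡ (coefRows 1ℚ c) (coefRows (- 1ℚ) d) i)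

    A-ʳ : ∀ c d i j → A c d (k ↑ʳ i) j ≡ coefRow (- 1ℚ) (d i) j
    A-ʳ c d i j = cong (λ r → r j) (lookup-++ʳ (coefRows 1ℚ c) (coefRows (- 1ℚ) d) i)

    E-cong : ∀ {c c′ d d′} → (∀ i → c i ≡ c′ i) → (∀ i → d i ≡ d′ i) → E k c d ≡ E k c′ d′
    E-cong {c} {c′} {d} {d′} hc hd = det-cong n aux
      where
      aux : A c d ≐ A c′ d′
      aux r j with splitAt k r
      ... | inj₁ i = cong (λ a → coefRow 1ℚ a j) (hc i)
      ... | inj₂ i = cong (λ a → coefRow (- 1ℚ) a j) (hd i)

    E-trace : ∀ {X : Row n → Row n} (lin : Linear X) c d →
              Σℚ k (λ i → det n (A c d ⟨ i ↑ˡ k ⟩≔ X (coefRow 1ℚ (c i)))) +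
              Σℚ k (λ i → det n (A c d ⟨ k ↑ʳ i ⟩≔ X (coefRow (- 1ℚ) (d i))))
              ≡ Σℚ n (λ i → X (e i) i) * E k c d
    E-trace {X} lin c d = begin
      Σℚ k (λ i → det n (A c d ⟨ i ↑ˡ k ⟩≔ X (coefRow 1ℚ (c i)))) +
      Σℚ k (λ i → det n (A c d ⟨ k ↑ʳ i ⟩≔ X (coefRow (- 1ℚ) (d i))))
        ≡⟨ cong₂ _+_ (Σ-cong (λ i → det-cong n (≔-cong (λ _ _ _ → refl) (X-cong lin (sym ∘ A-ˡ c d i)))))
                     (Σ-cong (λ i → det-cong n (≔-cong (λ _ _ _ → refl) (X-cong lin (sym ∘ A-ʳ c d i))))) ⟩
      Σℚ k (λ i → f (i ↑ˡ k)) + Σℚ k (λ i → f (k ↑ʳ i))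
        ≡⟨ Σ-↑ k k f ⟨
      Σℚ n f
        ≡⟨ det-trace n lin (A c d) ⟩
      Σℚ n (λ i → X (e i) i) * E k c d ∎
      where
      f : Fin n → ℚ
      f r = det n (A c d ⟨ r ⟩≔ X (A c d r))

    E-shift : ∀ s c d → Σℚ k (λ i → E k (c [ i ]+ suc s) d) + Σℚ k (λ i → E k c (d [ i ]+ suc s)) ≡ 0ℚ
    E-shift s c d = begin
      Σℚ k (λ i → E k (c [ i ]+ suc s) d) + Σℚ k (λ i → E k c (d [ i ]+ suc s))
        ≡⟨ cong₂ _+_
            (Σ-cong (λ i → trans (E-bumpˡ c d i (suc s)) (det-cong n (≔-cong (λ _ _ _ → refl) (sym ∘ shift-coefRow (suc s) 1ℚ (c i))))))
            (Σ-cong (λ i → trans (E-bumpʳ c d i (suc s)) (det-cong n (≔-cong (λ _ _ _ → refl) (sym ∘ shift-coefRow (suc s) (- 1ℚ) (d i)))))) ⟩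
      Σℚ k (λ i → det n (A c d ⟨ i ↑ˡ k ⟩≔ shift (suc s) (coefRow 1ℚ (c i)))) +
      Σℚ k (λ i → det n (A c d ⟨ k ↑ʳ i ⟩≔ shift (suc s) (coefRow (- 1ℚ) (d i))))
        ≡⟨ E-trace (shift-linear (suc s)) c d ⟩
      Σℚ n (λ i → shift (suc s) (e i) i) * E k c d
        ≡⟨ cong (_* E k c d) (Σ-zero {n} (shift-trace s)) ⟩
      0ℚ * E k c d
        ≡⟨ ℚP.*-zeroˡ (E k c d) ⟩
      0ℚ ∎

    -- The derivative of exp (ε x) contributes ε, which is -1 on the lower rows. Hence the actions
    -- of p_(s+1) on c and on d enter with opposite signs, and `E-shift` makes them add up: this is
    -- the factor 2 on the left of the recursions.
    E-euler : ∀ s c d →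
              Σℚ k (λ i → ι (c i) * E k (c [ i ]+ s) d + E k (c [ i ]+ suc s) d) +
              Σℚ k (λ i → ι (d i) * E k c (d [ i ]+ s) + - E k c (d [ i ]+ suc s))
              ≡ Σℚ n (λ i → deriv s (e i) i) * E k c d
    E-euler s c d = begin
      Σℚ k (λ i → ι (c i) * E k (c [ i ]+ s) d + E k (c [ i ]+ suc s) d) +
      Σℚ k (λ i → ι (d i) * E k c (d [ i ]+ s) + - E k c (d [ i ]+ suc s))
        ≡⟨ cong₂ _+_ (Σ-cong left) (Σ-cong right) ⟩
      Σℚ k (λ i → det n (A c d ⟨ i ↑ˡ k ⟩≔ deriv s (coefRow 1ℚ (c i)))) +
      Σℚ k (λ i → det n (A c d ⟨ k ↑ʳ i ⟩≔ deriv s (coefRow (- 1ℚ) (d i))))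
        ≡⟨ E-trace (deriv-linear s) c d ⟩
      Σℚ n (λ i → deriv s (e i) i) * E k c d ∎
      where
      row : ∀ r ε a → ι a * det n (A c d ⟨ r ⟩≔ coefRow ε (s ℕ.+ a)) + ε * det n (A c d ⟨ r ⟩≔ coefRow ε (suc s ℕ.+ a))
            ≡ det n (A c d ⟨ r ⟩≔ deriv s (coefRow ε a))
      row r ε a = sym (begin
        det n (A c d ⟨ r ⟩≔ deriv s (coefRow ε a))
          ≡⟨ det-cong n (≔-cong (λ _ _ _ → refl) (deriv-coefRow s ε a)) ⟩
        det n (A c d ⟨ r ⟩≔ (λ j → ι a * coefRow ε (s ℕ.+ a) j + ε * coefRow ε (suc s ℕ.+ a) j))
          ≡⟨ det-lin n (A c d) r (ι a) (coefRow ε (s ℕ.+ a)) (λ j → ε * coefRow ε (suc s ℕ.+ a) j) ⟩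
        ι a * det n (A c d ⟨ r ⟩≔ coefRow ε (s ℕ.+ a)) + det n (A c d ⟨ r ⟩≔ (λ j → ε * coefRow ε (suc s ℕ.+ a) j))
          ≡⟨ cong (ι a * det n (A c d ⟨ r ⟩≔ coefRow ε (s ℕ.+ a)) +_) (φ-* (det-multilinear n) (A c d) r ε (coefRow ε (suc s ℕ.+ a))) ⟩
        ι a * det n (A c d ⟨ r ⟩≔ coefRow ε (s ℕ.+ a)) + ε * det n (A c d ⟨ r ⟩≔ coefRow ε (suc s ℕ.+ a)) ∎)
      left : ∀ i → ι (c i) * E k (c [ i ]+ s) d + E k (c [ i ]+ suc s) d
             ≡ det n (A c d ⟨ i ↑ˡ k ⟩≔ deriv s (coefRow 1ℚ (c i)))
      left i = trans (cong₂ (λ a b → ι (c i) * a + b) (E-bumpˡ c d i s)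
                       (trans (E-bumpˡ c d i (suc s)) (sym (ℚP.*-identityˡ _))))
                     (row (i ↑ˡ k) 1ℚ (c i))
      right : ∀ i → ι (d i) * E k c (d [ i ]+ s) + - E k c (d [ i ]+ suc s)
              ≡ det n (A c d ⟨ k ↑ʳ i ⟩≔ deriv s (coefRow (- 1ℚ) (d i)))
      right i = trans (cong₂ (λ a b → ι (d i) * a + b) (E-bumpʳ c d i s)
                        (trans (cong -_ (E-bumpʳ c d i (suc s))) (neg≡-1* _)))
                      (row (k ↑ʳ i) (- 1ℚ) (d i))

    E-antiˡ : ∀ {i j} → i ≢ j → ∀ {c c′} → c′ i ≡ c j → c′ j ≡ c i → (∀ x → x ≢ i → x ≢ j → c′ x ≡ c x) →
              ∀ d → E k c′ d ≡ - E k c d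
    E-antiˡ {i} {j} i≢j {c} {c′} h₁ h₂ h₃ d =
      swap-rows (det-alternating n) (i≢j ∘ FP.↑ˡ-injective k i j) {A c d} {A c′ d}
        (λ x → trans (A-ˡ c′ d i x) (trans (cong (λ a → coefRow 1ℚ a x) h₁) (sym (A-ˡ c d j x))))
        (λ x → trans (A-ˡ c′ d j x) (trans (cong (λ a → coefRow 1ℚ a x) h₂) (sym (A-ˡ c d i x))))
        other
      where
      other : ∀ q → q ≢ i ↑ˡ k → q ≢ j ↑ˡ k → ∀ x → A c′ d q x ≡ A c d q x
      other q q≢i q≢j x with splitAt k q in eq
      ... | inj₁ y = cong (λ a → coefRow 1ℚ a x)
                       (h₃ y (λ { refl → q≢i (sym (FP.splitAt⁻¹-↑ˡ eq)) }) (λ { refl → q≢j (sym (FP.splitAt⁻¹-↑ˡ eq)) }))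
      ... | inj₂ y = refl

    E-antiʳ : ∀ {i j} → i ≢ j → ∀ {d d′} → d′ i ≡ d j → d′ j ≡ d i → (∀ x → x ≢ i → x ≢ j → d′ x ≡ d x) →
              ∀ c → E k c d′ ≡ - E k c d
    E-antiʳ {i} {j} i≢j {d} {d′} h₁ h₂ h₃ c =
      swap-rows (det-alternating n) (i≢j ∘ FP.↑ʳ-injective k i j) {A c d} {A c d′}
        (λ x → trans (A-ʳ c d′ i x) (trans (cong (λ a → coefRow (- 1ℚ) a x) h₁) (sym (A-ʳ c d j x))))
        (λ x → trans (A-ʳ c d′ j x) (trans (cong (λ a → coefRow (- 1ℚ) a x) h₂) (sym (A-ʳ c d i x))))
        other
      where
      other : ∀ q → q ≢ k ↑ʳ i → q ≢ k ↑ʳ j → ∀ x → A c d′ q x ≡ A c d q x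
      other q q≢i q≢j x with splitAt k q in eq
      ... | inj₁ y = refl
      ... | inj₂ y = cong (λ a → coefRow (- 1ℚ) a x)
                       (h₃ y (λ { refl → q≢i (sym (FP.splitAt⁻¹-↑ʳ eq)) }) (λ { refl → q≢j (sym (FP.splitAt⁻¹-↑ʳ eq)) }))

  -- The determinant for α = β = ∅

  -- The value 1 at 0 keeps f (0) in the last column of `T`, where differentiation alone would give
  -- 0; this makes `T` invertible.
  ι₁ : ℕ → ℚ
  ι₁ zero    = 1ℚ
  ι₁ (suc m) = ι (suc m)

  -- f ↦ (f′ - ε f , f (0)) in the coordinates of coefRow: the column of x ^ m holds the coefficient
  -- of x ^ (m - 1) in f′ - ε f for m > 0, and f (0) for m = 0.
  T : ∀ {n} → ℚ → Row (suc n) → Row (suc n)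
  T {n} ε f j = ι₁ (n ∸ toℕ j) * f j + (- ε) * shift 1 f j

  T-linear : ∀ {n} ε → Linear (T {n} ε)
  T-linear {n} ε = record
    { X-cong = λ h j → cong₂ (λ a b → ι₁ (n ∸ toℕ j) * a + (- ε) * b) (h j) (X-cong (shift-linear 1) h j)
    ; X-lin  = λ t u v j → trans
        (cong (λ b → ι₁ (n ∸ toℕ j) * (t * u j + v j) + (- ε) * b) (X-lin (shift-linear 1) t u v j))
        (ring (ι₁ (n ∸ toℕ j)) t (u j) (v j) ε (shift 1 u j) (shift 1 v j))
    }
    where
    ring : ∀ a t u v ε x y → a * (t * u + v) + (- ε) * (t * x + y) ≡ t * (a * u + (- ε) * x) + (a * v + (- ε) * y)
    ring = solve-∀ ℚ-ring

  Π-ι₁ : ∀ n → Π {suc n} (λ i → ι₁ (n ∸ toℕ i)) ≡ ι (n !)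
  Π-ι₁ zero    = refl
  Π-ι₁ (suc n) = trans (cong (ι (suc n) *_) (Π-ι₁ n)) (sym (ι-* (suc n) (n !)))

  -- `T` is triangular with diagonal n, ..., 1, 1: differentiation scales each unit vector by its
  -- degree, and the term with ε sends it to a multiple of the preceding one.
  det-T : ∀ n ε → det (suc n) (λ i → T ε (e i)) ≡ ι (n !)
  det-T n ε = begin
    det (suc n) (λ i → T ε (e i))
      ≡⟨ triangular (det-multilinear (suc n)) e z (λ i → T ε (e i)) t split killed ⟩
    Π t * det (suc n) e
      ≡⟨ cong₂ _*_ (Π-ι₁ n) (det-e (suc n)) ⟩
    ι (n !) * 1ℚ
      ≡⟨ ℚP.*-identityʳ (ι (n !)) ⟩
    ι (n !) ∎
    where
    t : Fin (suc n) → ℚ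
    t i = ι₁ (n ∸ toℕ i)
    z : Matrix (suc n) (suc n)
    z i j = (- ε) * shift 1 (e i) j
    split : ∀ i j → T ε (e i) j ≡ t i * e i j + z i j
    split i j with i FP.≟ j
    ... | yes refl = refl
    ... | no i≢j = cong (_+ z i j) (trans (zeroed (t j)) (sym (zeroed (t i))))
      where
      zeroed : ∀ a → a * e i j ≡ 0ℚ
      zeroed a = trans (cong (a *_) (e-off i j i≢j)) (ℚP.*-zeroʳ a)
    get-inject₁ : ∀ {n} (r : Fin n) (j : Fin (suc n)) → get (e r) (toℕ j) ≡ e (inject₁ r) j
    get-inject₁ zero    zero    = refl
    get-inject₁ {n} zero (suc j) = get-e {n} zero (suc (toℕ j)) (λ ())
    get-inject₁ (suc r) zero    = refl
    get-inject₁ (suc r) (suc j) = get-inject₁ r j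
    killed : ∀ r A → (∀ q → q F.< r → ∀ j → A q j ≡ e q j) → (∀ j → A r j ≡ z r j) → det (suc n) A ≡ 0ℚ
    killed zero    A _  h = zero-row (det-multilinear (suc n)) {A} zero λ j →
      trans (h j) (trans (cong ((- ε) *_) (get-e {suc n} zero (toℕ j ℕ.+ 1) (ℕP.m+1+n≢0 (toℕ j)))) (ℚP.*-zeroʳ (- ε)))
    killed (suc r) A h₁ h = scaled-rows (det-alternating (suc n)) (- ε) {A} {s = inject₁ r} r≢ λ j →
      trans (h j) (cong ((- ε) *_) (trans
        (trans (cong (get (e (suc r))) (ℕP.+-comm (toℕ j) 1)) (get-inject₁ r j))
        (sym (h₁ (inject₁ r) (s≤s (ℕP.≤-reflexive (FP.toℕ-inject₁ r))) j))))
      where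
      r≢ : suc r ≢ inject₁ r
      r≢ eq = ℕP.1+n≢n (trans (cong toℕ eq) (FP.toℕ-inject₁ r))

  punchIn-fromℕ : ∀ n (x : Fin n) → punchIn (fromℕ n) x ≡ inject₁ x
  punchIn-fromℕ (suc n) zero    = refl
  punchIn-fromℕ (suc n) (suc x) = cong suc (punchIn-fromℕ n x)

  -- f = x ^ c exp (ε′ x) satisfies f′ - ε f = (ε′ - ε) f + c x ^ (c - 1) exp (ε′ x). For ε′ = ε
  -- only the lowering of c remains; for ε = 1 and ε′ = -1 the factor is -2, the source of the power
  -- of 2 in E(δ, δ). At c = 0 the value of `pred` is harmless because its coefficient is 0.
  T-coefRow : ∀ {n} ε ε′ c (x : Fin n) →
              T ε (coefRow ε′ c) (inject₁ x) ≡ (ε′ + - ε) * coefRow ε′ c x + ι c * coefRow ε′ (pred c) x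
  T-coefRow {n} ε ε′ c x = begin
    ι₁ (n ∸ toℕ (inject₁ x)) * coef ε′ c (n ∸ toℕ (inject₁ x)) + (- ε) * shift 1 (coefRow ε′ c) (inject₁ x)
      ≡⟨ cong (λ a → ι₁ (n ∸ toℕ (inject₁ x)) * coef ε′ c (n ∸ toℕ (inject₁ x)) + (- ε) * a)
          (shift-coefRow 1 ε′ c (inject₁ x)) ⟩
    ι₁ (n ∸ toℕ (inject₁ x)) * coef ε′ c (n ∸ toℕ (inject₁ x)) + (- ε) * coef ε′ (suc c) (n ∸ toℕ (inject₁ x))
      ≡⟨ cong (λ m → ι₁ m * coef ε′ c m + (- ε) * coef ε′ (suc c) m) index ⟩
    ι (suc m) * coef ε′ c (suc m) + (- ε) * coef ε′ c m
      ≡⟨ cong (_+ (- ε) * coef ε′ c m) (coef-euler ε′ c (suc m)) ⟩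
    (ι c * coef ε′ c (suc m) + ε′ * coef ε′ c m) + (- ε) * coef ε′ c m
      ≡⟨ cong (λ a → (a + ε′ * coef ε′ c m) + (- ε) * coef ε′ c m) (lower c) ⟩
    (ι c * coef ε′ (pred c) m + ε′ * coef ε′ c m) + (- ε) * coef ε′ c m
      ≡⟨ ring (ι c * coef ε′ (pred c) m) ε′ ε (coef ε′ c m) ⟩
    (ε′ + - ε) * coef ε′ c m + ι c * coef ε′ (pred c) m ∎
    where
    m = n ∸ suc (toℕ x)
    index : n ∸ toℕ (inject₁ x) ≡ suc m
    index = trans (cong (n ∸_) (FP.toℕ-inject₁ x)) (ℕP.+-∸-assoc 1 (FP.toℕ<n x))
    lower : ∀ c → ι c * coef ε′ c (suc m) ≡ ι c * coef ε′ (pred c) m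
    lower zero    = trans (ℚP.*-zeroˡ (coef ε′ 0 (suc m))) (sym (ℚP.*-zeroˡ (coef ε′ 0 m)))
    lower (suc c) = refl
    ring : ∀ a ε′ ε b → (a + ε′ * b) + (- ε) * b ≡ (ε′ + - ε) * b + a
    ring = solve-∀ ℚ-ring

  -- T ε sends exp (ε x) to the last unit vector.
  det-step : ∀ n ε (A : Matrix (suc n) (suc n)) → (∀ j → A zero j ≡ coefRow ε 0 j) →
             ι (n !) * det (suc n) A ≡ sgn n * det n (λ i x → T ε (A (suc i)) (inject₁ x))
  det-step n ε A h = begin
    ι (n !) * det (suc n) A
      ≡⟨ cong (_* det (suc n) A) (det-T n ε) ⟨
    det (suc n) (λ i → T ε (e i)) * det (suc n) A
      ≡⟨ det-* (suc n) (T-linear ε) A ⟨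
    det (suc n) TA
      ≡⟨ Σ-single term (fromℕ n) (λ j j≢ → trans (cong (λ a → sgn (toℕ j) * a * det n (minor TA j)) (off j j≢))
                                                 (ring (sgn (toℕ j)) (det n (minor TA j)))) ⟩
    sgn (toℕ (fromℕ n)) * TA zero (fromℕ n) * det n (minor TA (fromℕ n))
      ≡⟨ cong₂ (λ a b → sgn a * b * det n (minor TA (fromℕ n))) (FP.toℕ-fromℕ n) last ⟩
    sgn n * 1ℚ * det n (minor TA (fromℕ n))
      ≡⟨ cong₂ _*_ (ℚP.*-identityʳ (sgn n)) (det-cong n (λ i x → cong (TA (suc i)) (punchIn-fromℕ n x))) ⟩
    sgn n * det n (λ i x → TA (suc i) (inject₁ x)) ∎
    where
    TA : Matrix (suc n) (suc n)
    TA i = T ε (A i)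
    term : Fin (suc n) → ℚ
    term j = sgn (toℕ j) * TA zero j * det n (minor TA j)
    ring : ∀ a b → a * 0ℚ * b ≡ 0ℚ
    ring = solve-∀ ℚ-ring
    unfold : ∀ j → TA zero j ≡ ι₁ (n ∸ toℕ j) * coef ε 0 (n ∸ toℕ j) + (- ε) * coef ε 1 (n ∸ toℕ j)
    unfold j = trans (X-cong (T-linear ε) h j)
      (cong (λ a → ι₁ (n ∸ toℕ j) * coef ε 0 (n ∸ toℕ j) + (- ε) * a) (shift-coefRow 1 ε 0 j))
    last : TA zero (fromℕ n) ≡ 1ℚ
    last = begin
      TA zero (fromℕ n)
        ≡⟨ unfold (fromℕ n) ⟩
      ι₁ (n ∸ toℕ (fromℕ n)) * coef ε 0 (n ∸ toℕ (fromℕ n)) + (- ε) * coef ε 1 (n ∸ toℕ (fromℕ n))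
        ≡⟨ cong (λ m → ι₁ m * coef ε 0 m + (- ε) * coef ε 1 m) (trans (cong (n ∸_) (FP.toℕ-fromℕ n)) (ℕP.n∸n≡0 n)) ⟩
      1ℚ * 1ℚ + (- ε) * 0ℚ
        ≡⟨ cong (1ℚ +_) (ℚP.*-zeroʳ (- ε)) ⟩
      1ℚ ∎
    off : ∀ j → j ≢ fromℕ n → TA zero j ≡ 0ℚ
    off j j≢ with n ∸ toℕ j in eq | unfold j
    ... | zero  | _  = contradiction (FP.toℕ-injective (trans (ℕP.≤-antisym (FP.toℕ≤pred[n] j) (ℕP.m∸n≡0⇒m≤n eq)) (sym (FP.toℕ-fromℕ n)))) j≢
    ... | suc m | eq = trans eq (trans (cong (_+ (- ε) * coef ε 0 m) (coef-euler ε 0 (suc m))) (ring₂ (coef ε 0 (suc m)) ε (coef ε 0 m)))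
      where
      ring₂ : ∀ a ε b → (0ℚ * a + ε * b) + (- ε) * b ≡ 0ℚ
      ring₂ = solve-∀ ℚ-ring

  -- The two blocks may differ in size, since rows are removed one at a time; `D k k` is
  -- `E k toℕ toℕ`.
  D : ℕ → ℕ → ℚ
  D a b = det (a ℕ.+ b) (coefRows {a} 1ℚ toℕ ++ᶠ coefRows {b} (- 1ℚ) toℕ)

  Π-++ : ∀ {a b} (s : Fin a → ℚ) (t : Fin b → ℚ) → Π (s ++ᶠ t) ≡ Π s * Π t
  Π-++ {zero}  s t = sym (ℚP.*-identityˡ (Π t))
  Π-++ {suc a} {b} s t = begin
    s zero * Π ((s ++ᶠ t) ∘ suc)     ≡⟨ cong (s zero *_) (Π-cong tail) ⟩
    s zero * Π ((s ∘ suc) ++ᶠ t)     ≡⟨ cong (s zero *_) (Π-++ (s ∘ suc) t) ⟩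
    s zero * (Π (s ∘ suc) * Π t)    ≡⟨ ℚP.*-assoc (s zero) (Π (s ∘ suc)) (Π t) ⟨
    Π s * Π t                           ∎
    where
    Π-cong : ∀ {n} {f g : Fin n → ℚ} → (∀ i → f i ≡ g i) → Π f ≡ Π g
    Π-cong {zero}  h = refl
    Π-cong {suc n} h = cong₂ _*_ (h zero) (Π-cong (h ∘ suc))
    tail : ∀ i → (s ++ᶠ t) (suc i) ≡ ((s ∘ suc) ++ᶠ t) i
    tail i with splitAt a i
    ... | inj₁ _ = refl
    ... | inj₂ _ = refl

  Π-const : ∀ n x → Π {n} (λ _ → x) ≡ pw x n
  Π-const zero    x = refl
  Π-const (suc n) x = cong (x *_) (Π-const n x)

  Π-ι-suc : ∀ n → Π {n} (λ i → ι (suc (toℕ i))) ≡ ι (n !)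
  Π-ι-suc n = trans (Π-reverse n (λ m → ι (suc m))) (fact n)
    where
    Π-last : ∀ n (f : ℕ → ℚ) → Π {suc n} (f ∘ toℕ) ≡ Π {n} (f ∘ toℕ) * f n
    Π-last zero    f = ℚP.*-comm (f 0) 1ℚ
    Π-last (suc n) f = trans (cong (f 0 *_) (Π-last n (f ∘ suc))) (sym (ℚP.*-assoc (f 0) _ (f (suc n))))
    Π-reverse : ∀ n (f : ℕ → ℚ) → Π {n} (f ∘ toℕ) ≡ Π {n} (λ i → f (n ∸ suc (toℕ i)))
    Π-reverse zero    f = refl
    Π-reverse (suc n) f = trans (Π-last n f) (trans (ℚP.*-comm _ (f n)) (cong (f n *_) (Π-reverse n f)))
    fact : ∀ n → Π {n} (λ i → ι (suc (n ∸ suc (toℕ i)))) ≡ ι (n !)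
    fact zero    = refl
    fact (suc n) = trans (cong (ι (suc n) *_) (fact n)) (sym (ι-* (suc n) (n !)))

  -2ℚ : ℚ
  -2ℚ = - 1ℚ + - 1ℚ

  -- `T 1ℚ` disposes of the row exp (x). It turns x ^ (i + 1) exp (x) into (i + 1) x ^ i exp (x),
  -- which gives a! in all, and x ^ i exp (-x) into -2 times itself plus a multiple of the preceding
  -- lower row, which gives (-2) ^ b.
  D-sucˡ : ∀ a b → ι ((a ℕ.+ b) !) * D (suc a) b ≡ sgn (a ℕ.+ b) * (ι (a !) * pw -2ℚ b * D a b)
  D-sucˡ a b = begin
    ι (n !) * D (suc a) b
      ≡⟨ det-step n 1ℚ A (λ _ → refl) ⟩
    sgn n * det n (λ i x → T 1ℚ (A (suc i)) (inject₁ x))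
      ≡⟨ cong (sgn n *_) (triangular (det-multilinear n) g z _ t split killed) ⟩
    sgn n * (Π t * D a b)
      ≡⟨ cong (λ p → sgn n * (p * D a b)) (trans (Π-++ {a} {b} _ _) (cong₂ _*_ (Π-ι-suc a) (Π-const b -2ℚ))) ⟩
    sgn n * (ι (a !) * pw -2ℚ b * D a b) ∎
    where
    n = a ℕ.+ b
    A : Matrix (suc n) (suc n)
    A = coefRows {suc a} 1ℚ toℕ ++ᶠ coefRows {b} (- 1ℚ) toℕ
    g : Matrix n n
    g = coefRows {a} 1ℚ toℕ ++ᶠ coefRows {b} (- 1ℚ) toℕ
    t : Fin n → ℚ
    t = (λ (i : Fin a) → ι (suc (toℕ i))) ++ᶠ (λ (i : Fin b) → -2ℚ)
    z : Matrix n n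
    z = (λ (i : Fin a) _ → 0ℚ) ++ᶠ (λ (i : Fin b) j → ι (toℕ i) * coefRow (- 1ℚ) (pred (toℕ i)) j)
    ring : ∀ x y c → (1ℚ + - 1ℚ) * x + c * y ≡ c * y + 0ℚ
    ring = solve-∀ ℚ-ring
    split : ∀ r j → T 1ℚ (A (suc r)) (inject₁ j) ≡ t r * g r j + z r j
    split r j with splitAt a r
    ... | inj₁ i = trans (T-coefRow 1ℚ 1ℚ (suc (toℕ i)) j)
                     (ring (coefRow 1ℚ (suc (toℕ i)) j) (coefRow 1ℚ (toℕ i) j) (ι (suc (toℕ i))))
    ... | inj₂ i = T-coefRow 1ℚ (- 1ℚ) (toℕ i) j
    killed : ∀ r B → (∀ q → q F.< r → ∀ j → B q j ≡ g q j) → (∀ j → B r j ≡ z r j) → det n B ≡ 0ℚ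
    killed r B h₁ h with splitAt a r in eq
    ... | inj₁ i = zero-row (det-multilinear n) {B} r h
    ... | inj₂ zero = zero-row (det-multilinear n) {B} r (λ j → trans (h j) (ℚP.*-zeroˡ (coefRow (- 1ℚ) 0 j)))
    ... | inj₂ (suc i) = scaled-rows (det-alternating n) (ι (suc (toℕ i))) {B} {s = s} (λ r≡s → ℕP.<-irrefl (cong toℕ (sym r≡s)) s<r)
        λ j → trans (h j) (cong (ι (suc (toℕ i)) *_) (sym (trans (h₁ s s<r j) (trans
          (cong (λ v → v j) (lookup-++ʳ (coefRows {a} 1ℚ toℕ) (coefRows {b} (- 1ℚ) toℕ) (inject₁ i)))
          (cong (λ c → coefRow (- 1ℚ) c j) (FP.toℕ-inject₁ i))))))
      where
      s = a ↑ʳ inject₁ i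
      s<r : s F.< r
      s<r = subst₂ ℕ._<_ (sym (trans (FP.toℕ-↑ʳ a (inject₁ i)) (cong (a ℕ.+_) (FP.toℕ-inject₁ i))))
              (trans (sym (FP.toℕ-↑ʳ a (suc i))) (cong toℕ (FP.splitAt⁻¹-↑ʳ eq)))
              (ℕP.+-monoʳ-< a (ℕP.n<1+n (toℕ i)))

  D-sucʳ : ∀ b → D 0 (suc b) ≡ sgn b * D 0 b
  D-sucʳ b = ι-cancel (b !) {{b ℕP.!≢0}} (begin
    ι (b !) * D 0 (suc b)
      ≡⟨ det-step b (- 1ℚ) (coefRows (- 1ℚ) toℕ) (λ _ → refl) ⟩
    sgn b * det b (λ i x → T (- 1ℚ) (coefRow (- 1ℚ) (suc (toℕ i))) (inject₁ x))
      ≡⟨ cong (sgn b *_) (triangular (det-multilinear b) (coefRows (- 1ℚ) toℕ) (λ _ _ → 0ℚ) _ (λ i → ι (suc (toℕ i)))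
           (λ i j → trans (T-coefRow (- 1ℚ) (- 1ℚ) (suc (toℕ i)) j) (ring₁ (coefRow (- 1ℚ) (suc (toℕ i)) j) (coefRow (- 1ℚ) (toℕ i) j) (ι (suc (toℕ i)))))
           (λ r B _ h → zero-row (det-multilinear b) {B} r h)) ⟩
    sgn b * (Π {b} (λ i → ι (suc (toℕ i))) * D 0 b)
      ≡⟨ cong (λ p → sgn b * (p * D 0 b)) (Π-ι-suc b) ⟩
    sgn b * (ι (b !) * D 0 b)
      ≡⟨ ring₂ (sgn b) (ι (b !)) (D 0 b) ⟩
    ι (b !) * (sgn b * D 0 b) ∎)
    where
    ring₁ : ∀ x y c → (- 1ℚ + - (- 1ℚ)) * x + c * y ≡ c * y + 0ℚ
    ring₁ = solve-∀ ℚ-ring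
    ring₂ : ∀ a b c → a * (b * c) ≡ b * (a * c)
    ring₂ = solve-∀ ℚ-ring

  -- For b = k these are the factors of `invProd k`. The first argument stays fixed while the number
  -- of upper rows varies in `D-value`.
  quot : ℕ → ℕ → ℚ
  quot b l = _/_ (pos ((b ℕ.+ l) !)) (l !) {{l ℕP.!≢0}}

  sgn-+ : ∀ m n → sgn (m ℕ.+ n) ≡ sgn m * sgn n
  sgn-+ zero    n = sym (ℚP.*-identityˡ (sgn n))
  sgn-+ (suc m) n = trans (cong -_ (sgn-+ m n)) (ℚP.neg-distribˡ-* (sgn m) (sgn n))

  sgn-square : ∀ n → sgn n * sgn n ≡ 1ℚ
  sgn-square zero    = refl
  sgn-square (suc n) = trans (ring (sgn n)) (sgn-square n)
    where
    ring : ∀ a → (- a) * (- a) ≡ a * a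
    ring = solve-∀ ℚ-ring

  2ℚ : ℚ
  2ℚ = 1ℚ + 1ℚ

  pw--2 : ∀ n → pw -2ℚ n ≡ sgn n * pw 2ℚ n
  pw--2 zero    = refl
  pw--2 (suc n) = trans (cong (-2ℚ *_) (pw--2 n)) (ring (sgn n) (pw 2ℚ n))
    where
    ring : ∀ a b → (- 1ℚ + - 1ℚ) * (a * b) ≡ (- a) * ((1ℚ + 1ℚ) * b)
    ring = solve-∀ ℚ-ring

  pw-+ : ∀ x m n → pw x (m ℕ.+ n) ≡ pw x m * pw x n
  pw-+ x zero    n = sym (ℚP.*-identityˡ (pw x n))
  pw-+ x (suc m) n = trans (cong (x *_) (pw-+ x m n)) (sym (ℚP.*-assoc x (pw x m) (pw x n)))

  -- Upper rows are removed first, then the lower ones. In removing an upper row, the sign (-1) ^ (a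
  -- + b) of the expansion meets (-1) ^ b from the power of -2 and leaves (-1) ^ a. For a = b the
  -- two products of signs multiply to 1.
  D-value : ∀ a b → Πℚ a (quot b) * D a b ≡ pw 2ℚ (a ℕ.* b) * (Πℚ a sgn * Πℚ b sgn)
  D-value zero zero    = refl
  D-value zero (suc b) = begin
    1ℚ * D 0 (suc b)                    ≡⟨ cong (1ℚ *_) (D-sucʳ b) ⟩
    1ℚ * (sgn b * D 0 b)                ≡⟨ ring₁ (sgn b) (D 0 b) ⟩
    sgn b * (1ℚ * D 0 b)                ≡⟨ cong (sgn b *_) (D-value zero b) ⟩
    sgn b * (1ℚ * (1ℚ * Πℚ b sgn))      ≡⟨ ring₂ (sgn b) (Πℚ b sgn) ⟩
    1ℚ * (1ℚ * (Πℚ b sgn * sgn b))      ∎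
    where
    ring₁ : ∀ a b → 1ℚ * (a * b) ≡ a * (1ℚ * b)
    ring₁ = solve-∀ ℚ-ring
    ring₂ : ∀ a b → a * (1ℚ * (1ℚ * b)) ≡ 1ℚ * (1ℚ * (b * a))
    ring₂ = solve-∀ ℚ-ring
  D-value (suc a) b = begin
    Πℚ a (quot b) * quot b a * D (suc a) b
      ≡⟨ ℚP.*-assoc (Πℚ a (quot b)) (quot b a) (D (suc a) b) ⟩
    Πℚ a (quot b) * (quot b a * D (suc a) b)
      ≡⟨ cong (Πℚ a (quot b) *_) step ⟩
    Πℚ a (quot b) * (sgn (a ℕ.+ b) * (pw -2ℚ b * D a b))
      ≡⟨ ring₁ (Πℚ a (quot b)) (sgn (a ℕ.+ b)) (pw -2ℚ b) (D a b) ⟩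
    sgn (a ℕ.+ b) * pw -2ℚ b * (Πℚ a (quot b) * D a b)
      ≡⟨ cong₂ _*_ (cong₂ _*_ (sgn-+ a b) (pw--2 b)) (D-value a b) ⟩
    (sgn a * sgn b) * (sgn b * pw 2ℚ b) * (pw 2ℚ (a ℕ.* b) * (Πℚ a sgn * Πℚ b sgn))
      ≡⟨ ring₂ (sgn a) (sgn b) (pw 2ℚ b) (pw 2ℚ (a ℕ.* b)) (Πℚ a sgn) (Πℚ b sgn) ⟩
    (sgn b * sgn b) * ((pw 2ℚ b * pw 2ℚ (a ℕ.* b)) * ((Πℚ a sgn * sgn a) * Πℚ b sgn))
      ≡⟨ cong₂ (λ x y → x * (y * ((Πℚ a sgn * sgn a) * Πℚ b sgn))) (sgn-square b) (sym (pw-+ 2ℚ b (a ℕ.* b))) ⟩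
    1ℚ * (pw 2ℚ (suc a ℕ.* b) * (Πℚ (suc a) sgn * Πℚ b sgn))
      ≡⟨ ℚP.*-identityˡ _ ⟩
    pw 2ℚ (suc a ℕ.* b) * (Πℚ (suc a) sgn * Πℚ b sgn) ∎
    where
    ring₁ : ∀ x s y d → x * (s * (y * d)) ≡ s * y * (x * d)
    ring₁ = solve-∀ ℚ-ring
    ring₂ : ∀ s t p q x y → (s * t) * (t * p) * (q * (x * y)) ≡ (t * t) * ((p * q) * ((x * s) * y))
    ring₂ = solve-∀ ℚ-ring
    ring₃ : ∀ x y z → x * (y * z) ≡ (y * x) * z
    ring₃ = solve-∀ ℚ-ring
    ring₄ : ∀ s x y d → s * (x * y * d) ≡ x * (s * (y * d))
    ring₄ = solve-∀ ℚ-ring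
    step : quot b a * D (suc a) b ≡ sgn (a ℕ.+ b) * (pw -2ℚ b * D a b)
    step = ι-cancel (a !) {{a ℕP.!≢0}} (begin
      ι (a !) * (quot b a * D (suc a) b)
        ≡⟨ ring₃ (ι (a !)) (quot b a) (D (suc a) b) ⟩
      (quot b a * ι (a !)) * D (suc a) b
        ≡⟨ cong (_* D (suc a) b) (/-cancel ((b ℕ.+ a) !) (a !) {{a ℕP.!≢0}}) ⟩
      ι ((b ℕ.+ a) !) * D (suc a) b
        ≡⟨ cong (λ m → ι (m !) * D (suc a) b) (ℕP.+-comm b a) ⟩
      ι ((a ℕ.+ b) !) * D (suc a) b
        ≡⟨ D-sucˡ a b ⟩
      sgn (a ℕ.+ b) * (ι (a !) * pw -2ℚ b * D a b)
        ≡⟨ ring₄ (sgn (a ℕ.+ b)) (ι (a !)) (pw -2ℚ b) (D a b) ⟩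
      ι (a !) * (sgn (a ℕ.+ b) * (pw -2ℚ b * D a b)) ∎)

  ι-2^ : ∀ n → ι (2 ℕ.^ n) ≡ pw 2ℚ n
  ι-2^ zero    = refl
  ι-2^ (suc n) = trans (ι-* 2 (2 ℕ.^ n)) (cong (2ℚ *_) (ι-2^ n))

  Πsgn-square : ∀ k → Πℚ k sgn * Πℚ k sgn ≡ 1ℚ
  Πsgn-square zero    = refl
  Πsgn-square (suc k) = trans (ring (Πℚ k sgn) (sgn k)) (trans (cong₂ _*_ (Πsgn-square k) (sgn-square k)) refl)
    where
    ring : ∀ a b → (a * b) * (a * b) ≡ (a * a) * (b * b)
    ring = solve-∀ ℚ-ring

  norm : ℕ → ℚ
  norm k = recip (2 ℕ.^ (k ℕ.* k)) {{ℕP.m^n≢0 2 (k ℕ.* k)}} * invProd k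

  norm-E : ∀ k → norm k * E k toℕ toℕ ≡ 1ℚ
  norm-E k = begin
    r * invProd k * E k toℕ toℕ                          ≡⟨ ℚP.*-assoc r (invProd k) (E k toℕ toℕ) ⟩
    r * (Πℚ k (quot k) * D k k)                          ≡⟨ cong (r *_) (D-value k k) ⟩
    r * (pw 2ℚ (k ℕ.* k) * (Πℚ k sgn * Πℚ k sgn))        ≡⟨ cong₂ (λ x y → r * (x * y)) (sym (ι-2^ (k ℕ.* k))) (Πsgn-square k) ⟩
    r * (ι (2 ℕ.^ (k ℕ.* k)) * 1ℚ)                       ≡⟨ cong (r *_) (ℚP.*-identityʳ (ι (2 ℕ.^ (k ℕ.* k)))) ⟩
    r * ι (2 ℕ.^ (k ℕ.* k))                              ≡⟨ recip-*ι (2 ℕ.^ (k ℕ.* k)) {{ℕP.m^n≢0 2 (k ℕ.* k)}} ⟩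
    1ℚ                                                   ∎
    where r = recip (2 ℕ.^ (k ℕ.* k)) {{ℕP.m^n≢0 2 (k ℕ.* k)}}

  twoFactor-norm : ∀ k r → twoFactor k r * invProd k ≡ ι (2 ℕ.^ r) * norm k
  twoFactor-norm k r = ι-cancel d {{nz}} (begin
    ι d * (twoFactor k r * invProd k)        ≡⟨ ring₁ (ι d) (twoFactor k r) (invProd k) ⟩
    twoFactor k r * ι d * invProd k          ≡⟨ cong (_* invProd k) (/-cancel (2 ℕ.^ r) d {{nz}}) ⟩
    ι (2 ℕ.^ r) * invProd k                  ≡⟨ cong (_* invProd k) (ℚP.*-identityʳ (ι (2 ℕ.^ r))) ⟨
    ι (2 ℕ.^ r) * 1ℚ * invProd k             ≡⟨ cong (λ x → ι (2 ℕ.^ r) * x * invProd k) (recip-*ι d {{nz}}) ⟨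
    ι (2 ℕ.^ r) * (recip d {{nz}} * ι d) * invProd k ≡⟨ ring₂ (ι (2 ℕ.^ r)) (recip d {{nz}}) (ι d) (invProd k) ⟩
    ι d * (ι (2 ℕ.^ r) * norm k)              ∎)
    where
    d = 2 ℕ.^ (k ℕ.* k)
    nz = ℕP.m^n≢0 2 (k ℕ.* k)
    ring₁ : ∀ a b c → a * (b * c) ≡ b * a * c
    ring₁ = solve-∀ ℚ-ring
    ring₂ : ∀ a b c d → a * (b * c) * d ≡ c * (a * (b * d))
    ring₂ = solve-∀ ℚ-ring

  -- Power sums acting on alternating functions

  []+-comm : ∀ {k} (c : Idx k) i r j s x → (c [ i ]+ r [ j ]+ s) x ≡ (c [ j ]+ s [ i ]+ r) x
  []+-comm c i r j s x = trans (ℕP.+-assoc (c x) (bump i r x) (bump j s x))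
    (trans (cong (c x ℕ.+_) (ℕP.+-comm (bump i r x) (bump j s x))) (sym (ℕP.+-assoc (c x) (bump j s x) (bump i r x))))

  []+-+ : ∀ {k} (c : Idx k) i r s x → (c [ i ]+ r [ i ]+ s) x ≡ (c [ i ]+ (r ℕ.+ s)) x
  []+-+ c i r s x = trans (ℕP.+-assoc (c x) (bump i r x) (bump i s x)) (cong (c x ℕ.+_) (bump-+ i r s x))

  bump-0 : ∀ {k} (i x : Fin k) → bump i 0 x ≡ 0
  bump-0 zero    zero    = refl
  bump-0 zero    (suc x) = refl
  bump-0 (suc i) zero    = refl
  bump-0 (suc i) (suc x) = bump-0 i x

  []+-0 : ∀ {k} (c : Idx k) i x → (c [ i ]+ 0) x ≡ c x
  []+-0 c i x = trans (cong (c x ℕ.+_) (bump-0 i x)) (ℕP.+-identityʳ (c x))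

  []+-cong : ∀ {k} {c c′ : Idx k} → (∀ x → c x ≡ c′ x) → ∀ i r x → (c [ i ]+ r) x ≡ (c′ [ i ]+ r) x
  []+-cong h i r x = cong (ℕ._+ bump i r x) (h x)

  transpose-elim : ∀ {k} (i j : Fin k) (Q : Fin k → Fin k → Set) →
                   Q i j → Q j i → (∀ x → x ≢ i → x ≢ j → Q x x) → ∀ x → Q x (PC.transpose i j x)
  transpose-elim i j Q qij qji qxx x with x FP.≟ i
  ... | yes refl = qij
  ... | no x≢i with x FP.≟ j
  ...   | yes refl = qji
  ...   | no x≢j = qxx x x≢i x≢j

  transpose-at-i : ∀ {k} (i j : Fin k) → PC.transpose i j i ≡ j
  transpose-at-i i j with i FP.≟ i
  ... | yes _  = refl
  ... | no i≢i = contradiction refl i≢i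

  transpose-at-j : ∀ {k} (i j : Fin k) → PC.transpose i j j ≡ i
  transpose-at-j i j with j FP.≟ i
  ... | yes j≡i = j≡i
  ... | no _ with j FP.≟ j
  ...   | yes _  = refl
  ...   | no j≢j = contradiction refl j≢j

  transpose-fixed : ∀ {k} (i j : Fin k) x → x ≢ i → x ≢ j → PC.transpose i j x ≡ x
  transpose-fixed i j x x≢i x≢j with x FP.≟ i
  ... | yes x≡i = contradiction x≡i x≢i
  ... | no _ with x FP.≟ j
  ...   | yes x≡j = contradiction x≡j x≢j
  ...   | no _ = refl

  transpose-involutive : ∀ {k} (i j x : Fin k) → PC.transpose i j (PC.transpose i j x) ≡ x
  transpose-involutive i j = transpose-elim i j (λ x y → PC.transpose i j y ≡ x)
    (transpose-at-j i j) (transpose-at-i i j) (transpose-fixed i j)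

  bump-transpose : ∀ {k} (i j l : Fin k) r x → bump (PC.transpose i j l) r x ≡ bump l r (PC.transpose i j x)
  bump-transpose i j l r x with x FP.≟ PC.transpose i j l
  ... | yes refl = trans (bump-diag (PC.transpose i j l) r)
                     (sym (trans (cong (bump l r) (transpose-involutive i j l)) (bump-diag l r)))
  ... | no x≢ = trans (bump-off (PC.transpose i j l) r x x≢)
                  (sym (bump-off l r (PC.transpose i j x) (λ eq → x≢ (trans (sym (transpose-involutive i j x)) (cong (PC.transpose i j) eq)))))

  -- Such a G is a linear functional on alternating polynomials, `G c` being its value at the
  -- alternant of x ^ c. Then `P r` is precomposition with multiplication by p_r, and `toℕ` is the
  -- exponent sequence of the Vandermonde determinant.
  record Anti {k} (G : Idx k → ℚ) : Set where
    field
      ext  : ∀ {c c′} → (∀ x → c x ≡ c′ x) → G c ≡ G c′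
      anti : ∀ {i j} → i ≢ j → ∀ c → G (c ∘ PC.transpose i j) ≡ - G c

    anti-at : ∀ {i j} → i ≢ j → ∀ {c c′} → c i ≡ c′ j → c j ≡ c′ i → (∀ x → x ≢ i → x ≢ j → c x ≡ c′ x) →
              G c ≡ - G c′
    anti-at {i} {j} i≢j {c} {c′} h₁ h₂ h₃ =
      trans (ext (transpose-elim i j (λ x y → c x ≡ c′ y) h₁ h₂ h₃)) (anti i≢j c′)

    vanish : ∀ {i j} → i ≢ j → ∀ {c} → c i ≡ c j → G c ≡ 0ℚ
    vanish i≢j h = x≡-x⇒x≡0 (anti-at i≢j h (sym h) (λ _ _ _ → refl))
  open Anti

  P : ∀ {k} → ℕ → (Idx k → ℚ) → Idx k → ℚ
  P {k} r G c = Σℚ k (λ i → G (c [ i ]+ r))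

  P-0 : ∀ {k} {G : Idx k → ℚ} → Anti G → ∀ c → P 0 G c ≡ ι k * G c
  P-0 {k} {G} a c = trans (Σ-cong (λ i → ext a ([]+-0 c i))) (Σ-const k (G c))

  P-cong : ∀ {k} r {G H : Idx k → ℚ} → (∀ c → G c ≡ H c) → ∀ c → P r G c ≡ P r H c
  P-cong r h c = Σ-cong (λ i → h (c [ i ]+ r))

  P-comm : ∀ {k} {G : Idx k → ℚ} → Anti G → ∀ r s c → P r (P s G) c ≡ P s (P r G) c
  P-comm {k} {G} a r s c = trans (Σ-comm (λ i j → G (c [ i ]+ r [ j ]+ s)))
    (Σ-cong (λ j → Σ-cong (λ i → ext a ([]+-comm c i r j s))))

  Σ-anti : ∀ {k n} {G : Fin n → Idx k → ℚ} → (∀ q → Anti (G q)) → Anti (λ c → Σℚ n (λ q → G q c))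
  Σ-anti {n = n} {G} a = record
    { ext  = λ h → Σ-cong (λ q → ext (a q) h)
    ; anti = λ i≢j c → trans (Σ-cong (λ q → anti (a q) i≢j c)) (Σ-neg (λ q → G q c))
    }

  P-anti : ∀ {k} r {G : Idx k → ℚ} → Anti G → Anti (P r G)
  P-anti {k} r {G} a = record
    { ext  = λ h → Σ-cong (λ i → ext a ([]+-cong h i r))
    ; anti = λ {i} {j} i≢j c → begin
        Σℚ k (λ l → G (c ∘ PC.transpose i j [ l ]+ r))
          ≡⟨ Σ-permute (λ l → G (c ∘ PC.transpose i j [ l ]+ r)) (transpose i j) ⟩
        Σℚ k (λ l → G (c ∘ PC.transpose i j [ PC.transpose i j l ]+ r))
          ≡⟨ Σ-cong (λ l → trans (ext a (λ x → cong (c (PC.transpose i j x) ℕ.+_) (bump-transpose i j l r x)))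
                                 (anti a i≢j (c [ l ]+ r))) ⟩
        Σℚ k (λ l → - G (c [ l ]+ r))
          ≡⟨ Σ-neg (λ l → G (c [ l ]+ r)) ⟩
        - P r G c ∎
    }

  antisymmetric-sum : ∀ m (h : ℕ → ℚ) → (∀ a → a ≤ m → h a ≡ - h (m ∸ a)) → Σℚ (suc m) (h ∘ toℕ) ≡ 0ℚ
  antisymmetric-sum m h anti = x≡-x⇒x≡0 (begin
    Σℚ (suc m) (h ∘ toℕ)                    ≡⟨ Σ-cong {suc m} (λ a → anti (toℕ a) (FP.toℕ≤pred[n] a)) ⟩
    Σℚ (suc m) (λ a → - h (m ∸ toℕ a))      ≡⟨ Σ-neg (λ (a : Fin (suc m)) → h (m ∸ toℕ a)) ⟩
    - Σℚ (suc m) (λ a → h (m ∸ toℕ a))      ≡⟨ cong -_ (Σ-reverse (suc m) h) ⟨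
    - Σℚ (suc m) (h ∘ toℕ)                  ∎)

  -- The index bookkeeping for `ladder`, where suc d is the distance j - i. The reflection a ↦ s +
  -- suc d - a preserves the range from suc d to s, so the terms there cancel in pairs.
  collapse : ∀ d s (h : ℕ → ℚ) → (∀ a → 0 < a → a < suc d → a ≤ s → h a ≡ 0ℚ) →
             (∀ a → suc d ≤ a → a ≤ s → h a ≡ - h (s ℕ.+ suc d ∸ a)) →
             Σℚ (suc s) (h ∘ toℕ) ≡ h 0
  collapse d s h z r with suc d ℕP.≤? s
  ... | no d≮s = trans (cong (h 0 +_) (Σ-zero {s} (λ a → z (suc (toℕ a)) (s≤s z≤n)
      (ℕP.≤-<-trans (FP.toℕ<n a) (ℕP.≰⇒> d≮s)) (FP.toℕ<n a)))) (ℚP.+-identityʳ (h 0))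
  ... | yes d<s with m , refl ← ℕP.m≤n⇒∃[o]m+o≡n d<s = begin
    Σℚ (suc (suc d ℕ.+ m)) (h ∘ toℕ)
      ≡⟨ cong (λ n → Σℚ n (h ∘ toℕ)) (ℕP.+-suc (suc d) m) ⟨
    Σℚ (suc d ℕ.+ suc m) (h ∘ toℕ)
      ≡⟨ Σ-↑ (suc d) (suc m) (h ∘ toℕ) ⟩
    Σℚ (suc d) (λ a → h (toℕ (a ↑ˡ suc m))) + Σℚ (suc m) (λ a → h (toℕ (suc d ↑ʳ a)))
      ≡⟨ cong₂ _+_ (cong (h 0 +_) (Σ-zero {d} low)) (trans (Σ-cong {suc m} (λ a → cong h (FP.toℕ-↑ʳ (suc d) a)))
          (antisymmetric-sum m (λ a → h (suc d ℕ.+ a)) high)) ⟩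
    (h 0 + 0ℚ) + 0ℚ
      ≡⟨ trans (ℚP.+-identityʳ (h 0 + 0ℚ)) (ℚP.+-identityʳ (h 0)) ⟩
    h 0 ∎
    where
    low : ∀ a → h (suc (toℕ (a ↑ˡ suc m))) ≡ 0ℚ
    low a = trans (cong (h ∘ suc) (FP.toℕ-↑ˡ a (suc m)))
      (z (suc (toℕ a)) (s≤s z≤n) (s≤s (FP.toℕ<n a)) (ℕP.≤-trans (s≤s (ℕP.<⇒≤ (FP.toℕ<n a))) (ℕP.m≤m+n (suc d) m)))
    high : ∀ a → a ≤ m → h (suc d ℕ.+ a) ≡ - h (suc d ℕ.+ (m ∸ a))
    high a a≤m = trans (r (suc d ℕ.+ a) (ℕP.m≤m+n (suc d) a) (ℕP.+-monoʳ-≤ (suc d) a≤m)) (cong (-_ ∘ h) idx)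
      where
      idx : suc d ℕ.+ m ℕ.+ suc d ∸ (suc d ℕ.+ a) ≡ suc d ℕ.+ (m ∸ a)
      idx = trans (cong (_∸ (suc d ℕ.+ a)) (ℕP.+-assoc (suc d) m (suc d)))
        (trans (ℕP.[m+n]∸[m+o]≡n∸o (suc d) (m ℕ.+ suc d) a)
        (trans (cong (_∸ a) (ℕP.+-comm m (suc d))) (ℕP.+-∸-assoc (suc d) a≤m)))

  -- Swapping the entries i + a and j + s - a pairs off the terms with a ≥ j - i; the remaining terms
  -- with a > 0 have a repeated entry i + a.
  ladder : ∀ {k} {G : Idx k → ℚ} → Anti G → ∀ s (i j : Fin k) → i F.< j →
           Σℚ (suc s) (λ a → G (toℕ [ i ]+ toℕ a [ j ]+ (s ∸ toℕ a))) ≡ G (toℕ [ j ]+ s)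
  ladder {k} {G} A s i j i<j with d , eq ← ℕP.m≤n⇒∃[o]m+o≡n i<j =
    trans (collapse d s h zeros flips) (ext A (λ x → cong (ℕ._+ bump j s x) ([]+-0 toℕ i x)))
    where
    i≢j : i ≢ j
    i≢j refl = ℕP.<-irrefl refl i<j
    c : ℕ → Idx k
    c a = toℕ [ i ]+ a [ j ]+ (s ∸ a)
    h : ℕ → ℚ
    h a = G (c a)
    jd : toℕ j ≡ toℕ i ℕ.+ suc d
    jd = trans (sym eq) (sym (ℕP.+-suc (toℕ i) d))
    c-i : ∀ a → c a i ≡ toℕ i ℕ.+ a
    c-i a = trans ([]+-off (toℕ [ i ]+ a) j (s ∸ a) i i≢j) ([]+-diag toℕ i a)
    c-j : ∀ a → c a j ≡ toℕ j ℕ.+ (s ∸ a)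
    c-j a = trans ([]+-diag (toℕ [ i ]+ a) j (s ∸ a)) (cong (ℕ._+ (s ∸ a)) ([]+-off toℕ i a j (i≢j ∘ sym)))
    c-x : ∀ a x → x ≢ i → x ≢ j → c a x ≡ toℕ x
    c-x a x x≢i x≢j = trans ([]+-off (toℕ [ i ]+ a) j (s ∸ a) x x≢j) ([]+-off toℕ i a x x≢i)
    zeros : ∀ a → 0 < a → a < suc d → a ≤ s → h a ≡ 0ℚ
    zeros a 0<a a<d _ = vanish A (x≢i ∘ sym) (trans (c-i a) (trans (sym toℕx) (sym (c-x a x x≢i x≢j))))
      where
      i+a<j : toℕ i ℕ.+ a < toℕ j
      i+a<j = subst (toℕ i ℕ.+ a ℕ.<_) (sym jd) (ℕP.+-monoʳ-< (toℕ i) a<d)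
      -- i + a lies strictly between i and j, so it is the untouched value of the entry at that
      -- position.
      x : Fin k
      x = fromℕ< (ℕP.<-trans i+a<j (FP.toℕ<n j))
      toℕx : toℕ x ≡ toℕ i ℕ.+ a
      toℕx = FP.toℕ-fromℕ< _
      x≢i : x ≢ i
      x≢i x≡i = ℕP.<-irrefl (trans (sym (cong toℕ x≡i)) toℕx) (ℕP.m<m+n (toℕ i) 0<a)
      x≢j : x ≢ j
      x≢j x≡j = ℕP.<-irrefl (trans (sym toℕx) (cong toℕ x≡j)) i+a<j
    flips : ∀ a → suc d ≤ a → a ≤ s → h a ≡ - h (s ℕ.+ suc d ∸ a)
    flips a d<a a≤s with b , refl ← ℕP.m≤n⇒∃[o]m+o≡n d<a | q , refl ← ℕP.m≤n⇒∃[o]m+o≡n a≤s =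
      anti-at A i≢j
        (begin
          c a i                                ≡⟨ c-i a ⟩
          toℕ i ℕ.+ (suc d ℕ.+ b)              ≡⟨ ℕP.+-assoc (toℕ i) (suc d) b ⟨
          toℕ i ℕ.+ suc d ℕ.+ b                ≡⟨ cong₂ ℕ._+_ jd (trans (cong (s ∸_) a′≡) s∸[q+d]) ⟨
          toℕ j ℕ.+ (s ∸ a′)                   ≡⟨ c-j a′ ⟨
          c a′ j                               ∎)
        (begin
          c a j                                ≡⟨ c-j a ⟩
          toℕ j ℕ.+ (s ∸ a)                    ≡⟨ cong₂ ℕ._+_ jd (ℕP.m+n∸m≡n a q) ⟩
          toℕ i ℕ.+ suc d ℕ.+ q                ≡⟨ ℕP.+-assoc (toℕ i) (suc d) q ⟩
          toℕ i ℕ.+ (suc d ℕ.+ q)              ≡⟨ cong (toℕ i ℕ.+_) (trans (ℕP.+-comm (suc d) q) (sym a′≡)) ⟩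
          toℕ i ℕ.+ a′                         ≡⟨ c-i a′ ⟨
          c a′ i                               ∎)
        (λ x x≢i x≢j → trans (c-x a x x≢i x≢j) (sym (c-x a′ x x≢i x≢j)))
      where
      a′ = s ℕ.+ suc d ∸ a
      a′≡ : a′ ≡ q ℕ.+ suc d
      a′≡ = trans (cong (_∸ a) (ℕP.+-assoc a q (suc d))) (ℕP.m+n∸m≡n a (q ℕ.+ suc d))
      s∸[q+d] : s ∸ (q ℕ.+ suc d) ≡ b
      s∸[q+d] = trans (cong₂ _∸_ (trans (cong (ℕ._+ q) (ℕP.+-comm (suc d) b)) (ℕP.+-assoc b (suc d) q)) (ℕP.+-comm q (suc d)))
                      (ℕP.m+n∸n≡m b (suc d ℕ.+ q))

  lt : ∀ {k} → Fin k → Fin k → ℚ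
  lt zero    zero    = 0ℚ
  lt zero    (suc j) = 1ℚ
  lt (suc i) zero    = 0ℚ
  lt (suc i) (suc j) = lt i j

  lt-< : ∀ {k} (i j : Fin k) → i F.< j → lt i j ≡ 1ℚ
  lt-< zero    (suc j) _         = refl
  lt-< (suc i) (suc j) (s≤s i<j) = lt-< i j i<j

  lt-≥ : ∀ {k} (i j : Fin k) → j F.≤ i → lt i j ≡ 0ℚ
  lt-≥ zero    zero    _         = refl
  lt-≥ (suc i) zero    _         = refl
  lt-≥ (suc i) (suc j) (s≤s j≤i) = lt-≥ i j j≤i

  Σ-lt : ∀ {k} (i : Fin k) → Σℚ k (λ j → lt j i) ≡ ι (toℕ i)
  Σ-lt {suc k} zero    = trans (ℚP.+-identityˡ (Σℚ k (λ j → 0ℚ))) (Σ-zero {k} (λ _ → refl))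
  Σ-lt {suc k} (suc i) = cong (1ℚ +_) (Σ-lt i)

  -- In the reading of G as a functional, this applies the derivation Σ_i x_i ^ (s + 1) ∂_i to the
  -- alternant of x ^ c.
  V : ∀ {k} → ℕ → (Idx k → ℚ) → Idx k → ℚ
  V {k} s G c = Σℚ k (λ i → ι (c i) * G (c [ i ]+ s))

  -- In terms of symmetric polynomials acting on a Vandermonde determinant Δ, this is
  -- Σ_{a + b = s} p_a p_b Δ = 2 Σ_i x_i ^ (s + 1) ∂_i Δ + (s + 1) p_s Δ.
  vandermonde : ∀ {k} {G : Idx k → ℚ} → Anti G → ∀ s →
    Σℚ (suc s) (λ a → P (toℕ a) (P (s ∸ toℕ a) G) toℕ) ≡ 2ℚ * V s G toℕ + ι (suc s) * P s G toℕ
  vandermonde {k} {G} A s = begin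
    Σℚ (suc s) (λ a → Σℚ k (λ i → Σℚ k (λ j → t a i j)))
      ≡⟨ Σ-comm (λ a i → Σℚ k (t a i)) ⟩
    Σℚ k (λ i → Σℚ (suc s) (λ a → Σℚ k (t a i)))
      ≡⟨ Σ-cong (λ i → Σ-comm (λ a → t a i)) ⟩
    Σℚ k (λ i → Σℚ k (λ j → Σℚ (suc s) (λ a → t a i j)))
      -- For i ≠ j only the term that puts all of s on the larger index survives. An index m is the
      -- larger one for m values of the other, once in each order, which yields 2 V; for i = j all s
      -- + 1 terms coincide.
      ≡⟨ Σ-cong (λ i → Σ-cong (cases i)) ⟩
    Σℚ k (λ i → Σℚ k (λ j → lt i j * g j + (lt j i * g i + e i j * (ι (suc s) * g i))))
      ≡⟨ Σ-cong (λ i → Σ-+ (λ j → lt i j * g j) (λ j → lt j i * g i + e i j * (ι (suc s) * g i))) ⟩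
    Σℚ k (λ i → Σℚ k (λ j → lt i j * g j) + Σℚ k (λ j → lt j i * g i + e i j * (ι (suc s) * g i)))
      ≡⟨ Σ-+ (λ i → Σℚ k (λ j → lt i j * g j)) (λ i → Σℚ k (λ j → lt j i * g i + e i j * (ι (suc s) * g i))) ⟩
    Σℚ k (λ i → Σℚ k (λ j → lt i j * g j)) + Σℚ k (λ i → Σℚ k (λ j → lt j i * g i + e i j * (ι (suc s) * g i)))
      ≡⟨ cong₂ _+_ (trans (Σ-comm (λ i j → lt i j * g j)) (Σ-cong count)) (Σ-cong (λ i → trans
          (Σ-+ (λ j → lt j i * g i) (λ j → e i j * (ι (suc s) * g i))) (cong₂ _+_ (count i) (Σ-e i (ι (suc s) * g i))))) ⟩
    V s G toℕ + Σℚ k (λ i → ι (toℕ i) * g i + ι (suc s) * g i)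
      ≡⟨ cong (V s G toℕ +_) (trans (Σ-+ (λ i → ι (toℕ i) * g i) (λ i → ι (suc s) * g i))
          (cong (V s G toℕ +_) (Σ-*ˡ (ι (suc s)) g))) ⟩
    V s G toℕ + (V s G toℕ + ι (suc s) * P s G toℕ)
      ≡⟨ ring (V s G toℕ) (ι (suc s) * P s G toℕ) ⟩
    2ℚ * V s G toℕ + ι (suc s) * P s G toℕ ∎
    where
    ring : ∀ a b → a + (a + b) ≡ (1ℚ + 1ℚ) * a + b
    ring = solve-∀ ℚ-ring
    ring₁ : ∀ x y z → x ≡ 1ℚ * x + (0ℚ * y + 0ℚ * z)
    ring₁ = solve-∀ ℚ-ring
    ring₂ : ∀ x y z → x ≡ 0ℚ * y + (1ℚ * x + 0ℚ * z)
    ring₂ = solve-∀ ℚ-ring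
    ring₃ : ∀ x y z → x ≡ 0ℚ * y + (0ℚ * z + 1ℚ * x)
    ring₃ = solve-∀ ℚ-ring
    t : Fin (suc s) → Fin k → Fin k → ℚ
    t a i j = G (toℕ [ i ]+ toℕ a [ j ]+ (s ∸ toℕ a))
    g : Fin k → ℚ
    g i = G (toℕ [ i ]+ s)
    count : ∀ i → Σℚ k (λ j → lt j i * g i) ≡ ι (toℕ i) * g i
    count i = trans (Σ-*ʳ (g i) (λ j → lt j i)) (cong (_* g i) (Σ-lt i))
    cases : ∀ i j → Σℚ (suc s) (λ a → t a i j) ≡ lt i j * g j + (lt j i * g i + e i j * (ι (suc s) * g i))
    cases i j with FP.<-cmp i j
    ... | tri< i<j i≢j _ rewrite lt-< i j i<j | lt-≥ j i (ℕP.<⇒≤ i<j) | e-off i j i≢j =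
      trans (ladder A s i j i<j) (ring₁ (g j) (g i) (ι (suc s) * g i))
    ... | tri> _ i≢j j<i rewrite lt-< j i j<i | lt-≥ i j (ℕP.<⇒≤ j<i) | e-off i j i≢j =
      trans (trans reversed (ladder A s j i j<i)) (ring₂ (g i) (g j) (ι (suc s) * g i))
      where
      h : ℕ → ℚ
      h a = G (toℕ [ i ]+ a [ j ]+ (s ∸ a))
      reversed : Σℚ (suc s) (λ a → t a i j) ≡ Σℚ (suc s) (λ a → t a j i)
      reversed = trans (Σ-reverse (suc s) h) (Σ-cong {suc s} (λ a → ext A (λ x → trans
        ([]+-comm toℕ i (s ∸ toℕ a) j (s ∸ (s ∸ toℕ a)) x)
        (cong (λ b → (toℕ [ j ]+ b [ i ]+ (s ∸ toℕ a)) x) (ℕP.m∸[m∸n]≡n (FP.toℕ≤pred[n] a))))))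
    ... | tri≈ _ refl _ rewrite lt-≥ i i ℕP.≤-refl | e-diag i =
      trans (trans (Σ-cong {suc s} (λ a → ext A (λ x → trans ([]+-+ toℕ i (toℕ a) (s ∸ toℕ a) x)
        (cong (λ b → (toℕ [ i ]+ b) x) (ℕP.m+[n∸m]≡n (FP.toℕ≤pred[n] a)))))) (Σ-const (suc s) (g i)))
        (ring₃ (ι (suc s) * g i) (g i) (g i))

  -- Functions of two exponent sequences and commutation rules

  Pˡ Pʳ : ∀ {k} → ℕ → (Idx k → Idx k → ℚ) → Idx k → Idx k → ℚ
  Pˡ r G c d = P r (λ c → G c d) c
  Pʳ r G c d = P r (G c) d

  Vˡ Vʳ : ∀ {k} → ℕ → (Idx k → Idx k → ℚ) → Idx k → Idx k → ℚ
  Vˡ s G c d = V s (λ c → G c d) c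
  Vʳ s G c d = V s (G c) d

  -- Properties of `E` that survive power sums acting on the left, so that they remain available
  -- after any product of them has been applied. `transfer` is confined to positive indices, because
  -- p_0 is multiplication by k on both sides.
  record Adm {k} (G : Idx k → Idx k → ℚ) : Set where
    field
      antiˡ : ∀ d → Anti (λ c → G c d)
      antiʳ : ∀ c → Anti (G c)
      transfer : ∀ r c d → Pʳ (suc r) G c d ≡ - Pˡ (suc r) G c d
  open Adm

  E-adm : ∀ k → Adm (E k)
  E-adm k = record
    { antiˡ = λ d → record
      { ext = λ {c} {c′} h → E-cong {k} {c} {c′} {d} {d} h (λ _ → refl)
      ; anti = λ {i} {j} i≢j c → E-antiˡ {k} i≢j (cong c (transpose-at-i i j)) (cong c (transpose-at-j i j))
                 (λ x x≢i x≢j → cong c (transpose-fixed i j x x≢i x≢j)) d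
      }
    ; antiʳ = λ c → record
      { ext = λ {d} {d′} h → E-cong {k} {c} {c} {d} {d′} (λ _ → refl) h
      ; anti = λ {i} {j} i≢j d → E-antiʳ {k} i≢j (cong d (transpose-at-i i j)) (cong d (transpose-at-j i j))
                 (λ x x≢i x≢j → cong d (transpose-fixed i j x x≢i x≢j)) c
      }
    ; transfer = λ r c d → trans (ring (Pˡ (suc r) (E k) c d) (Pʳ (suc r) (E k) c d))
        (trans (cong (_+ - Pˡ (suc r) (E k) c d) (E-shift r c d)) (ℚP.+-identityˡ _))
    }
    where
    ring : ∀ a b → b ≡ (a + b) + - a
    ring = solve-∀ ℚ-ring

  Pˡ-adm : ∀ {k} r {G : Idx k → Idx k → ℚ} → Adm G → Adm (Pˡ r G)
  Pˡ-adm {k} r {G} a = record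
    { antiˡ = λ d → P-anti r (antiˡ a d)
    ; antiʳ = λ c → Σ-anti (λ i → antiʳ a (c [ i ]+ r))
    ; transfer = λ s c d → begin
        Σℚ k (λ i → Σℚ k (λ j → G (c [ j ]+ r) (d [ i ]+ suc s)))  ≡⟨ Σ-comm (λ i j → G (c [ j ]+ r) (d [ i ]+ suc s)) ⟩
        Σℚ k (λ j → Pʳ (suc s) G (c [ j ]+ r) d)                   ≡⟨ Σ-cong (λ j → transfer a s (c [ j ]+ r) d) ⟩
        Σℚ k (λ j → - Pˡ (suc s) G (c [ j ]+ r) d)                 ≡⟨ Σ-neg (λ j → Pˡ (suc s) G (c [ j ]+ r) d) ⟩
        - Pˡ r (Pˡ (suc s) G) c d                                  ≡⟨ cong -_ (P-comm (antiˡ a d) r (suc s) c) ⟩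
        - Pˡ (suc s) (Pˡ r G) c d                                  ∎
    }

  Pˡs : ∀ {k} → List ℕ → (Idx k → Idx k → ℚ) → Idx k → Idx k → ℚ
  Pˡs []       G = G
  Pˡs (r ∷ rs) G = Pˡ r (Pˡs rs G)

  Pˡs-adm : ∀ {k} rs {G : Idx k → Idx k → ℚ} → Adm G → Adm (Pˡs rs G)
  Pˡs-adm []       a = a
  Pˡs-adm (r ∷ rs) a = Pˡ-adm r (Pˡs-adm rs a)

  Σᴸ : ∀ {A : Set} → List A → (A → ℚ) → ℚ
  Σᴸ []       f = 0ℚ
  Σᴸ (x ∷ xs) f = f x + Σᴸ xs f

  Σᴸ-cong : ∀ {A : Set} (xs : List A) {f g : A → ℚ} → (∀ x → f x ≡ g x) → Σᴸ xs f ≡ Σᴸ xs g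
  Σᴸ-cong []       h = refl
  Σᴸ-cong (x ∷ xs) h = cong₂ _+_ (h x) (Σᴸ-cong xs h)

  Σᴸ-map : ∀ {A B : Set} (m : A → B) xs (f : B → ℚ) → Σᴸ (map m xs) f ≡ Σᴸ xs (f ∘ m)
  Σᴸ-map m []       f = refl
  Σᴸ-map m (x ∷ xs) f = cong (f (m x) +_) (Σᴸ-map m xs f)

  Σᴸ-*ˡ : ∀ {A : Set} t (xs : List A) f → Σᴸ xs (λ x → t * f x) ≡ t * Σᴸ xs f
  Σᴸ-*ˡ t []       f = sym (ℚP.*-zeroʳ t)
  Σᴸ-*ˡ t (x ∷ xs) f = trans (cong (t * f x +_) (Σᴸ-*ˡ t xs f)) (sym (ℚP.*-distribˡ-+ t (f x) (Σᴸ xs f)))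

  Σ-Σᴸ : ∀ {A : Set} {n} (xs : List A) (f : Fin n → A → ℚ) →
         Σℚ n (λ i → Σᴸ xs (f i)) ≡ Σᴸ xs (λ x → Σℚ n (λ i → f i x))
  Σ-Σᴸ {n = n} []       f = Σ-zero {n} (λ _ → refl)
  Σ-Σᴸ (x ∷ xs) f = trans (Σ-+ (λ i → f i x) (λ i → Σᴸ xs (f i)))
    (cong (Σℚ _ (λ i → f i x) +_) (Σ-Σᴸ xs f))

  -- Lists the ways of merging s into one part. The old value of that part is recorded as well,
  -- since it is the coefficient λ_j in the recursion.
  bumps : ℕ → List ℕ → List (ℕ × List ℕ)
  bumps s []       = []
  bumps s (r ∷ rs) = (r , r ℕ.+ s ∷ rs) ∷ map (λ p → proj₁ p , r ∷ proj₂ p) (bumps s rs)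

  P-scale : ∀ {k} r t (G : Idx k → ℚ) c → P r (λ c → t * G c) c ≡ t * P r G c
  P-scale r t G c = Σ-*ˡ t (λ i → G (c [ i ]+ r))

  P-linear : ∀ {k} r (A B : Idx k → ℚ) t (H K : Idx k → ℚ) c →
             P r (λ c → A c + B c + t * H c + K c) c ≡ P r A c + P r B c + t * P r H c + P r K c
  P-linear r A B t H K c = trans (Σ-+ (λ i → A (f i) + B (f i) + t * H (f i)) (K ∘ f)) (cong (_+ P r K c)
    (trans (Σ-+ (λ i → A (f i) + B (f i)) (λ i → t * H (f i))) (cong₂ _+_ (Σ-+ (A ∘ f) (B ∘ f)) (P-scale r t H c))))
    where f = λ i → c [ i ]+ r

  -- The derivation x ^ (s + 1) d/dx sends x ^ r to r x ^ (r + s), so its commutator with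
  -- multiplication by p_r is r p_(r+s).
  P-V : ∀ {k} {G : Idx k → ℚ} → Anti G → ∀ r s c →
        P r (V s G) c ≡ V s (P r G) c + ι r * P (r ℕ.+ s) G c
  P-V {k} {G} A r s c = begin
    Σℚ k (λ j → Σℚ k (λ i → ι ((c [ j ]+ r) i) * G (c [ j ]+ r [ i ]+ s)))
      ≡⟨ Σ-cong (λ j → trans (Σ-cong (split j)) (Σ-+ (λ i → ι (c i) * G (c [ j ]+ r [ i ]+ s)) (diag j))) ⟩
    Σℚ k (λ j → Σℚ k (λ i → ι (c i) * G (c [ j ]+ r [ i ]+ s)) + Σℚ k (diag j))
      ≡⟨ Σ-+ (λ j → Σℚ k (λ i → ι (c i) * G (c [ j ]+ r [ i ]+ s))) (λ j → Σℚ k (diag j)) ⟩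
    Σℚ k (λ j → Σℚ k (λ i → ι (c i) * G (c [ j ]+ r [ i ]+ s))) + Σℚ k (λ j → Σℚ k (diag j))
      ≡⟨ cong₂ _+_ (trans (Σ-comm (λ j i → ι (c i) * G (c [ j ]+ r [ i ]+ s))) (Σ-cong (λ i → trans
           (Σ-cong (λ j → cong (ι (c i) *_) (ext A ([]+-comm c j r i s)))) (Σ-*ˡ (ι (c i)) (λ j → G (c [ i ]+ s [ j ]+ r))))))
         (trans (Σ-cong collect) (Σ-*ˡ (ι r) (λ j → G (c [ j ]+ (r ℕ.+ s))))) ⟩
    V s (P r G) c + ι r * P (r ℕ.+ s) G c ∎
    where
    diag : Fin k → Fin k → ℚ
    diag j i = ι (bump j r i) * G (c [ j ]+ r [ i ]+ s)
    split : ∀ j i → ι ((c [ j ]+ r) i) * G (c [ j ]+ r [ i ]+ s) ≡ ι (c i) * G (c [ j ]+ r [ i ]+ s) + diag j i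
    split j i = trans (cong (_* G (c [ j ]+ r [ i ]+ s)) (ι-+ (c i) (bump j r i)))
                      (ℚP.*-distribʳ-+ (G (c [ j ]+ r [ i ]+ s)) (ι (c i)) (ι (bump j r i)))
    collect : ∀ j → Σℚ k (diag j) ≡ ι r * G (c [ j ]+ (r ℕ.+ s))
    collect j = trans (Σ-single (diag j) j (λ i i≢j →
                  trans (cong (λ b → ι b * G (c [ j ]+ r [ i ]+ s)) (bump-off j r i i≢j)) (ℚP.*-zeroˡ (G (c [ j ]+ r [ i ]+ s)))))
      (cong₂ (λ a b → ι a * b) (bump-diag j r) (ext A ([]+-+ c j r s)))

  Pˡ-Vʳ : ∀ {k} (G : Idx k → Idx k → ℚ) r s c d → Pˡ r (Vʳ s G) c d ≡ Vʳ s (Pˡ r G) c d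
  Pˡ-Vʳ {k} G r s c d = trans (Σ-comm (λ j i → ι (d i) * G (c [ j ]+ r) (d [ i ]+ s)))
    (Σ-cong (λ i → Σ-*ˡ (ι (d i)) (λ j → G (c [ j ]+ r) (d [ i ]+ s))))

  -- The recursion for products of power sums at (δ, δ)

  module Euler (k : ℕ) where
    G : List ℕ → Idx k → Idx k → ℚ
    G rs = Pˡs rs (E k)

    G-adm : ∀ rs → Adm (G rs)
    G-adm rs = Pˡs-adm rs (E-adm k)

    C : ℕ → List ℕ → Idx k → Idx k → ℚ
    C s rs c d = Σᴸ (bumps s rs) (λ p → ι (proj₁ p) * G (proj₂ p) c d)

    tr : ℕ → ℚ
    tr s = Σℚ (k ℕ.+ k) (λ i → deriv s (e i) i)

    -- For the empty product this is `E-euler` with p_(s+1) moved from d to c. To adjoin a part r,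
    -- apply `Pˡ r`: it commutes with everything except `Vˡ`, where `P-V` supplies the new merged
    -- term. General c and d are kept because `Pˡ r` evaluates the identity at shifted exponents.
    euler : ∀ s rs c d →
            Vˡ s (G rs) c d + Vʳ s (G rs) c d + 2ℚ * G (suc s ∷ rs) c d + C s rs c d ≡ tr s * G rs c d
    euler s [] c d = begin
      Vˡ s (E k) c d + Vʳ s (E k) c d + 2ℚ * Pˡ (suc s) (E k) c d + 0ℚ
        ≡⟨ ring (Vˡ s (E k) c d) (Vʳ s (E k) c d) (Pˡ (suc s) (E k) c d) ⟩
      (Vˡ s (E k) c d + Pˡ (suc s) (E k) c d) + (Vʳ s (E k) c d + - - Pˡ (suc s) (E k) c d)
        ≡⟨ cong (λ x → (Vˡ s (E k) c d + Pˡ (suc s) (E k) c d) + (Vʳ s (E k) c d + - x)) (transfer (E-adm k) s c d) ⟨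
      (Vˡ s (E k) c d + Pˡ (suc s) (E k) c d) + (Vʳ s (E k) c d + - Pʳ (suc s) (E k) c d)
        ≡⟨ cong₂ _+_ (Σ-+ (λ i → ι (c i) * E k (c [ i ]+ s) d) (λ i → E k (c [ i ]+ suc s) d))
             (trans (Σ-+ (λ i → ι (d i) * E k c (d [ i ]+ s)) (λ i → - E k c (d [ i ]+ suc s)))
               (cong (Vʳ s (E k) c d +_) (Σ-neg (λ i → E k c (d [ i ]+ suc s))))) ⟨
      Σℚ k (λ i → ι (c i) * E k (c [ i ]+ s) d + E k (c [ i ]+ suc s) d) +
      Σℚ k (λ i → ι (d i) * E k c (d [ i ]+ s) + - E k c (d [ i ]+ suc s))
        ≡⟨ E-euler s c d ⟩
      tr s * E k c d ∎
      where
      ring : ∀ a b p → a + b + (1ℚ + 1ℚ) * p + 0ℚ ≡ (a + p) + (b + - - p)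
      ring = solve-∀ ℚ-ring
    euler s (r ∷ rs) c d = begin
      Vˡ s (G (r ∷ rs)) c d + Vʳ s (G (r ∷ rs)) c d + 2ℚ * G (suc s ∷ r ∷ rs) c d + C s (r ∷ rs) c d
        ≡⟨ cong (Vˡ s (G (r ∷ rs)) c d + Vʳ s (G (r ∷ rs)) c d + 2ℚ * G (suc s ∷ r ∷ rs) c d +_)
             (cong (ι r * G (r ℕ.+ s ∷ rs) c d +_) C-tail) ⟩
      Vˡ s (G (r ∷ rs)) c d + Vʳ s (G (r ∷ rs)) c d + 2ℚ * G (suc s ∷ r ∷ rs) c d +
        (ι r * G (r ℕ.+ s ∷ rs) c d + Pˡ r (C s rs) c d)
        ≡⟨ ring (Vˡ s (G (r ∷ rs)) c d) (Vʳ s (G (r ∷ rs)) c d) (2ℚ * G (suc s ∷ r ∷ rs) c d) (ι r * G (r ℕ.+ s ∷ rs) c d) (Pˡ r (C s rs) c d) ⟩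
      (Vˡ s (G (r ∷ rs)) c d + ι r * G (r ℕ.+ s ∷ rs) c d) + Vʳ s (G (r ∷ rs)) c d + 2ℚ * G (suc s ∷ r ∷ rs) c d + Pˡ r (C s rs) c d
        ≡⟨ cong₂ (λ x y → x + y + 2ℚ * G (suc s ∷ r ∷ rs) c d + Pˡ r (C s rs) c d)
             (P-V (antiˡ (G-adm rs) d) r s c) (Pˡ-Vʳ (G rs) r s c d) ⟨
      Pˡ r (Vˡ s (G rs)) c d + Pˡ r (Vʳ s (G rs)) c d + 2ℚ * G (suc s ∷ r ∷ rs) c d + Pˡ r (C s rs) c d
        ≡⟨ cong (λ x → Pˡ r (Vˡ s (G rs)) c d + Pˡ r (Vʳ s (G rs)) c d + 2ℚ * x + Pˡ r (C s rs) c d)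
             (P-comm (antiˡ (G-adm rs) d) (suc s) r c) ⟩
      Pˡ r (Vˡ s (G rs)) c d + Pˡ r (Vʳ s (G rs)) c d + 2ℚ * Pˡ r (G (suc s ∷ rs)) c d + Pˡ r (C s rs) c d
        ≡⟨ P-linear r (λ c → Vˡ s (G rs) c d) (λ c → Vʳ s (G rs) c d) 2ℚ (λ c → G (suc s ∷ rs) c d) (λ c → C s rs c d) c ⟨
      Pˡ r (λ c d → Vˡ s (G rs) c d + Vʳ s (G rs) c d + 2ℚ * G (suc s ∷ rs) c d + C s rs c d) c d
        ≡⟨ P-cong r (λ c → euler s rs c d) c ⟩
      Pˡ r (λ c d → tr s * G rs c d) c d
        ≡⟨ P-scale r (tr s) (λ c → G rs c d) c ⟩
      tr s * G (r ∷ rs) c d ∎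
      where
      ring : ∀ a b x y z → a + b + x + (y + z) ≡ (a + y) + b + x + z
      ring = solve-∀ ℚ-ring
      C-tail : Σᴸ (map (λ p → proj₁ p , r ∷ proj₂ p) (bumps s rs)) (λ p → ι (proj₁ p) * G (proj₂ p) c d) ≡ Pˡ r (C s rs) c d
      C-tail = begin
        Σᴸ (map (λ p → proj₁ p , r ∷ proj₂ p) (bumps s rs)) (λ p → ι (proj₁ p) * G (proj₂ p) c d)
          ≡⟨ Σᴸ-map (λ p → proj₁ p , r ∷ proj₂ p) (bumps s rs) (λ p → ι (proj₁ p) * G (proj₂ p) c d) ⟩
        Σᴸ (bumps s rs) (λ p → ι (proj₁ p) * Pˡ r (G (proj₂ p)) c d)
          ≡⟨ Σᴸ-cong (bumps s rs) (λ p → sym (P-scale r (ι (proj₁ p)) (λ c → G (proj₂ p) c d) c)) ⟩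
        Σᴸ (bumps s rs) (λ p → Pˡ r (λ c d → ι (proj₁ p) * G (proj₂ p) c d) c d)
          ≡⟨ Σ-Σᴸ (bumps s rs) (λ j p → ι (proj₁ p) * G (proj₂ p) (c [ j ]+ r) d) ⟨
        Pˡ r (C s rs) c d ∎

    ⟪_⟫ : List ℕ → ℚ
    ⟪ rs ⟫ = G rs toℕ toℕ

    Cδ : ℕ → List ℕ → ℚ
    Cδ s rs = Σᴸ (bumps s rs) (λ p → ι (proj₁ p) * ⟪ proj₂ p ⟫)

    -- The end terms a = 0 and a = s contain p_0, which acts as the scalar k. They are split off
    -- because `transfer` can only be applied to the interior terms.
    vandermonde-interior : ∀ {H : Idx k → ℚ} → Anti H → ∀ t →
          Σℚ t (λ a → P (suc (toℕ a)) (P (t ∸ toℕ a) H) toℕ) + 2ℚ * (ι k * P (suc t) H toℕ)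
          ≡ 2ℚ * V (suc t) H toℕ + ι (suc (suc t)) * P (suc t) H toℕ
    vandermonde-interior {H} A t = begin
      Σℚ t (f ∘ suc ∘ toℕ) + 2ℚ * (ι k * P (suc t) H toℕ)
        ≡⟨ ring (Σℚ t (f ∘ suc ∘ toℕ)) (ι k * P (suc t) H toℕ) ⟩
      ι k * P (suc t) H toℕ + (Σℚ t (f ∘ suc ∘ toℕ) + ι k * P (suc t) H toℕ)
        ≡⟨ cong₂ (λ x y → x + (Σℚ t (f ∘ suc ∘ toℕ) + y)) first last ⟨
      f 0 + (Σℚ t (f ∘ suc ∘ toℕ) + f (suc t))
        ≡⟨ cong (f 0 +_) (Σ-last t (f ∘ suc)) ⟨
      Σℚ (suc (suc t)) (f ∘ toℕ)
        ≡⟨ vandermonde A (suc t) ⟩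
      2ℚ * V (suc t) H toℕ + ι (suc (suc t)) * P (suc t) H toℕ ∎
      where
      f : ℕ → ℚ
      f a = P a (P (suc t ∸ a) H) toℕ
      ring : ∀ a b → a + (1ℚ + 1ℚ) * b ≡ b + (a + b)
      ring = solve-∀ ℚ-ring
      first : f 0 ≡ ι k * P (suc t) H toℕ
      first = P-0 (P-anti (suc t) A) toℕ
      last : f (suc t) ≡ ι k * P (suc t) H toℕ
      last = begin
        P (suc t) (P (t ∸ t) H) toℕ       ≡⟨ cong (λ s → P (suc t) (P s H) toℕ) (ℕP.n∸n≡0 t) ⟩
        P (suc t) (P 0 H) toℕ             ≡⟨ P-cong (suc t) (P-0 A) toℕ ⟩
        P (suc t) (λ c → ι k * H c) toℕ   ≡⟨ P-scale (suc t) (ι k) H toℕ ⟩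
        ι k * P (suc t) H toℕ             ∎

    -- The trace is 0, so everything rests on evaluating Vˡ + Vʳ at (δ, δ). Adding the Vandermonde
    -- identities of both sides, the multiples of p_s cancel because transfer changes their sign,
    -- while an interior product p_a p_b is transferred twice and keeps its sign.
    recursion-suc : ∀ t rs → 2ℚ * ⟪ suc (suc t) ∷ rs ⟫ ≡
                    - (Σℚ t (λ a → ⟪ suc (toℕ a) ∷ t ∸ toℕ a ∷ rs ⟫) + Cδ (suc t) rs)
    recursion-suc t rs = begin
      2ℚ * q
        ≡⟨ ring₁ (vˡ + vʳ) (2ℚ * q) (Cδ s rs) ⟩
      (vˡ + vʳ + 2ℚ * q + Cδ s rs) + - ((vˡ + vʳ) + Cδ s rs)
        ≡⟨ cong₂ (λ x y → x + - (y + Cδ s rs)) (trans (euler s rs toℕ toℕ) (trans (cong (_* ⟪ rs ⟫) tr-0) (ℚP.*-zeroˡ ⟪ rs ⟫))) vˡ+vʳ ⟩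
      0ℚ + - (m + Cδ s rs)
        ≡⟨ ℚP.+-identityˡ _ ⟩
      - (m + Cδ s rs) ∎
      where
      s = suc t
      a = G-adm rs
      q = ⟪ suc s ∷ rs ⟫
      p = ⟪ s ∷ rs ⟫
      m = Σℚ t (λ a → ⟪ suc (toℕ a) ∷ t ∸ toℕ a ∷ rs ⟫)
      mʳ = Σℚ t (λ a → P (suc (toℕ a)) (P (t ∸ toℕ a) (G rs toℕ)) toℕ)
      vˡ = Vˡ s (G rs) toℕ toℕ
      vʳ = Vʳ s (G rs) toℕ toℕ
      pʳ = Pʳ s (G rs) toℕ toℕ
      ring₁ : ∀ v q c → q ≡ (v + q + c) + - (v + c)
      ring₁ = solve-∀ ℚ-ring
      tr-0 : tr s ≡ 0ℚ
      tr-0 = Σ-zero {k ℕ.+ k} (deriv-trace t)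
      mʳ≡m : mʳ ≡ m
      mʳ≡m = Σ-cong λ i → middle (suc (toℕ i)) (t ∸ toℕ i) (s≤s z≤n) (ℕP.m<n⇒0<n∸m (FP.toℕ<n i))
        where
        middle : ∀ x y → 0 < x → 0 < y → P x (P y (G rs toℕ)) toℕ ≡ ⟪ x ∷ y ∷ rs ⟫
        middle (suc x) (suc y) _ _ = begin
          P (suc x) (P (suc y) (G rs toℕ)) toℕ              ≡⟨ P-cong (suc x) (transfer a y toℕ) toℕ ⟩
          P (suc x) (λ d → - G (suc y ∷ rs) toℕ d) toℕ      ≡⟨ Σ-neg (λ i → G (suc y ∷ rs) toℕ (toℕ [ i ]+ suc x)) ⟩
          - Pʳ (suc x) (G (suc y ∷ rs)) toℕ toℕ             ≡⟨ cong -_ (transfer (G-adm (suc y ∷ rs)) x toℕ toℕ) ⟩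
          - - ⟪ suc x ∷ suc y ∷ rs ⟫                        ≡⟨ neg-neg ⟪ suc x ∷ suc y ∷ rs ⟫ ⟩
          ⟪ suc x ∷ suc y ∷ rs ⟫                            ∎
          where
          neg-neg : ∀ x → - - x ≡ x
          neg-neg = solve-∀ ℚ-ring
      ring₂ : ∀ x y l p → (x + y) + (x + y) ≡
        (((1ℚ + 1ℚ) * x + l * p) + ((1ℚ + 1ℚ) * y + l * - p))
      ring₂ = solve-∀ ℚ-ring
      ring₃ : ∀ m c p → (m + (1ℚ + 1ℚ) * (c * p)) + (m + (1ℚ + 1ℚ) * (c * - p)) ≡ m + m
      ring₃ = solve-∀ ℚ-ring
      doubled : (vˡ + vʳ) + (vˡ + vʳ) ≡ m + m
      doubled = begin
        (vˡ + vʳ) + (vˡ + vʳ)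
          ≡⟨ ring₂ vˡ vʳ (ι (suc s)) p ⟩
        (2ℚ * vˡ + ι (suc s) * p) + (2ℚ * vʳ + ι (suc s) * - p)
          ≡⟨ cong (λ x → (2ℚ * vˡ + ι (suc s) * p) + (2ℚ * vʳ + ι (suc s) * x)) (transfer a t toℕ toℕ) ⟨
        (2ℚ * vˡ + ι (suc s) * p) + (2ℚ * vʳ + ι (suc s) * pʳ)
          ≡⟨ cong₂ _+_ (vandermonde-interior (antiˡ a toℕ) t) (vandermonde-interior (antiʳ a toℕ) t) ⟨
        (m + 2ℚ * (ι k * p)) + (mʳ + 2ℚ * (ι k * pʳ))
          ≡⟨ cong₂ (λ x y → (m + 2ℚ * (ι k * p)) + (x + 2ℚ * (ι k * y))) mʳ≡m (transfer a t toℕ toℕ) ⟩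
        (m + 2ℚ * (ι k * p)) + (m + 2ℚ * (ι k * - p))
          ≡⟨ ring₃ m (ι k) p ⟩
        m + m ∎
      vˡ+vʳ : vˡ + vʳ ≡ m
      vˡ+vʳ = ι-cancel 2 (trans (ring₄ (vˡ + vʳ)) (trans doubled (sym (ring₄ m))))
        where
        ring₄ : ∀ x → (1ℚ + (1ℚ + 0ℚ)) * x ≡ x + x
        ring₄ = solve-∀ ℚ-ring

    -- The degrees 0, ..., 2k - 1 are split at k. The two sums over 0, ..., k - 1 are exactly what
    -- `Vˡ` and `Vʳ` give at δ for s = 0, so that k² is left in `recursion-one`.
    tr-zero : tr 0 ≡ (Σℚ k (λ i → ι (toℕ i)) + Σℚ k (λ i → ι (toℕ i))) + ι k * ι k
    tr-zero = begin
      Σℚ (k ℕ.+ k) (λ i → deriv 0 (e i) i)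
        ≡⟨ Σ-cong {k ℕ.+ k} deriv-trace₀ ⟩
      Σℚ (k ℕ.+ k) (λ i → ι (k ℕ.+ k ∸ suc (toℕ i)))
        ≡⟨ Σ-reverse (k ℕ.+ k) ι ⟨
      Σℚ (k ℕ.+ k) (λ i → ι (toℕ i))
        ≡⟨ Σ-↑ k k (λ i → ι (toℕ i)) ⟩
      Σℚ k (λ i → ι (toℕ (i ↑ˡ k))) + Σℚ k (λ i → ι (toℕ (k ↑ʳ i)))
        ≡⟨ cong₂ _+_ (Σ-cong {k} (λ i → cong ι (FP.toℕ-↑ˡ i k)))
             (Σ-cong {k} (λ i → trans (cong ι (FP.toℕ-↑ʳ k i)) (trans (ι-+ k (toℕ i)) (cong (_+ ι (toℕ i)) (sym (ℚP.*-identityʳ (ι k))))))) ⟩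
      σ + Σℚ k (λ i → ι k * 1ℚ + ι (toℕ i))
        ≡⟨ cong (σ +_) (trans (Σ-+ {k} (λ i → ι k * 1ℚ) (λ i → ι (toℕ i))) (cong (_+ σ) (trans (Σ-*ˡ {k} (ι k) (λ _ → 1ℚ)) (cong (ι k *_) (trans (Σ-const k 1ℚ) (ℚP.*-identityʳ (ι k))))))) ⟩
      σ + (ι k * ι k + σ)
        ≡⟨ ring σ (ι k * ι k) ⟩
      (σ + σ) + ι k * ι k ∎
      where
      σ = Σℚ k (λ i → ι (toℕ i))
      ring : ∀ a b → a + (b + a) ≡ (a + a) + b
      ring = solve-∀ ℚ-ring

    recursion-one : ∀ rs → 2ℚ * ⟪ 1 ∷ rs ⟫ ≡ (ι k * ι k) * ⟪ rs ⟫ + - Cδ 0 rs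
    recursion-one rs = begin
      2ℚ * ⟪ 1 ∷ rs ⟫
        ≡⟨ ring₁ (σ * ⟪ rs ⟫ + σ * ⟪ rs ⟫) (2ℚ * ⟪ 1 ∷ rs ⟫) (Cδ 0 rs) ⟩
      (σ * ⟪ rs ⟫ + σ * ⟪ rs ⟫ + 2ℚ * ⟪ 1 ∷ rs ⟫ + Cδ 0 rs) + - (σ * ⟪ rs ⟫ + σ * ⟪ rs ⟫ + Cδ 0 rs)
        ≡⟨ cong (_+ - (σ * ⟪ rs ⟫ + σ * ⟪ rs ⟫ + Cδ 0 rs)) (trans (sym (cong₂ (λ x y → x + y + 2ℚ * ⟪ 1 ∷ rs ⟫ + Cδ 0 rs) vˡ vʳ)) (euler 0 rs toℕ toℕ)) ⟩
      tr 0 * ⟪ rs ⟫ + - (σ * ⟪ rs ⟫ + σ * ⟪ rs ⟫ + Cδ 0 rs)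
        ≡⟨ cong (λ x → x * ⟪ rs ⟫ + - (σ * ⟪ rs ⟫ + σ * ⟪ rs ⟫ + Cδ 0 rs)) tr-zero ⟩
      ((σ + σ) + ι k * ι k) * ⟪ rs ⟫ + - (σ * ⟪ rs ⟫ + σ * ⟪ rs ⟫ + Cδ 0 rs)
        ≡⟨ ring₂ σ (ι k * ι k) ⟪ rs ⟫ (Cδ 0 rs) ⟩
      (ι k * ι k) * ⟪ rs ⟫ + - Cδ 0 rs ∎
      where
      σ = Σℚ k (λ i → ι (toℕ i))
      a = G-adm rs
      ring₁ : ∀ v q c → q ≡ (v + q + c) + - (v + c)
      ring₁ = solve-∀ ℚ-ring
      ring₂ : ∀ s k g c → ((s + s) + k) * g + - (s * g + s * g + c) ≡ k * g + - c
      ring₂ = solve-∀ ℚ-ring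
      vˡ : Vˡ 0 (G rs) toℕ toℕ ≡ σ * ⟪ rs ⟫
      vˡ = trans (Σ-cong (λ i → cong (ι (toℕ i) *_) (ext (antiˡ a toℕ) ([]+-0 toℕ i)))) (Σ-*ʳ {k} ⟪ rs ⟫ (λ i → ι (toℕ i)))
      vʳ : Vʳ 0 (G rs) toℕ toℕ ≡ σ * ⟪ rs ⟫
      vʳ = trans (Σ-cong (λ i → cong (ι (toℕ i) *_) (ext (antiʳ a toℕ) ([]+-0 toℕ i)))) (Σ-*ʳ {k} ⟪ rs ⟫ (λ i → ι (toℕ i)))

  -- Polynomials in k

  -- Agreement is asked for at every natural k: the recursions hold for all k, and bounds on k enter
  -- only when injections are compared with rearrangements.
  IsPoly : ℕ → (ℕ → ℚ) → Set
  IsPoly d f = Σ (List ℚ) (λ cs → length cs ≤ 1 ℕ.+ d × (∀ k → f k ≡ evalPoly cs k))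

  poly-cong : ∀ {d f g} → (∀ k → f k ≡ g k) → IsPoly d g → IsPoly d f
  poly-cong h (cs , len , eq) = cs , len , λ k → trans (h k) (eq k)

  poly-mono : ∀ {d d′ f} → d ≤ d′ → IsPoly d f → IsPoly d′ f
  poly-mono d≤d′ (cs , len , eq) = cs , ℕP.≤-trans len (s≤s d≤d′) , eq

  poly-const : ∀ {d} c → IsPoly d (λ _ → c)
  poly-const c = c ∷ [] , s≤s z≤n , λ k → sym (trans (cong (c +_) (ℚP.*-zeroʳ (pos k / 1))) (ℚP.+-identityʳ c))

  addPoly : List ℚ → List ℚ → List ℚ
  addPoly []       ds       = ds
  addPoly (c ∷ cs) []       = c ∷ cs
  addPoly (c ∷ cs) (d ∷ ds) = c + d ∷ addPoly cs ds

  length-addPoly : ∀ {n} cs ds → length cs ≤ n → length ds ≤ n → length (addPoly cs ds) ≤ n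
  length-addPoly []       ds       _       q       = q
  length-addPoly (c ∷ cs) []       p       _       = p
  length-addPoly (c ∷ cs) (d ∷ ds) (s≤s p) (s≤s q) = s≤s (length-addPoly cs ds p q)

  eval-addPoly : ∀ cs ds k → evalPoly (addPoly cs ds) k ≡ evalPoly cs k + evalPoly ds k
  eval-addPoly []       ds       k = sym (ℚP.+-identityˡ (evalPoly ds k))
  eval-addPoly (c ∷ cs) []       k = sym (ℚP.+-identityʳ (evalPoly (c ∷ cs) k))
  eval-addPoly (c ∷ cs) (d ∷ ds) k = trans (cong (λ y → (c + d) + (pos k / 1) * y) (eval-addPoly cs ds k))
    (ring c d (pos k / 1) (evalPoly cs k) (evalPoly ds k))
    where
    ring : ∀ c d x a b → (c + d) + x * (a + b) ≡ (c + x * a) + (d + x * b)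
    ring = solve-∀ ℚ-ring

  poly-+ : ∀ {d f g} → IsPoly d f → IsPoly d g → IsPoly d (λ k → f k + g k)
  poly-+ (cs , l₁ , e₁) (ds , l₂ , e₂) = addPoly cs ds , length-addPoly cs ds l₁ l₂ ,
    λ k → trans (cong₂ _+_ (e₁ k) (e₂ k)) (sym (eval-addPoly cs ds k))

  eval-scale : ∀ t cs k → evalPoly (map (t *_) cs) k ≡ t * evalPoly cs k
  eval-scale t []       k = sym (ℚP.*-zeroʳ t)
  eval-scale t (c ∷ cs) k = trans (cong (λ y → t * c + (pos k / 1) * y) (eval-scale t cs k))
    (ring t c (pos k / 1) (evalPoly cs k))
    where
    ring : ∀ t c x a → t * c + x * (t * a) ≡ t * (c + x * a)
    ring = solve-∀ ℚ-ring

  poly-* : ∀ {d f} t → IsPoly d f → IsPoly d (λ k → t * f k)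
  poly-* t (cs , l , eq) = map (t *_) cs , subst (ℕ._≤ _) (sym (ListP.length-map (t *_) cs)) l ,
    λ k → trans (cong (t *_) (eq k)) (sym (eval-scale t cs k))

  poly-neg : ∀ {d f} → IsPoly d f → IsPoly d (λ k → - f k)
  poly-neg {f = f} p = poly-cong (λ k → neg≡-1* (f k)) (poly-* (- 1ℚ) p)

  poly-square : ∀ {d f} → IsPoly d f → IsPoly (2 ℕ.+ d) (λ k → (ι k * ι k) * f k)
  poly-square {f = f} (cs , l , eq) = 0ℚ ∷ 0ℚ ∷ cs , s≤s (s≤s l) , λ k →
    trans (cong₂ (λ x y → (x * x) * y) (ι≡/1 k) (eq k)) (ring (pos k / 1) (evalPoly cs k))
    where
    ring : ∀ x a → (x * x) * a ≡ 0ℚ + x * (0ℚ + x * a)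
    ring = solve-∀ ℚ-ring

  poly-Σ : ∀ {d} n (f : Fin n → ℕ → ℚ) → (∀ i → IsPoly d (f i)) → IsPoly d (λ k → Σℚ n (λ i → f i k))
  poly-Σ zero    f p = poly-const 0ℚ
  poly-Σ (suc n) f p = poly-+ (p zero) (poly-Σ n (f ∘ suc) (p ∘ suc))

  poly-Σᴸ : ∀ {d} {A : Set} {xs : List A} {f : A → ℕ → ℚ} → All (λ x → IsPoly d (f x)) xs →
            IsPoly d (λ k → Σᴸ xs (λ x → f x k))
  poly-Σᴸ []       = poly-const 0ℚ
  poly-Σᴸ (p ∷ ps) = poly-+ p (poly-Σᴸ ps)

  AllPos : List ℕ → Set
  AllPos = All (0 ℕ.<_)

  bumps-All : ∀ s {rs} → AllPos rs →
              All (λ p → AllPos (proj₂ p) × sumℕ (proj₂ p) ≡ s ℕ.+ sumℕ rs × length (proj₂ p) ≡ length rs) (bumps s rs)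
  bumps-All s []             = []
  bumps-All s (_∷_ {r} {rs} 0<r pos-rs) =
    (ℕP.<-≤-trans 0<r (ℕP.m≤m+n r s) ∷ pos-rs , trans (cong (ℕ._+ sumℕ rs) (ℕP.+-comm r s)) (ℕP.+-assoc s r (sumℕ rs)) , refl) ∷
    AllP.map⁺ (All.map (λ { {_ , ν} (p , q , l) → 0<r ∷ p ,
      trans (cong (r ℕ.+_) q) (trans (sym (ℕP.+-assoc r s (sumℕ rs))) (trans (cong (ℕ._+ sumℕ rs) (ℕP.+-comm r s)) (ℕP.+-assoc s r (sumℕ rs)))) ,
      cong suc l }) (bumps-All s pos-rs))

  open Euler using (⟪_⟫; Cδ; recursion-one; recursion-suc)

  -- With x = ⟨λ⟩ and n = |λ| this is 2 ^ |λ| ⟨λ⟩ / E(δ, δ), as `norm k` is the inverse of E(δ, δ).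
  -- Each use of the recursion consumes one factor 2.
  scaled : ℕ → ℕ → ℚ → ℚ
  scaled n k x = pw 2ℚ n * (norm k * x)

  scaled-suc : ∀ n k x → scaled (suc n) k x ≡ scaled n k (2ℚ * x)
  scaled-suc n k x = ring (pw 2ℚ n) (norm k) x
    where
    ring : ∀ p q x → (1ℚ + 1ℚ) * p * (q * x) ≡ p * (q * ((1ℚ + 1ℚ) * x))
    ring = solve-∀ ℚ-ring

  scaled-+ : ∀ n k x y → scaled n k (x + y) ≡ scaled n k x + scaled n k y
  scaled-+ n k x y = ring (pw 2ℚ n) (norm k) x y
    where
    ring : ∀ p q x y → p * (q * (x + y)) ≡ p * (q * x) + p * (q * y)
    ring = solve-∀ ℚ-ring

  scaled-* : ∀ n k t x → scaled n k (t * x) ≡ t * scaled n k x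
  scaled-* n k t x = ring (pw 2ℚ n) (norm k) t x
    where
    ring : ∀ p q t x → p * (q * (t * x)) ≡ t * (p * (q * x))
    ring = solve-∀ ℚ-ring

  scaled-neg : ∀ n k x → scaled n k (- x) ≡ - scaled n k x
  scaled-neg n k x = ring (pw 2ℚ n) (norm k) x
    where
    ring : ∀ p q x → p * (q * (- x)) ≡ - (p * (q * x))
    ring = solve-∀ ℚ-ring

  scaled-Σ : ∀ n k m (f : Fin m → ℚ) → scaled n k (Σℚ m f) ≡ Σℚ m (λ i → scaled n k (f i))
  scaled-Σ n k m f = sym (trans (Σ-*ˡ (pw 2ℚ n) (λ i → norm k * f i)) (cong (pw 2ℚ n *_) (Σ-*ˡ (norm k) f)))

  scaled-Σᴸ : ∀ n k {A : Set} (xs : List A) (f : A → ℚ) → scaled n k (Σᴸ xs f) ≡ Σᴸ xs (λ x → scaled n k (f x))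
  scaled-Σᴸ n k xs f = sym (trans (Σᴸ-*ˡ (pw 2ℚ n) xs (λ x → norm k * f x)) (cong (pw 2ℚ n *_) (Σᴸ-*ˡ (norm k) xs f)))

  -- Induction on the total n rather than on the list: both recursions lead to lists of total one
  -- less, possibly with more parts. The degree grows only through the factor k² that comes with a
  -- part 1.
  poly-⟪⟫ : ∀ n rs → AllPos rs → sumℕ rs ≡ n → IsPoly (2 ℕ.* n) (λ k → scaled n k (⟪_⟫ k rs))
  poly-⟪⟫ zero [] _ _ = poly-cong (λ k → trans (ℚP.*-identityˡ _) (norm-E k)) (poly-const 1ℚ)
  poly-⟪⟫ zero (zero ∷ rs) (() ∷ _) _
  poly-⟪⟫ zero (suc s ∷ rs) _ ()
  poly-⟪⟫ (suc n) (suc zero ∷ rs) (_ ∷ ps) total =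
    poly-cong eq (poly-+ (subst (λ d → IsPoly d (λ k → (ι k * ι k) * scaled n k (⟪_⟫ k rs))) deg (poly-square (poly-⟪⟫ n rs ps (ℕP.suc-injective total))))
      (poly-neg (poly-mono (ℕP.*-monoʳ-≤ 2 (ℕP.n≤1+n n)) (poly-Σᴸ (All.map
        (λ { {q , ν} (pν , sν , _) → poly-* (ι q) (poly-⟪⟫ n ν pν (trans sν (ℕP.suc-injective total))) }) (bumps-All 0 ps))))))
    where
    deg : 2 ℕ.+ 2 ℕ.* n ≡ 2 ℕ.* suc n
    deg = sym (ℕP.*-suc 2 n)
    eq : ∀ k → scaled (suc n) k (⟪_⟫ k (1 ∷ rs)) ≡
         (ι k * ι k) * scaled n k (⟪_⟫ k rs) + - Σᴸ (bumps 0 rs) (λ p → ι (proj₁ p) * scaled n k (⟪_⟫ k (proj₂ p)))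
    eq k = begin
      scaled (suc n) k (⟪_⟫ k (1 ∷ rs))
        ≡⟨ scaled-suc n k (⟪_⟫ k (1 ∷ rs)) ⟩
      scaled n k (2ℚ * ⟪_⟫ k (1 ∷ rs))
        ≡⟨ cong (scaled n k) (recursion-one k rs) ⟩
      scaled n k ((ι k * ι k) * ⟪_⟫ k rs + - Cδ k 0 rs)
        ≡⟨ scaled-+ n k ((ι k * ι k) * ⟪_⟫ k rs) (- Cδ k 0 rs) ⟩
      scaled n k ((ι k * ι k) * ⟪_⟫ k rs) + scaled n k (- Cδ k 0 rs)
        ≡⟨ cong₂ _+_ (scaled-* n k (ι k * ι k) (⟪_⟫ k rs)) (scaled-neg n k (Cδ k 0 rs)) ⟩
      (ι k * ι k) * scaled n k (⟪_⟫ k rs) + - scaled n k (Cδ k 0 rs)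
        ≡⟨ cong (λ x → (ι k * ι k) * scaled n k (⟪_⟫ k rs) + - x) (trans (scaled-Σᴸ n k (bumps 0 rs) _)
             (Σᴸ-cong (bumps 0 rs) (λ p → scaled-* n k (ι (proj₁ p)) (⟪_⟫ k (proj₂ p))))) ⟩
      (ι k * ι k) * scaled n k (⟪_⟫ k rs) + - Σᴸ (bumps 0 rs) (λ p → ι (proj₁ p) * scaled n k (⟪_⟫ k (proj₂ p))) ∎
  poly-⟪⟫ (suc n) (suc (suc t) ∷ rs) (_ ∷ ps) total =
    poly-cong eq (poly-mono (ℕP.*-monoʳ-≤ 2 (ℕP.n≤1+n n)) (poly-neg (poly-+
      (poly-Σ t _ (λ a → poly-⟪⟫ n (suc (toℕ a) ∷ t ∸ toℕ a ∷ rs) (s≤s z≤n ∷ ℕP.m<n⇒0<n∸m (FP.toℕ<n a) ∷ ps) (total′ a)))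
      (poly-Σᴸ (All.map (λ { {q , ν} (pν , sν , _) → poly-* (ι q) (poly-⟪⟫ n ν pν (trans sν (ℕP.suc-injective total))) }) (bumps-All (suc t) ps))))))
    where
    total′ : ∀ (a : Fin t) → suc (toℕ a) ℕ.+ (t ∸ toℕ a ℕ.+ sumℕ rs) ≡ n
    total′ a = trans (cong suc (trans (sym (ℕP.+-assoc (toℕ a) (t ∸ toℕ a) (sumℕ rs)))
                              (cong (ℕ._+ sumℕ rs) (ℕP.m+[n∸m]≡n (ℕP.<⇒≤ (FP.toℕ<n a)))))) (ℕP.suc-injective total)
    m : ℕ → ℚ
    m k = Σℚ t (λ a → ⟪_⟫ k (suc (toℕ a) ∷ t ∸ toℕ a ∷ rs))
    eq : ∀ k → scaled (suc n) k (⟪_⟫ k (suc (suc t) ∷ rs)) ≡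
         - (Σℚ t (λ a → scaled n k (⟪_⟫ k (suc (toℕ a) ∷ t ∸ toℕ a ∷ rs))) +
            Σᴸ (bumps (suc t) rs) (λ p → ι (proj₁ p) * scaled n k (⟪_⟫ k (proj₂ p))))
    eq k = begin
      scaled (suc n) k (⟪_⟫ k (suc (suc t) ∷ rs))
        ≡⟨ scaled-suc n k (⟪_⟫ k (suc (suc t) ∷ rs)) ⟩
      scaled n k (2ℚ * ⟪_⟫ k (suc (suc t) ∷ rs))
        ≡⟨ cong (scaled n k) (recursion-suc k t rs) ⟩
      scaled n k (- (m k + Cδ k (suc t) rs))
        ≡⟨ scaled-neg n k (m k + Cδ k (suc t) rs) ⟩
      - scaled n k (m k + Cδ k (suc t) rs)
        ≡⟨ cong -_ (scaled-+ n k (m k) (Cδ k (suc t) rs)) ⟩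
      - (scaled n k (m k) + scaled n k (Cδ k (suc t) rs))
        ≡⟨ cong₂ (λ x y → - (x + y)) (scaled-Σ n k t _) (trans (scaled-Σᴸ n k (bumps (suc t) rs) _)
             (Σᴸ-cong (bumps (suc t) rs) (λ p → scaled-* n k (ι (proj₁ p)) (⟪_⟫ k (proj₂ p))))) ⟩
      - (Σℚ t (λ a → scaled n k (⟪_⟫ k (suc (toℕ a) ∷ t ∸ toℕ a ∷ rs))) +
         Σᴸ (bumps (suc t) rs) (λ p → ι (proj₁ p) * scaled n k (⟪_⟫ k (proj₂ p)))) ∎

  -- Augmented monomial symmetric functions

  isZero nonZero : ℕ → ℚ
  isZero zero    = 1ℚ
  isZero (suc _) = 0ℚ
  nonZero zero    = 0ℚ
  nonZero (suc _) = 1ℚ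

  Ext : ∀ {k} → (Idx k → ℚ) → Set
  Ext H = ∀ {c c′} → (∀ x → c x ≡ c′ x) → H c ≡ H c′

  -- An entry 0 marks a free position, which is why all parts have to be positive. A power sum adds
  -- x either at a free position or at an occupied one.
  fill raise : ∀ {k} → ℕ → (Idx k → ℚ) → Idx k → ℚ
  fill  {k} x H τ = Σℚ k (λ i → isZero (τ i) * H (τ [ i ]+ x))
  raise {k} x H τ = Σℚ k (λ i → nonZero (τ i) * H (τ [ i ]+ x))

  -- The sum of H (Σ_l α_l e_{p(l)}) over the injections p of the positions of α into Fin k.
  Inj : ∀ {k} → List ℕ → (Idx k → ℚ) → ℚ
  Inj []      H = H (λ _ → 0)
  Inj (x ∷ α) H = Inj α (fill x H)

  fill-ext : ∀ {k} x {H : Idx k → ℚ} → Ext H → Ext (fill x H)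
  fill-ext x h {c} {c′} eq = Σ-cong (λ i → cong₂ (λ a b → isZero a * b) (eq i) (h ([]+-cong {c = c} {c′} eq i x)))

  fill-+-raise : ∀ {k} x (H : Idx k → ℚ) τ → P x H τ ≡ fill x H τ + raise x H τ
  fill-+-raise x H τ = trans (Σ-cong (λ i → split (τ i) (H (τ [ i ]+ x))))
    (Σ-+ (λ i → isZero (τ i) * H (τ [ i ]+ x)) (λ i → nonZero (τ i) * H (τ [ i ]+ x)))
    where
    ring₁ : ∀ a → a ≡ 1ℚ * a + 0ℚ * a
    ring₁ = solve-∀ ℚ-ring
    ring₂ : ∀ a → a ≡ 0ℚ * a + 1ℚ * a
    ring₂ = solve-∀ ℚ-ring
    split : ∀ m a → a ≡ isZero m * a + nonZero m * a
    split zero    a = ring₁ a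
    split (suc m) a = ring₂ a

  -- After y has been placed, x is added either to that same entry, which amounts to placing y + x,
  -- or to an entry occupied before. In the latter case the two positions differ and the order can
  -- be exchanged.
  fill-raise : ∀ {k} y x {H : Idx k → ℚ} → 0 < y → Ext H → ∀ τ →
               fill y (raise x H) τ ≡ fill (y ℕ.+ x) H τ + raise x (fill y H) τ
  fill-raise {k} y x {H} 0<y ext τ = begin
    Σℚ k (λ i → isZero (τ i) * Σℚ k (λ j → nonZero ((τ [ i ]+ y) j) * H (τ [ i ]+ y [ j ]+ x)))
      ≡⟨ Σ-cong (λ i → trans (sym (Σ-*ˡ (isZero (τ i)) (λ j → nonZero ((τ [ i ]+ y) j) * H (τ [ i ]+ y [ j ]+ x))))
           (trans (Σ-cong (λ j → term i j (i FP.≟ j))) (Σ-+ (λ j → e i j * f i) (g i)))) ⟩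
    Σℚ k (λ i → Σℚ k (λ j → e i j * f i) + Σℚ k (g i))
      ≡⟨ Σ-+ (λ i → Σℚ k (λ j → e i j * f i)) (λ i → Σℚ k (g i)) ⟩
    Σℚ k (λ i → Σℚ k (λ j → e i j * f i)) + Σℚ k (λ i → Σℚ k (g i))
      ≡⟨ cong₂ _+_ (Σ-cong (λ i → Σ-e i (f i))) (trans (Σ-comm g) (Σ-cong (λ j → Σ-*ˡ (nonZero (τ j)) (λ i → isZero ((τ [ j ]+ x) i) * H (τ [ j ]+ x [ i ]+ y))))) ⟩
    fill (y ℕ.+ x) H τ + raise x (fill y H) τ ∎
    where
    f : Fin k → ℚ
    f i = isZero (τ i) * H (τ [ i ]+ (y ℕ.+ x))
    g : Fin k → Fin k → ℚ
    g i j = nonZero (τ j) * (isZero ((τ [ j ]+ x) i) * H (τ [ j ]+ x [ i ]+ y))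
    nonZero-+ : ∀ m {y} → 0 < y → nonZero (m ℕ.+ y) ≡ 1ℚ
    nonZero-+ zero    (s≤s _) = refl
    nonZero-+ (suc m) _       = refl
    exclusive : ∀ m → nonZero m * isZero (m ℕ.+ x) ≡ 0ℚ
    exclusive zero    = ℚP.*-zeroˡ (isZero x)
    exclusive (suc m) = refl
    ring₁ : ∀ z h w → z * (1ℚ * h) ≡ 1ℚ * (z * h) + 0ℚ * w
    ring₁ = solve-∀ ℚ-ring
    ring₂ : ∀ z n h w → z * (n * h) ≡ 0ℚ * w + n * (z * h)
    ring₂ = solve-∀ ℚ-ring
    term : ∀ i j → Dec (i ≡ j) → isZero (τ i) * (nonZero ((τ [ i ]+ y) j) * H (τ [ i ]+ y [ j ]+ x)) ≡ e i j * f i + g i j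
    term i j (yes refl) = begin
      isZero (τ i) * (nonZero ((τ [ i ]+ y) i) * H (τ [ i ]+ y [ i ]+ x))
        ≡⟨ cong₂ (λ a b → isZero (τ i) * (a * b)) (trans (cong nonZero ([]+-diag τ i y)) (nonZero-+ (τ i) 0<y)) (ext ([]+-+ τ i y x)) ⟩
      isZero (τ i) * (1ℚ * H (τ [ i ]+ (y ℕ.+ x)))
        ≡⟨ ring₁ (isZero (τ i)) (H (τ [ i ]+ (y ℕ.+ x))) (H (τ [ i ]+ x [ i ]+ y)) ⟩
      1ℚ * f i + 0ℚ * H (τ [ i ]+ x [ i ]+ y)
        ≡⟨ cong₂ (λ a b → a * f i + b * H (τ [ i ]+ x [ i ]+ y)) (e-diag i)
             (trans (cong (λ m → nonZero (τ i) * isZero m) ([]+-diag τ i x)) (exclusive (τ i))) ⟨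
      e i i * f i + (nonZero (τ i) * isZero ((τ [ i ]+ x) i)) * H (τ [ i ]+ x [ i ]+ y)
        ≡⟨ cong (e i i * f i +_) (ℚP.*-assoc (nonZero (τ i)) (isZero ((τ [ i ]+ x) i)) (H (τ [ i ]+ x [ i ]+ y))) ⟩
      e i i * f i + g i i ∎
    term i j (no i≢j) = begin
      isZero (τ i) * (nonZero ((τ [ i ]+ y) j) * H (τ [ i ]+ y [ j ]+ x))
        ≡⟨ cong₂ (λ a b → isZero (τ i) * (nonZero a * b)) ([]+-off τ i y j (i≢j ∘ sym)) (ext ([]+-comm τ i y j x)) ⟩
      isZero (τ i) * (nonZero (τ j) * H (τ [ j ]+ x [ i ]+ y))
        ≡⟨ ring₂ (isZero (τ i)) (nonZero (τ j)) (H (τ [ j ]+ x [ i ]+ y)) (f i) ⟩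
      0ℚ * f i + nonZero (τ j) * (isZero (τ i) * H (τ [ j ]+ x [ i ]+ y))
        ≡⟨ cong₂ (λ a b → a * f i + nonZero (τ j) * (isZero b * H (τ [ j ]+ x [ i ]+ y))) (e-off i j i≢j) ([]+-off τ j x i i≢j) ⟨
      e i j * f i + g i j ∎

  Inj-cong : ∀ {k} α {H H′ : Idx k → ℚ} → (∀ τ → H τ ≡ H′ τ) → Inj α H ≡ Inj α H′
  Inj-cong []      h = h (λ _ → 0)
  Inj-cong (x ∷ α) h = Inj-cong α (λ τ → Σ-cong (λ i → cong (isZero (τ i) *_) (h (τ [ i ]+ x))))

  Inj-+ : ∀ {k} α (H H′ : Idx k → ℚ) → Inj α (λ τ → H τ + H′ τ) ≡ Inj α H + Inj α H′
  Inj-+ []      H H′ = refl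
  Inj-+ (x ∷ α) H H′ = trans (Inj-cong α (λ τ → trans
      (Σ-cong (λ i → ℚP.*-distribˡ-+ (isZero (τ i)) (H (τ [ i ]+ x)) (H′ (τ [ i ]+ x))))
      (Σ-+ (λ i → isZero (τ i) * H (τ [ i ]+ x)) (λ i → isZero (τ i) * H′ (τ [ i ]+ x)))))
    (Inj-+ α (fill x H) (fill x H′))

  Inj-*ˡ : ∀ {k} α t (H : Idx k → ℚ) → Inj α (λ τ → t * H τ) ≡ t * Inj α H
  Inj-*ˡ []      t H = refl
  Inj-*ˡ (x ∷ α) t H = trans (Inj-cong α (λ τ → trans
      (Σ-cong (λ i → ring (isZero (τ i)) t (H (τ [ i ]+ x))))
      (Σ-*ˡ t (λ i → isZero (τ i) * H (τ [ i ]+ x)))))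
    (Inj-*ˡ α t (fill x H))
    where
    ring : ∀ a b c → a * (b * c) ≡ b * (a * c)
    ring = solve-∀ ℚ-ring

  Inj-neg : ∀ {k} α (H : Idx k → ℚ) → Inj α (λ τ → - H τ) ≡ - Inj α H
  Inj-neg α H = trans (Inj-cong α (λ τ → neg≡-1* (H τ))) (trans (Inj-*ˡ α (- 1ℚ) H) (sym (neg≡-1* (Inj α H))))

  Inj-Σᴸ : ∀ {k} α {A : Set} (xs : List A) (H : A → Idx k → ℚ) →
           Inj α (λ τ → Σᴸ xs (λ x → H x τ)) ≡ Σᴸ xs (λ x → Inj α (H x))
  Inj-Σᴸ α []       H = trans (Inj-*ˡ α 0ℚ (λ _ → 0ℚ)) (ℚP.*-zeroˡ (Inj α (λ _ → 0ℚ)))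
  Inj-Σᴸ α (x ∷ xs) H = trans (Inj-+ α (H x) (λ τ → Σᴸ xs (λ x → H x τ))) (cong (Inj α (H x) +_) (Inj-Σᴸ α xs H))

  Inj-raise : ∀ {k} x {α} {H : Idx k → ℚ} → AllPos α → Ext H →
              Inj α (raise x H) ≡ Σᴸ (bumps x α) (λ p → Inj (proj₂ p) H)
  Inj-raise {k} x {H = H} [] ext = Σ-zero (λ i → ℚP.*-zeroˡ (H ((λ _ → 0) [ i ]+ x)))
  Inj-raise x {y ∷ α} {H} (0<y ∷ ps) ext = begin
    Inj α (fill y (raise x H))
      ≡⟨ Inj-cong α (fill-raise y x 0<y ext) ⟩
    Inj α (λ τ → fill (y ℕ.+ x) H τ + raise x (fill y H) τ)
      ≡⟨ Inj-+ α (fill (y ℕ.+ x) H) (raise x (fill y H)) ⟩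
    Inj α (fill (y ℕ.+ x) H) + Inj α (raise x (fill y H))
      ≡⟨ cong (Inj α (fill (y ℕ.+ x) H) +_) (Inj-raise x ps (fill-ext y ext)) ⟩
    Inj α (fill (y ℕ.+ x) H) + Σᴸ (bumps x α) (λ p → Inj (proj₂ p) (fill y H))
      ≡⟨ cong (Inj α (fill (y ℕ.+ x) H) +_) (Σᴸ-map (λ p → proj₁ p , y ∷ proj₂ p) (bumps x α) (λ p → Inj (proj₂ p) H)) ⟨
    Σᴸ (bumps x (y ∷ α)) (λ p → Inj (proj₂ p) H) ∎

  -- The classical rule p_x m_α = m_(x,α) + Σ (x merged into one part of α) for augmented monomial
  -- symmetric functions, solved for m_(x,α). Its coefficients do not depend on k.
  Inj-∷ : ∀ {k} x {α} {H : Idx k → ℚ} → AllPos α → Ext H →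
          Inj (x ∷ α) H ≡ Inj α (P x H) + - Σᴸ (bumps x α) (λ p → Inj (proj₂ p) H)
  Inj-∷ x {α} {H} ps ext = begin
    Inj (x ∷ α) H
      ≡⟨ x≡[x+y]-y (Inj (x ∷ α) H) (Inj α (raise x H)) ⟩
    (Inj (x ∷ α) H + Inj α (raise x H)) + - Inj α (raise x H)
      ≡⟨ cong₂ (λ a b → a + - b)
           (trans (sym (Inj-+ α (fill x H) (raise x H))) (Inj-cong α (λ τ → sym (fill-+-raise x H τ))))
           (Inj-raise x ps ext) ⟩
    Inj α (P x H) + - Σᴸ (bumps x α) (λ p → Inj (proj₂ p) H) ∎

  -- Monomial symmetric functions on both sides, reduced to power sums

  δ+ : ∀ {k} → Idx k → Idx k
  δ+ a i = toℕ i ℕ.+ a i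

  module _ (k : ℕ) where
    open Euler k using (G; G-adm)

    -- Augmented monomials in the parts of `α` on the left and of `β` on the right; `rs` collects
    -- the power sums already split off, all of them acting on the left.
    Φ : List ℕ → List ℕ → List ℕ → ℚ
    Φ α β rs = Inj α (λ a → Inj β (λ b → G rs (δ+ a) (δ+ b)))

    -- A part of β is split off as a power sum on the right, and `transfer` moves it to the left at
    -- the cost of a sign. It can be used under the sums over injections because it holds at all
    -- exponents.
    Φ-∷ʳ : ∀ α x β rs → AllPos β →
           Φ α (suc x ∷ β) rs ≡ - (Φ α β (suc x ∷ rs) + Σᴸ (bumps (suc x) β) (λ p → Φ α (proj₂ p) rs))
    Φ-∷ʳ α x β rs ps = begin
      Inj α (λ a → Inj (suc x ∷ β) (H a))
        ≡⟨ Inj-cong α inner ⟩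
      Inj α (λ a → - (Inj β (λ b → G (suc x ∷ rs) (δ+ a) (δ+ b)) + Σᴸ (bumps (suc x) β) (λ p → Inj (proj₂ p) (H a))))
        ≡⟨ Inj-neg α _ ⟩
      - Inj α (λ a → Inj β (λ b → G (suc x ∷ rs) (δ+ a) (δ+ b)) + Σᴸ (bumps (suc x) β) (λ p → Inj (proj₂ p) (H a)))
        ≡⟨ cong -_ (Inj-+ α (λ a → Inj β (λ b → G (suc x ∷ rs) (δ+ a) (δ+ b))) (λ a → Σᴸ (bumps (suc x) β) (λ p → Inj (proj₂ p) (H a)))) ⟩
      - (Φ α β (suc x ∷ rs) + Inj α (λ a → Σᴸ (bumps (suc x) β) (λ p → Inj (proj₂ p) (H a))))
        ≡⟨ cong (λ y → - (Φ α β (suc x ∷ rs) + y)) (Inj-Σᴸ α (bumps (suc x) β) (λ p a → Inj (proj₂ p) (H a))) ⟩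
      - (Φ α β (suc x ∷ rs) + Σᴸ (bumps (suc x) β) (λ p → Φ α (proj₂ p) rs)) ∎
      where
      H : Idx k → Idx k → ℚ
      H a b = G rs (δ+ a) (δ+ b)
      P-H : ∀ a b → P (suc x) (H a) b ≡ - G (suc x ∷ rs) (δ+ a) (δ+ b)
      P-H a b = trans (Σ-cong (λ i → ext (antiʳ (G-adm rs) (δ+ a)) (λ y → sym (ℕP.+-assoc (toℕ y) (b y) (bump i (suc x) y)))))
                      (transfer (G-adm rs) x (δ+ a) (δ+ b))
      inner : ∀ a → Inj (suc x ∷ β) (H a) ≡
              - (Inj β (λ b → G (suc x ∷ rs) (δ+ a) (δ+ b)) + Σᴸ (bumps (suc x) β) (λ p → Inj (proj₂ p) (H a)))
      inner a = begin
        Inj (suc x ∷ β) (H a)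
          ≡⟨ Inj-∷ (suc x) {β} {H a} ps (λ h → ext (antiʳ (G-adm rs) (δ+ a)) (λ y → cong (toℕ y ℕ.+_) (h y))) ⟩
        Inj β (P (suc x) (H a)) + - Σᴸ (bumps (suc x) β) (λ p → Inj (proj₂ p) (H a))
          ≡⟨ cong (_+ - Σᴸ (bumps (suc x) β) (λ p → Inj (proj₂ p) (H a)))
               (trans (Inj-cong β (P-H a)) (Inj-neg β (λ b → G (suc x ∷ rs) (δ+ a) (δ+ b)))) ⟩
        - Inj β (λ b → G (suc x ∷ rs) (δ+ a) (δ+ b)) + - Σᴸ (bumps (suc x) β) (λ p → Inj (proj₂ p) (H a))
          ≡⟨ ℚP.neg-distrib-+ (Inj β (λ b → G (suc x ∷ rs) (δ+ a) (δ+ b))) (Σᴸ (bumps (suc x) β) (λ p → Inj (proj₂ p) (H a))) ⟨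
        - (Inj β (λ b → G (suc x ∷ rs) (δ+ a) (δ+ b)) + Σᴸ (bumps (suc x) β) (λ p → Inj (proj₂ p) (H a))) ∎

    Φ-∷ˡ : ∀ x α rs → AllPos α →
           Φ (x ∷ α) [] rs ≡ Φ α [] (x ∷ rs) + - Σᴸ (bumps x α) (λ p → Φ (proj₂ p) [] rs)
    Φ-∷ˡ x α rs ps = trans (Inj-∷ x {α} {H} ps (λ h → ext A (λ y → cong (toℕ y ℕ.+_) (h y))))
      (cong (_+ - Σᴸ (bumps x α) (λ p → Inj (proj₂ p) H)) (Inj-cong α (λ a → Σ-cong (λ i →
        ext A (λ y → sym (ℕP.+-assoc (toℕ y) (a y) (bump i x y)))))))
      where
      A : Anti (λ c → G rs c (δ+ (λ _ → 0)))
      A = antiˡ (G-adm rs) (δ+ (λ _ → 0))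
      H : Idx k → ℚ
      H a = G rs (δ+ a) (δ+ (λ _ → 0))

    Φ-[] : ∀ rs → Φ [] [] rs ≡ Euler.⟪_⟫ k rs
    Φ-[] rs = trans (ext (antiˡ (G-adm rs) (δ+ (λ _ → 0))) (λ y → ℕP.+-identityʳ (toℕ y)))
                    (ext (antiʳ (G-adm rs) toℕ) (λ y → ℕP.+-identityʳ (toℕ y)))

  a+[x+r]≡x+a+r : ∀ a x r → a ℕ.+ (x ℕ.+ r) ≡ x ℕ.+ a ℕ.+ r
  a+[x+r]≡x+a+r a x r = trans (sym (ℕP.+-assoc a x r)) (cong (ℕ._+ r) (ℕP.+-comm a x))

  -- The recursion is on the length l: splitting off a part and merging it into another both shorten
  -- α by one, and the total of α and rs together stays n.
  poly-Φˡ : ∀ n l α rs → length α ≡ l → AllPos α → AllPos rs → sumℕ α ℕ.+ sumℕ rs ≡ n →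
            IsPoly (2 ℕ.* n) (λ k → scaled n k (Φ k α [] rs))
  poly-Φˡ n l []      rs _  _        qs eq = poly-cong (λ k → cong (scaled n k) (Φ-[] k rs)) (poly-⟪⟫ n rs qs eq)
  poly-Φˡ n (suc l) (x ∷ α) rs ll (0<x ∷ ps) qs eq = poly-cong expand
    (poly-+ (poly-Φˡ n l α (x ∷ rs) (ℕP.suc-injective ll) ps (0<x ∷ qs) (trans (a+[x+r]≡x+a+r (sumℕ α) x (sumℕ rs)) eq))
            (poly-neg (poly-Σᴸ (All.map (λ { {_ , ν} (pν , sν , lν) → poly-Φˡ n l ν rs (trans lν (ℕP.suc-injective ll)) pν qs
              (trans (cong (ℕ._+ sumℕ rs) sν) eq) }) (bumps-All x ps)))))
    where
    expand : ∀ k → scaled n k (Φ k (x ∷ α) [] rs) ≡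
             scaled n k (Φ k α [] (x ∷ rs)) + - Σᴸ (bumps x α) (λ p → scaled n k (Φ k (proj₂ p) [] rs))
    expand k = begin
      scaled n k (Φ k (x ∷ α) [] rs)
        ≡⟨ cong (scaled n k) (Φ-∷ˡ k x α rs ps) ⟩
      scaled n k (Φ k α [] (x ∷ rs) + - Σᴸ (bumps x α) (λ p → Φ k (proj₂ p) [] rs))
        ≡⟨ scaled-+ n k _ _ ⟩
      scaled n k (Φ k α [] (x ∷ rs)) + scaled n k (- Σᴸ (bumps x α) (λ p → Φ k (proj₂ p) [] rs))
        ≡⟨ cong (scaled n k (Φ k α [] (x ∷ rs)) +_) (trans (scaled-neg n k _) (cong -_ (scaled-Σᴸ n k (bumps x α) _))) ⟩
      scaled n k (Φ k α [] (x ∷ rs)) + - Σᴸ (bumps x α) (λ p → scaled n k (Φ k (proj₂ p) [] rs)) ∎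

  poly-Φ : ∀ n l α β rs → length β ≡ l → AllPos α → AllPos β → AllPos rs → sumℕ α ℕ.+ (sumℕ β ℕ.+ sumℕ rs) ≡ n →
           IsPoly (2 ℕ.* n) (λ k → scaled n k (Φ k α β rs))
  poly-Φ n l α []      rs _  as _          qs eq = poly-Φˡ n (length α) α rs refl as qs eq
  poly-Φ n (suc l) α (suc x ∷ β) rs ll as (0<x ∷ ps) qs eq = poly-cong expand
    (poly-neg (poly-+ (poly-Φ n l α β (suc x ∷ rs) (ℕP.suc-injective ll) as ps (0<x ∷ qs)
                         (trans (cong (sumℕ α ℕ.+_) (a+[x+r]≡x+a+r (sumℕ β) (suc x) (sumℕ rs))) eq))
            (poly-Σᴸ (All.map (λ { {_ , ν} (pν , sν , lν) → poly-Φ n l α ν rs (trans lν (ℕP.suc-injective ll)) as pν qs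
              (trans (cong (λ s → sumℕ α ℕ.+ (s ℕ.+ sumℕ rs)) sν) eq) }) (bumps-All (suc x) ps)))))
    where
    expand : ∀ k → scaled n k (Φ k α (suc x ∷ β) rs) ≡
             - (scaled n k (Φ k α β (suc x ∷ rs)) + Σᴸ (bumps (suc x) β) (λ p → scaled n k (Φ k α (proj₂ p) rs)))
    expand k = begin
      scaled n k (Φ k α (suc x ∷ β) rs)
        ≡⟨ cong (scaled n k) (Φ-∷ʳ k α x β rs ps) ⟩
      scaled n k (- (Φ k α β (suc x ∷ rs) + Σᴸ (bumps (suc x) β) (λ p → Φ k α (proj₂ p) rs)))
        ≡⟨ scaled-neg n k _ ⟩
      - scaled n k (Φ k α β (suc x ∷ rs) + Σᴸ (bumps (suc x) β) (λ p → Φ k α (proj₂ p) rs))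
        ≡⟨ cong -_ (scaled-+ n k _ _) ⟩
      - (scaled n k (Φ k α β (suc x ∷ rs)) + scaled n k (Σᴸ (bumps (suc x) β) (λ p → Φ k α (proj₂ p) rs)))
        ≡⟨ cong (λ y → - (scaled n k (Φ k α β (suc x ∷ rs)) + y)) (scaled-Σᴸ n k (bumps (suc x) β) _) ⟩
      - (scaled n k (Φ k α β (suc x ∷ rs)) + Σᴸ (bumps (suc x) β) (λ p → scaled n k (Φ k α (proj₂ p) rs))) ∎

  -- Sums over rearrangements

  Σᴸ-↭ : ∀ {A : Set} {xs ys : List A} (f : A → ℚ) → xs ↭ ys → Σᴸ xs f ≡ Σᴸ ys f
  Σᴸ-↭ f ↭.refl          = refl
  Σᴸ-↭ f (↭.prep x p)    = cong (f x +_) (Σᴸ-↭ f p)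
  Σᴸ-↭ f (↭.swap x y p)  = trans (cong (λ s → f x + (f y + s)) (Σᴸ-↭ f p)) (ring (f x) (f y) _)
    where
    ring : ∀ a b c → a + (b + c) ≡ b + (a + c)
    ring = solve-∀ ℚ-ring
  Σᴸ-↭ f (↭.trans p q)   = trans (Σᴸ-↭ f p) (Σᴸ-↭ f q)

  Σᴸ-cong-∈ : ∀ {A : Set} (xs : List A) {f g : A → ℚ} → (∀ x → x ∈ xs → f x ≡ g x) → Σᴸ xs f ≡ Σᴸ xs g
  Σᴸ-cong-∈ []       h = refl
  Σᴸ-cong-∈ (x ∷ xs) h = cong₂ _+_ (h x (here refl)) (Σᴸ-cong-∈ xs (λ y y∈ → h y (there y∈)))

  Σᴸ-filter : ∀ {A : Set} {Q : A → Set} (Q? : Decidable Q) {w : A → ℚ} →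
              (∀ x → Q x → w x ≡ 1ℚ) → (∀ x → ¬ Q x → w x ≡ 0ℚ) →
              ∀ xs f → Σᴸ xs (λ x → w x * f x) ≡ Σᴸ (filter Q? xs) f
  Σᴸ-filter Q? {w} h₁ h₀ []       f = refl
  Σᴸ-filter Q? {w} h₁ h₀ (x ∷ xs) f with Q? x
  ... | yes q = cong₂ _+_ (trans (cong (_* f x) (h₁ x q)) (ℚP.*-identityˡ (f x))) (Σᴸ-filter Q? h₁ h₀ xs f)
  ... | no ¬q = trans (cong₂ _+_ (trans (cong (_* f x) (h₀ x ¬q)) (ℚP.*-zeroˡ (f x))) (Σᴸ-filter Q? h₁ h₀ xs f))
                      (ℚP.+-identityˡ _)

  unique-map : ∀ {A B : Set} {Q : A → Set} {f : A → B} → (∀ {x y} → Q x → Q y → f x ≡ f y → x ≡ y) →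
               ∀ {xs} → All Q xs → Unique xs → Unique (map f xs)
  unique-map inj []       []       = []
  unique-map inj (q ∷ qs) (u ∷ us) =
    AllP.map⁺ (All.map (λ { (q′ , x≢) indicator → x≢ (inj q q′ indicator) }) (All.zip (qs , u))) ∷ unique-map inj qs us

  insertAll-sound : ∀ x τ {σ} → σ ∈ insertAll x τ → σ ↭ x ∷ τ
  insertAll-sound x []       (here refl) = ↭-refl
  insertAll-sound x (y ∷ τ)  (here refl) = ↭-refl
  insertAll-sound x (y ∷ τ)  (there σ∈) with σ′ , σ′∈ , refl ← ∈P.∈-map⁻ (y ∷_) σ∈ =
    ↭-trans (↭-prep y (insertAll-sound x τ σ′∈)) (↭-swap y x ↭-refl)

  insertAll-complete : ∀ x ys zs → ys ++ x ∷ zs ∈ insertAll x (ys ++ zs)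
  insertAll-complete x []       []       = here refl
  insertAll-complete x []       (mult! ∷ zs) = here refl
  insertAll-complete x (y ∷ ys) zs       = there (∈P.∈-map⁺ (y ∷_) (insertAll-complete x ys zs))

  perms-sound : ∀ xs {σ} → σ ∈ perms xs → σ ↭ xs
  perms-sound []       (here refl) = ↭-refl
  perms-sound (x ∷ xs) σ∈ with τ , τ∈ , σ∈′ ← find (∈P.∈-concatMap⁻ (insertAll x) σ∈) =
    ↭-trans (insertAll-sound x τ σ∈′) (↭-prep x (perms-sound xs τ∈))

  perms-complete : ∀ xs {σ} → σ ↭ xs → σ ∈ perms xs
  perms-complete []       p = here (↭P.↭-empty-inv p)
  perms-complete (x ∷ xs) p with ys , zs , refl ← ∈P.∈-∃++ (↭P.∈-resp-↭ (↭-sym p) (here refl)) =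
    ∈P.∈-concatMap⁺ (insertAll x) (lose (perms-complete xs (↭P.drop-mid ys [] p)) (insertAll-complete x ys zs))

  rearrangements-sound : ∀ xs {σ} → σ ∈ rearrangements xs → σ ↭ xs
  rearrangements-sound xs σ∈ = perms-sound xs (∈P.∈-deduplicate⁻ (ListP.≡-dec ℕ._≟_) (perms xs) σ∈)

  rearrangements-complete : ∀ xs {σ} → σ ↭ xs → σ ∈ rearrangements xs
  rearrangements-complete xs p = ∈P.∈-deduplicate⁺ (ListP.≡-dec ℕ._≟_) (perms-complete xs p)

  rearrangements-unique : ∀ xs → Unique (rearrangements xs)
  rearrangements-unique xs = DecUnique.deduplicate-! (ListP.≡-dec ℕ._≟_) (perms xs)

  setAt : ℕ → ℕ → List ℕ → List ℕ
  setAt i       x []       = []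
  setAt zero    x (y ∷ ys) = x ∷ ys
  setAt (suc i) x (y ∷ ys) = y ∷ setAt i x ys

  removeAt : ℕ → List ℕ → List ℕ
  removeAt i       []       = []
  removeAt zero    (y ∷ ys) = ys
  removeAt (suc i) (y ∷ ys) = y ∷ removeAt i ys

  setAt-↭ : ∀ i x σ → i < length σ → setAt i x σ ↭ x ∷ removeAt i σ
  setAt-↭ zero    x (y ∷ σ) _         = ↭-refl
  setAt-↭ (suc i) x (y ∷ σ) (s≤s i<l) = ↭-trans (↭-prep y (setAt-↭ i x σ i<l)) (↭-swap y x ↭-refl)

  setAt-at : ∀ i σ → setAt i (at σ i) σ ≡ σ
  setAt-at i       []      = refl
  setAt-at zero    (y ∷ σ) = refl
  setAt-at (suc i) (y ∷ σ) = cong (y ∷_) (setAt-at i σ)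

  setAt-setAt : ∀ i x y σ → setAt i y (setAt i x σ) ≡ setAt i y σ
  setAt-setAt i       x y []      = refl
  setAt-setAt zero    x y (mult! ∷ σ) = refl
  setAt-setAt (suc i) x y (mult! ∷ σ) = cong (mult! ∷_) (setAt-setAt i x y σ)

  at-setAt : ∀ i x σ → i < length σ → at (setAt i x σ) i ≡ x
  at-setAt zero    x (y ∷ σ) _         = refl
  at-setAt (suc i) x (y ∷ σ) (s≤s i<l) = at-setAt i x σ i<l

  idx : ∀ {k} → List ℕ → Idx k
  idx σ i = at σ (toℕ i)

  idx-setAt : ∀ {k} (i : Fin k) x σ → toℕ i < length σ → at σ (toℕ i) ≡ 0 →
              ∀ j → idx (setAt (toℕ i) x σ) j ≡ (idx σ [ i ]+ x) j
  idx-setAt zero    x (y ∷ σ) _         refl zero    = refl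
  idx-setAt zero    x (y ∷ σ) _         _    (suc j) = sym (ℕP.+-identityʳ _)
  idx-setAt (suc i) x (y ∷ σ) _         _    zero    = sym (ℕP.+-identityʳ y)
  idx-setAt (suc i) x (y ∷ σ) (s≤s i<l) h    (suc j) = idx-setAt i x σ i<l h j

  replace-↭ : ∀ {i a b σ ρ} → i < length σ → at σ i ≡ a → σ ↭ a ∷ ρ → setAt i b σ ↭ b ∷ ρ
  replace-↭ {i} {a} {b} {σ} i<l h p = ↭-trans (setAt-↭ i b σ i<l) (↭-prep b (↭P.drop-∷
    (↭-trans (↭-sym (setAt-↭ i a σ i<l)) (↭-trans (↭-reflexive (trans (cong (λ x → setAt i x σ) (sym h)) (setAt-at i σ))) p))))

  pad-suc : ∀ k α → length α < k → pad k α ↭ 0 ∷ (α ++ replicate (k ∸ suc (length α)) 0)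
  pad-suc k α l<k = ↭-trans (↭-reflexive (cong (λ m → α ++ replicate m 0) (ℕP.+-∸-assoc 1 l<k)))
                            (↭P.shift 0 α (replicate (k ∸ suc (length α)) 0))

  length-pad : ∀ k α → length α ≤ k → length (pad k α) ≡ k
  length-pad k α l≤k = trans (ListP.length-++ α) (trans (cong (length α ℕ.+_) (ListP.length-replicate (k ∸ length α))) (ℕP.m+[n∸m]≡n l≤k))

  length-rearrangement : ∀ {k α} σ → length α ≤ k → σ ∈ rearrangements (pad k α) → length σ ≡ k
  length-rearrangement {k} {α} σ l≤k σ∈ = trans (↭P.↭-length (rearrangements-sound (pad k α) σ∈)) (length-pad k α l≤k)

  indicator : ℕ → ℕ → ℕ
  indicator x y with x ℕ.≟ y
  ... | yes _ = 1
  ... | no _  = 0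

  indicator-yes : ∀ {x y} → x ≡ y → indicator x y ≡ 1
  indicator-yes {x} {y} h with x ℕ.≟ y
  ... | yes _ = refl
  ... | no ¬h = contradiction h ¬h

  indicator-no : ∀ {x y} → x ≢ y → indicator x y ≡ 0
  indicator-no {x} {y} ¬h with x ℕ.≟ y
  ... | yes h = contradiction h ¬h
  ... | no _  = refl

  mult : ℕ → List ℕ → ℕ
  mult x []       = 0
  mult x (y ∷ ys) = indicator y x ℕ.+ mult x ys

  mult-↭ : ∀ x {xs ys} → xs ↭ ys → mult x xs ≡ mult x ys
  mult-↭ x ↭.refl         = refl
  mult-↭ x (↭.prep y p)   = cong (indicator y x ℕ.+_) (mult-↭ x p)
  mult-↭ x {_} {_ ∷ _ ∷ ys} (↭.swap y mult! p) = trans (cong (λ m → indicator y x ℕ.+ (indicator mult! x ℕ.+ m)) (mult-↭ x p))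
    (trans (sym (ℕP.+-assoc (indicator y x) (indicator mult! x) (mult x ys))) (trans (cong (ℕ._+ mult x ys) (ℕP.+-comm (indicator y x) (indicator mult! x)))
      (ℕP.+-assoc (indicator mult! x) (indicator y x) (mult x ys))))
  mult-↭ x (↭.trans p q)  = trans (mult-↭ x p) (mult-↭ x q)

  mult-++-zeros : ∀ x α m → 0 < x → mult x (α ++ replicate m 0) ≡ mult x α
  mult-++-zeros x []      zero    0<x = refl
  mult-++-zeros x []      (suc m) 0<x = cong₂ ℕ._+_ (indicator-no (ℕP.<⇒≢ 0<x)) (mult-++-zeros x [] m 0<x)
  mult-++-zeros x (y ∷ α) m       0<x = cong (indicator y x ℕ.+_) (mult-++-zeros x α m 0<x)

  Σ-indicator : ∀ {k} x σ → length σ ≡ k → Σℚ k (λ i → ι (indicator (at σ (toℕ i)) x)) ≡ ι (mult x σ)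
  Σ-indicator x []      refl = refl
  Σ-indicator x (y ∷ σ) refl = trans (cong (ι (indicator y x) +_) (Σ-indicator x σ refl)) (sym (ι-+ (indicator y x) (mult x σ)))

  Σ-rearr : ∀ {k} → List ℕ → (Idx k → ℚ) → ℚ
  Σ-rearr {k} α H = Σᴸ (rearrangements (pad k α)) (λ σ → H (idx σ))

  -- Setting entry i to x identifies the rearrangements σ of α with σ_i = 0 with the
  -- rearrangements σ of x ∷ α with σ_i = x.
  slot : ∀ {k} x α (i : Fin k) {H : Idx k → ℚ} → Ext H → length α < k →
         Σᴸ (rearrangements (pad k α)) (λ σ → isZero (at σ (toℕ i)) * H (idx σ [ i ]+ x)) ≡
         Σᴸ (rearrangements (pad k (x ∷ α))) (λ σ → ι (indicator (at σ (toℕ i)) x) * H (idx σ))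
  slot {k} x α i {H} ext l<k = begin
    Σᴸ R (λ σ → isZero (at σ (toℕ i)) * H (idx σ [ i ]+ x))
      ≡⟨ Σᴸ-filter zero? (λ σ h → cong isZero h) (λ σ ¬h → non-zero (at σ (toℕ i)) ¬h) R (λ σ → H (idx σ [ i ]+ x)) ⟩
    Σᴸ (filter zero? R) (λ σ → H (idx σ [ i ]+ x))
      ≡⟨ Σᴸ-cong-∈ (filter zero? R) (λ σ σ∈ → let σ∈R , h = ∈P.∈-filter⁻ zero? σ∈ in
           ext (λ j → sym (idx-setAt i x σ (i<len σ σ∈R) h j))) ⟩
    Σᴸ (filter zero? R) (λ σ → H (idx (setAt (toℕ i) x σ)))
      ≡⟨ Σᴸ-map (setAt (toℕ i) x) (filter zero? R) (λ σ → H (idx σ)) ⟨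
    Σᴸ (map (setAt (toℕ i) x) (filter zero? R)) (λ σ → H (idx σ))
      -- Two lists without repetitions and with the same members are permutations of each other, so
      -- neither order of enumeration matters.
      ≡⟨ Σᴸ-↭ (λ σ → H (idx σ)) (∼bag⇒↭ (unique∧set⇒bag unique₁ unique₂ (mk⇔ to from))) ⟩
    Σᴸ (filter x? R′) (λ σ → H (idx σ))
      ≡⟨ Σᴸ-filter x? (λ σ h → cong ι (indicator-yes h)) (λ σ ¬h → cong ι (indicator-no ¬h)) R′ (λ σ → H (idx σ)) ⟨
    Σᴸ R′ (λ σ → ι (indicator (at σ (toℕ i)) x) * H (idx σ)) ∎
    where
    R  = rearrangements (pad k α)
    R′ = rearrangements (pad k (x ∷ α))
    ρ  = α ++ replicate (k ∸ suc (length α)) 0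
    zero? : Decidable (λ σ → at σ (toℕ i) ≡ 0)
    zero? σ = at σ (toℕ i) ℕ.≟ 0
    x? : Decidable (λ σ → at σ (toℕ i) ≡ x)
    x? σ = at σ (toℕ i) ℕ.≟ x
    non-zero : ∀ m → m ≢ 0 → isZero m ≡ 0ℚ
    non-zero zero    h = contradiction refl h
    non-zero (suc m) h = refl
    i<len : ∀ σ → σ ∈ R → toℕ i < length σ
    i<len σ σ∈ = subst (toℕ i ℕ.<_) (sym (length-rearrangement {k} {α} σ (ℕP.<⇒≤ l<k) σ∈)) (FP.toℕ<n i)
    i<len′ : ∀ σ → σ ∈ R′ → toℕ i < length σ
    i<len′ σ σ∈ = subst (toℕ i ℕ.<_) (sym (length-rearrangement {k} {x ∷ α} σ l<k σ∈)) (FP.toℕ<n i)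
    undo : ∀ {a} b σ → at σ (toℕ i) ≡ a → setAt (toℕ i) a (setAt (toℕ i) b σ) ≡ σ
    undo b σ refl = trans (setAt-setAt (toℕ i) b (at σ (toℕ i)) σ) (setAt-at (toℕ i) σ)
    unique₁ : Unique (map (setAt (toℕ i) x) (filter zero? R))
    unique₁ = unique-map (λ {σ} {τ} h h′ e → trans (sym (undo x σ h)) (trans (cong (setAt (toℕ i) 0) e) (undo x τ h′)))
      (AllP.all-filter zero? R) (UniqueP.filter⁺ zero? (rearrangements-unique (pad k α)))
    unique₂ : Unique (filter x? R′)
    unique₂ = UniqueP.filter⁺ x? (rearrangements-unique (pad k (x ∷ α)))
    to : ∀ {τ} → τ ∈ map (setAt (toℕ i) x) (filter zero? R) → τ ∈ filter x? R′
    to τ∈ with σ , σ∈ , refl ← ∈P.∈-map⁻ (setAt (toℕ i) x) τ∈ with σ∈R , h ← ∈P.∈-filter⁻ zero? σ∈ =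
      ∈P.∈-filter⁺ x? (rearrangements-complete (pad k (x ∷ α))
          (replace-↭ (i<len σ σ∈R) h (↭-trans (rearrangements-sound (pad k α) σ∈R) (pad-suc k α l<k))))
        (at-setAt (toℕ i) x σ (i<len σ σ∈R))
    from : ∀ {τ} → τ ∈ filter x? R′ → τ ∈ map (setAt (toℕ i) x) (filter zero? R)
    from {τ} τ∈ with τ∈R′ , h ← ∈P.∈-filter⁻ x? τ∈ =
      subst (_∈ map (setAt (toℕ i) x) (filter zero? R)) (undo 0 τ h) (∈P.∈-map⁺ (setAt (toℕ i) x)
        (∈P.∈-filter⁺ zero? (rearrangements-complete (pad k α)
            (↭-trans (replace-↭ (i<len′ τ τ∈R′) h (rearrangements-sound (pad k (x ∷ α)) τ∈R′)) (↭-sym (pad-suc k α l<k))))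
          (at-setAt (toℕ i) 0 τ (i<len′ τ τ∈R′))))

  -- Summing `slot` over all positions counts a rearrangement of x ∷ α once for every entry equal to
  -- x. As x is positive, the padding does not contribute to that number.
  Σ-rearr-fill : ∀ {k} x α {H : Idx k → ℚ} → 0 < x → Ext H → length α < k →
           Σ-rearr α (fill x H) ≡ ι (mult x (x ∷ α)) * Σ-rearr (x ∷ α) H
  Σ-rearr-fill {k} x α {H} 0<x ext l<k = begin
    Σᴸ R (λ σ → Σℚ k (λ i → isZero (at σ (toℕ i)) * H (idx σ [ i ]+ x)))
      ≡⟨ Σ-Σᴸ R (λ i σ → isZero (at σ (toℕ i)) * H (idx σ [ i ]+ x)) ⟨
    Σℚ k (λ i → Σᴸ R (λ σ → isZero (at σ (toℕ i)) * H (idx σ [ i ]+ x)))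
      ≡⟨ Σ-cong {k} (λ i → slot x α i ext l<k) ⟩
    Σℚ k (λ i → Σᴸ R′ (λ σ → ι (indicator (at σ (toℕ i)) x) * H (idx σ)))
      ≡⟨ Σ-Σᴸ {n = k} R′ (λ i σ → ι (indicator (at σ (toℕ i)) x) * H (idx σ)) ⟩
    Σᴸ R′ (λ σ → Σℚ k (λ i → ι (indicator (at σ (toℕ i)) x) * H (idx σ)))
      ≡⟨ Σᴸ-cong-∈ R′ (λ σ σ∈ → trans (Σ-*ʳ (H (idx σ)) (λ (i : Fin k) → ι (indicator (at σ (toℕ i)) x)))
           (cong (_* H (idx σ)) (trans (Σ-indicator {k} x σ (length-rearrangement {k} {x ∷ α} σ l<k σ∈))
             (cong ι (trans (mult-↭ x (rearrangements-sound (pad k (x ∷ α)) σ∈))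
               (mult-++-zeros x (x ∷ α) (k ∸ length (x ∷ α)) 0<x)))))) ⟩
    Σᴸ R′ (λ σ → ι (mult x (x ∷ α)) * H (idx σ))
      ≡⟨ Σᴸ-*ˡ (ι (mult x (x ∷ α))) R′ (λ σ → H (idx σ)) ⟩
    ι (mult x (x ∷ α)) * Σ-rearr (x ∷ α) H ∎
    where
    R  = rearrangements (pad k α)
    R′ = rearrangements (pad k (x ∷ α))

  Σ-rearr-[] : ∀ {k} {H : Idx k → ℚ} → Ext H → Σ-rearr [] H ≡ H (λ _ → 0)
  Σ-rearr-[] {k} {H} ext = begin
    Σᴸ (rearrangements zeros) (λ σ → H (idx σ))
      ≡⟨ Σᴸ-↭ (λ σ → H (idx σ)) (∼bag⇒↭ (unique∧set⇒bag (rearrangements-unique zeros) ([] ∷ []) (mk⇔ to from))) ⟩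
    H (idx zeros) + 0ℚ
      ≡⟨ trans (ℚP.+-identityʳ (H (idx zeros))) (ext (λ i → at-zeros k (toℕ i))) ⟩
    H (λ _ → 0) ∎
    where
    zeros = replicate k 0
    at-zeros : ∀ k i → at (replicate k 0) i ≡ 0
    at-zeros zero    i       = refl
    at-zeros (suc k) zero    = refl
    at-zeros (suc k) (suc i) = at-zeros k i
    all-zeros : ∀ k σ → All (_≡ 0) σ → length σ ≡ k → σ ≡ replicate k 0
    all-zeros zero    []      _           _ = refl
    all-zeros (suc k) (x ∷ σ) (refl ∷ zs) h = cong (0 ∷_) (all-zeros k σ zs (ℕP.suc-injective h))
    to : ∀ {σ} → σ ∈ rearrangements zeros → σ ∈ zeros ∷ []
    to {σ} σ∈ = here (all-zeros k σ (↭P.All-resp-↭ (↭-sym p) (AllP.replicate⁺ k refl)) (trans (↭P.↭-length p) (ListP.length-replicate k)))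
      where p = rearrangements-sound zeros σ∈
    from : ∀ {σ} → σ ∈ zeros ∷ [] → σ ∈ rearrangements zeros
    from (here refl) = rearrangements-complete zeros ↭-refl

  -- The product of the factorials of the multiplicities: the occurrences of a value, counted from
  -- the end of the list, contribute the factors 1, 2, 3, ... in turn.
  mult! : List ℕ → ℕ
  mult! []      = 1
  mult! (x ∷ α) = mult! α ℕ.* mult x (x ∷ α)

  mult!≢0 : ∀ α → ℕ.NonZero (mult! α)
  mult!≢0 []      = _
  mult!≢0 (x ∷ α) = ℕP.m*n≢0 (mult! α) (mult x (x ∷ α)) {{mult!≢0 α}} {{subst (λ m → ℕ.NonZero (m ℕ.+ mult x α)) (sym (indicator-yes {x} {x} refl)) _}}

  -- Injections that differ by permuting equal parts give the same tuple, so each rearrangement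
  -- arises from `mult! α` of them. The bound on the length ensures a free position for every part.
  Inj≡Σ-rearr : ∀ {k} α {H : Idx k → ℚ} → AllPos α → Ext H → length α ≤ k → Inj α H ≡ ι (mult! α) * Σ-rearr α H
  Inj≡Σ-rearr []      {H} _          ext _   = sym (trans (ℚP.*-identityˡ (Σ-rearr [] H)) (Σ-rearr-[] ext))
  Inj≡Σ-rearr (x ∷ α) {H} (0<x ∷ ps) ext l<k = begin
    Inj α (fill x H)                             ≡⟨ Inj≡Σ-rearr α ps (fill-ext x ext) (ℕP.<⇒≤ l<k) ⟩
    ι (mult! α) * Σ-rearr α (fill x H)                     ≡⟨ cong (ι (mult! α) *_) (Σ-rearr-fill x α 0<x ext l<k) ⟩
    ι (mult! α) * (ι (mult x (x ∷ α)) * Σ-rearr (x ∷ α) H) ≡⟨ ℚP.*-assoc (ι (mult! α)) (ι (mult x (x ∷ α))) (Σ-rearr (x ∷ α) H) ⟨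
    ι (mult! α) * ι (mult x (x ∷ α)) * Σ-rearr (x ∷ α) H   ≡⟨ cong (_* Σ-rearr (x ∷ α) H) (ι-* (mult! α) (mult x (x ∷ α))) ⟨
    ι (mult! (x ∷ α)) * Σ-rearr (x ∷ α) H                  ∎

  -- The matrix M as rows of coefficients of x ^ c exp (± x)

  -- x ^ c exp (x) has the coefficient 1 / (m - c)! at x ^ m. For m < c it is 0, in agreement with
  -- the convention at the poles of Γ.
  recipΓ-⊖ : ∀ c m → recipΓ (suc m ℤ.⊖ c) ≡ coef 1ℚ c m
  recipΓ-⊖ zero    m       = sym (trans (cong (_* recip! m) (pw-1 m)) (ℚP.*-identityˡ (recip! m)))
    where
    pw-1 : ∀ m → pw 1ℚ m ≡ 1ℚ
    pw-1 zero    = refl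
    pw-1 (suc m) = trans (ℚP.*-identityˡ (pw 1ℚ m)) (pw-1 m)
  recipΓ-⊖ (suc c) zero    = trans (cong recipΓ (ℤP.[1+m]⊖[1+n]≡m⊖n 0 c)) (nonpositive c)
    where
    nonpositive : ∀ c → recipΓ (0 ℤ.⊖ c) ≡ 0ℚ
    nonpositive zero    = refl
    nonpositive (suc c) = refl
  recipΓ-⊖ (suc c) (suc m) = trans (cong recipΓ (ℤP.[1+m]⊖[1+n]≡m⊖n (suc m) c)) (recipΓ-⊖ c m)

  -- Substituting -x for x in x ^ c exp (x) gives (-1) ^ c x ^ c exp (-x).
  coef-sgn : ∀ c m → coef (- 1ℚ) c m ≡ sgn m * sgn c * coef 1ℚ c m
  coef-sgn zero    m       = begin
    pw (- 1ℚ) m * recip! m                   ≡⟨ cong (_* recip! m) (pw-sgn m) ⟩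
    sgn m * pw 1ℚ m * recip! m               ≡⟨ ring (sgn m) (pw 1ℚ m) (recip! m) ⟩
    sgn m * 1ℚ * (pw 1ℚ m * recip! m)        ∎
    where
    ring : ∀ a b c → a * b * c ≡ a * 1ℚ * (b * c)
    ring = solve-∀ ℚ-ring
    ring′ : ∀ a b → (- 1ℚ) * (a * b) ≡ (- a) * (1ℚ * b)
    ring′ = solve-∀ ℚ-ring
    pw-sgn : ∀ m → pw (- 1ℚ) m ≡ sgn m * pw 1ℚ m
    pw-sgn zero    = refl
    pw-sgn (suc m) = trans (cong ((- 1ℚ) *_) (pw-sgn m)) (ring′ (sgn m) (pw 1ℚ m))
  coef-sgn (suc c) zero    = sym (ℚP.*-zeroʳ (1ℚ * sgn (suc c)))
  coef-sgn (suc c) (suc m) = trans (coef-sgn c m) (cong (_* coef 1ℚ c m) (ring (sgn m) (sgn c)))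
    where
    ring : ∀ a b → a * b ≡ (- a) * (- b)
    ring = solve-∀ ℚ-ring

  entry : ∀ k (i : Fin k) (j : Fin (k ℕ.+ k)) a →
          recipΓ (pos (2 ℕ.* k) ℤ.- pos (toℕ i) ℤ.- pos (toℕ j) ℤ.- pos a) ≡ coefRow 1ℚ (toℕ i ℕ.+ a) j
  entry k i j a = trans (cong recipΓ index) (recipΓ-⊖ (toℕ i ℕ.+ a) m)
    where
    m = k ℕ.+ k ∸ suc (toℕ j)
    2k≡ : 2 ℕ.* k ≡ suc m ℕ.+ toℕ j
    2k≡ = trans (cong (k ℕ.+_) (ℕP.+-identityʳ k)) (trans (sym (ℕP.m∸n+n≡m (FP.toℕ<n j))) (ℕP.+-suc m (toℕ j)))
    regroup : ∀ x i j a → (x ℤ.+ j) ℤ.- i ℤ.- j ℤ.- a ≡ x ℤ.- (i ℤ.+ a)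
    regroup = ℤ-Solver.solve-∀
    index : pos (2 ℕ.* k) ℤ.- pos (toℕ i) ℤ.- pos (toℕ j) ℤ.- pos a ≡ suc m ℤ.⊖ (toℕ i ℕ.+ a)
    index = trans (cong (λ x → pos x ℤ.- pos (toℕ i) ℤ.- pos (toℕ j) ℤ.- pos a) 2k≡)
      (trans (regroup (pos (suc m)) (pos (toℕ i)) (pos (toℕ j)) (pos a)) (ℤP.m-n≡m⊖n (suc m) (toℕ i ℕ.+ a)))

  -- The exponent m = 2k - 1 - j has the parity of j + 1, so the sign in M is that of x ^ (i + b)
  -- exp (-x) up to (-1) ^ b. These leftover signs multiply to the sign in front of the determinant
  -- in `Mtilde` and cancel it.
  signed-entry : ∀ k (i : Fin k) (j : Fin (k ℕ.+ k)) b →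
    sgn (toℕ i ℕ.+ toℕ j ℕ.+ 1) * recipΓ (pos (2 ℕ.* k) ℤ.- pos (toℕ i) ℤ.- pos (toℕ j) ℤ.- pos b) ≡
    sgn b * coefRow (- 1ℚ) (toℕ i ℕ.+ b) j
  signed-entry k i j b = begin
    sgn (toℕ i ℕ.+ toℕ j ℕ.+ 1) * recipΓ (pos (2 ℕ.* k) ℤ.- pos (toℕ i) ℤ.- pos (toℕ j) ℤ.- pos b)
      ≡⟨ cong₂ _*_ (trans (sgn-+ (toℕ i ℕ.+ toℕ j) 1) (cong (_* - 1ℚ) (sgn-+ (toℕ i) (toℕ j)))) (entry k i j b) ⟩
    sgn (toℕ i) * sgn (toℕ j) * - 1ℚ * x
      ≡⟨ ring₁ (sgn (toℕ i)) (sgn (toℕ j)) x ⟩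
    1ℚ * (sgn (toℕ i) * (- sgn (toℕ j)) * x)
      ≡⟨ cong₂ (λ p q → p * (sgn (toℕ i) * q * x)) (sgn-square b) sgn-m ⟨
    (sgn b * sgn b) * (sgn (toℕ i) * sgn m * x)
      ≡⟨ ring₂ (sgn b) (sgn (toℕ i)) (sgn m) x ⟩
    sgn b * (sgn m * (sgn (toℕ i) * sgn b) * x)
      ≡⟨ cong (λ p → sgn b * (sgn m * p * x)) (sgn-+ (toℕ i) b) ⟨
    sgn b * (sgn m * sgn (toℕ i ℕ.+ b) * x)
      ≡⟨ cong (sgn b *_) (coef-sgn (toℕ i ℕ.+ b) m) ⟨
    sgn b * coefRow (- 1ℚ) (toℕ i ℕ.+ b) j ∎
    where
    m = k ℕ.+ k ∸ suc (toℕ j)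
    x = coefRow 1ℚ (toℕ i ℕ.+ b) j
    ring₁ : ∀ i j x → i * j * (- 1ℚ) * x ≡ 1ℚ * (i * (- j) * x)
    ring₁ = solve-∀ ℚ-ring
    ring₂ : ∀ b i m x → (b * b) * (i * m * x) ≡ b * (m * (i * b) * x)
    ring₂ = solve-∀ ℚ-ring
    sgn-m : sgn m ≡ - sgn (toℕ j)
    sgn-m = begin
      sgn m                                            ≡⟨ ℚP.*-identityˡ (sgn m) ⟨
      1ℚ * sgn m                                       ≡⟨ cong (_* sgn m) (sgn-square (toℕ j)) ⟨
      sgn (toℕ j) * sgn (toℕ j) * sgn m                ≡⟨ ring₄ (sgn (toℕ j)) (sgn m) ⟩
      - (sgn (toℕ j) * (- sgn (toℕ j) * sgn m))        ≡⟨ cong (λ s → - (sgn (toℕ j) * s)) (sgn-+ (suc (toℕ j)) m) ⟨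
      - (sgn (toℕ j) * sgn (suc (toℕ j) ℕ.+ m))        ≡⟨ cong (λ n → - (sgn (toℕ j) * sgn n)) (ℕP.m+[n∸m]≡n (FP.toℕ<n j)) ⟩
      - (sgn (toℕ j) * sgn (k ℕ.+ k))                  ≡⟨ cong (λ s → - (sgn (toℕ j) * s)) (trans (sgn-+ k k) (sgn-square k)) ⟩
      - (sgn (toℕ j) * 1ℚ)                             ≡⟨ cong -_ (ℚP.*-identityʳ (sgn (toℕ j))) ⟩
      - sgn (toℕ j)                                    ∎
      where
      ring₄ : ∀ j m → j * j * m ≡ - (j * (- j * m))
      ring₄ = solve-∀ ℚ-ring

  Π-sgn : ∀ {k} τ → length τ ≡ k → Π {k} (λ i → sgn (at τ (toℕ i))) ≡ sgn (sumℕ τ)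
  Π-sgn []      refl = refl
  Π-sgn (y ∷ τ) refl = trans (cong (sgn y *_) (Π-sgn τ refl)) (sym (sgn-+ y (sumℕ τ)))

  Mtilde-E : ∀ k σ τ → length τ ≡ k → Mtilde k σ τ ≡ E k (δ+ (idx σ)) (δ+ (idx τ))
  Mtilde-E k σ τ len = begin
    sgn (sumℕ τ) * det n (Mmat k σ τ)
      -- With zero remainders, `triangular` just extracts one scalar from each row.
      ≡⟨ cong (sgn (sumℕ τ) *_) (triangular (det-multilinear n) g (λ _ _ → 0ℚ) (Mmat k σ τ) t rows
           (λ r A _ h → zero-row (det-multilinear n) {A} r h)) ⟩
    sgn (sumℕ τ) * (Π t * det n g)
      ≡⟨ cong (λ p → sgn (sumℕ τ) * (p * det n g)) (trans (Π-++ {k} {k} (λ _ → 1ℚ) (λ i → sgn (at τ (toℕ i))))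
           (trans (cong₂ _*_ (Π-1 {k}) (Π-sgn τ len)) (ℚP.*-identityˡ (sgn (sumℕ τ))))) ⟩
    sgn (sumℕ τ) * (sgn (sumℕ τ) * det n g)
      ≡⟨ ℚP.*-assoc (sgn (sumℕ τ)) (sgn (sumℕ τ)) (det n g) ⟨
    sgn (sumℕ τ) * sgn (sumℕ τ) * det n g
      ≡⟨ trans (cong (_* det n g) (sgn-square (sumℕ τ))) (ℚP.*-identityˡ (det n g)) ⟩
    det n g ∎
    where
    n = k ℕ.+ k
    g : Matrix n n
    g = coefRows 1ℚ (δ+ {k} (idx σ)) ++ᶠ coefRows (- 1ℚ) (δ+ {k} (idx τ))
    t : Fin n → ℚ
    t = (λ (i : Fin k) → 1ℚ) ++ᶠ (λ (i : Fin k) → sgn (at τ (toℕ i)))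
    ring : ∀ a → a ≡ 1ℚ * a + 0ℚ
    ring = solve-∀ ℚ-ring
    rows : ∀ r j → Mmat k σ τ r j ≡ t r * g r j + 0ℚ
    rows r j with splitAt k r
    ... | inj₁ i = trans (entry k i j (at σ (toℕ i))) (ring (coefRow 1ℚ (δ+ {k} (idx σ) i) j))
    ... | inj₂ i = trans (signed-entry k i j (at τ (toℕ i))) (sym (ℚP.+-identityʳ _))

  -- From `N` to `Φ` and the degree bound

  sumℚ-++ : ∀ xs ys → sumℚ (xs ++ ys) ≡ sumℚ xs + sumℚ ys
  sumℚ-++ []       ys = sym (ℚP.+-identityˡ (sumℚ ys))
  sumℚ-++ (x ∷ xs) ys = trans (cong (x +_) (sumℚ-++ xs ys)) (sym (ℚP.+-assoc x (sumℚ xs) (sumℚ ys)))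

  sumℚ-map : ∀ {A : Set} (f : A → ℚ) xs → sumℚ (map f xs) ≡ Σᴸ xs f
  sumℚ-map f []       = refl
  sumℚ-map f (x ∷ xs) = cong (f x +_) (sumℚ-map f xs)

  sumℚ-concatMap : ∀ {A : Set} (f : A → List ℚ) xs → sumℚ (concatMap f xs) ≡ Σᴸ xs (sumℚ ∘ f)
  sumℚ-concatMap f []       = refl
  sumℚ-concatMap f (x ∷ xs) = trans (sumℚ-++ (f x) (concatMap f xs)) (cong (sumℚ (f x) +_) (sumℚ-concatMap f xs))

  Φ≡Σ-rearr : ∀ k α β → AllPos α → AllPos β → length α ≤ k → length β ≤ k →
        Φ k α β [] ≡ ι (mult! α) * (ι (mult! β) * sumℚ (concatMap (λ σ → map (Mtilde k σ) (rearrangements (pad k β))) (rearrangements (pad k α))))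
  Φ≡Σ-rearr k α β ps qs lα lβ = begin
    Inj α (λ a → Inj β (λ b → E k (δ+ a) (δ+ b)))
      ≡⟨ Inj≡Σ-rearr α ps (λ {a} {a′} h → Inj-cong β (λ b → E-cong {k} {δ+ a} {δ+ a′} {δ+ b} {δ+ b} (λ x → cong (toℕ x ℕ.+_) (h x)) (λ _ → refl))) lα ⟩
    ι (mult! α) * Σ-rearr α (λ a → Inj β (λ b → E k (δ+ a) (δ+ b)))
      ≡⟨ cong (ι (mult! α) *_) (Σᴸ-cong Rα (λ σ → Inj≡Σ-rearr β {λ b → E k (δ+ (idx σ)) (δ+ b)} qs
           (λ {b} {b′} h → E-cong {k} {δ+ (idx σ)} {δ+ (idx σ)} {δ+ b} {δ+ b′} (λ _ → refl) (λ x → cong (toℕ x ℕ.+_) (h x))) lβ)) ⟩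
    ι (mult! α) * Σᴸ Rα (λ σ → ι (mult! β) * Σ-rearr β (λ b → E k (δ+ (idx σ)) (δ+ b)))
      ≡⟨ cong (ι (mult! α) *_) (Σᴸ-*ˡ (ι (mult! β)) Rα (λ σ → Σ-rearr β (λ b → E k (δ+ (idx σ)) (δ+ b)))) ⟩
    ι (mult! α) * (ι (mult! β) * Σᴸ Rα (λ σ → Σ-rearr β (λ b → E k (δ+ (idx σ)) (δ+ b))))
      ≡⟨ cong (λ s → ι (mult! α) * (ι (mult! β) * s)) (trans (Σᴸ-cong Rα (λ σ → trans
           (Σᴸ-cong-∈ Rβ (λ τ τ∈ → sym (Mtilde-E k σ τ (length-rearrangement {k} {β} τ lβ τ∈))))
           (sym (sumℚ-map (Mtilde k σ) Rβ)))) (sym (sumℚ-concatMap (λ σ → map (Mtilde k σ) Rβ) Rα))) ⟩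
    ι (mult! α) * (ι (mult! β) * sumℚ (concatMap (λ σ → map (Mtilde k σ) Rβ) Rα)) ∎
    where
    Rα = rearrangements (pad k α)
    Rβ = rearrangements (pad k β)

  -- The repetitions counted by `mult!` are divided out; these factors are the same for every k, so
  -- polynomiality and the degree bound carry over from `Φ`.
  N≡Φ : ∀ k α β → AllPos α → AllPos β → length α ≤ k → length β ≤ k →
        N k α β ≡ recip (mult! α) {{mult!≢0 α}} * (recip (mult! β) {{mult!≢0 β}} * scaled (sumℕ α ℕ.+ sumℕ β) k (Φ k α β []))
  N≡Φ k α β ps qs lα lβ = begin
    twoFactor k r * invProd k * s
      ≡⟨ cong (_* s) (trans (twoFactor-norm k r) (cong (_* norm k) (ι-2^ r))) ⟩
    pw 2ℚ r * norm k * s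
      ≡⟨ ring₁ (pw 2ℚ r * norm k) s ⟩
    1ℚ * (1ℚ * (pw 2ℚ r * norm k * s))
      ≡⟨ cong₂ (λ x y → x * (y * (pw 2ℚ r * norm k * s))) (recip-*ι (mult! α) {{mult!≢0 α}}) (recip-*ι (mult! β) {{mult!≢0 β}}) ⟨
    (a * ι (mult! α)) * ((b * ι (mult! β)) * (pw 2ℚ r * norm k * s))
      ≡⟨ ring₂ a (ι (mult! α)) b (ι (mult! β)) (pw 2ℚ r) (norm k) s ⟩
    a * (b * scaled r k (ι (mult! α) * (ι (mult! β) * s)))
      ≡⟨ cong (λ x → a * (b * scaled r k x)) (Φ≡Σ-rearr k α β ps qs lα lβ) ⟨
    a * (b * scaled r k (Φ k α β [])) ∎
    where
    r = sumℕ α ℕ.+ sumℕ β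
    a = recip (mult! α) {{mult!≢0 α}}
    b = recip (mult! β) {{mult!≢0 β}}
    s = sumℚ (concatMap (λ σ → map (Mtilde k σ) (rearrangements (pad k β))) (rearrangements (pad k α)))
    ring₁ : ∀ x s → x * s ≡ 1ℚ * (1ℚ * (x * s))
    ring₁ = solve-∀ ℚ-ring
    ring₂ : ∀ a x b y p q s → (a * x) * ((b * y) * (p * q * s)) ≡ a * (b * (p * (q * (x * (y * s)))))
    ring₂ = solve-∀ ℚ-ring

  N-poly : ∀ α β → AllPos α → AllPos β →
           Σ (List ℚ) (λ cs → length cs ≤ 1 ℕ.+ 2 ℕ.* (sumℕ α ℕ.+ sumℕ β) ×
             (∀ k → 1 ≤ k → length α ≤ k → length β ≤ k → N k α β ≡ evalPoly cs k))
  N-poly α β ps qs =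
    let cs , bound , value = poly-* (recip (mult! α) {{mult!≢0 α}}) (poly-* (recip (mult! β) {{mult!≢0 β}})
          (poly-Φ n (length β) α β [] refl ps qs [] (cong (sumℕ α ℕ.+_) (ℕP.+-identityʳ (sumℕ β)))))
    in cs , bound , λ k _ lα lβ → trans (N≡Φ k α β ps qs lα lβ) (value k)
    where n = sumℕ α ℕ.+ sumℕ β

open import Data.Nat using (ℕ; _≤_; _<_; _≥_; _+_; _*_)
open import Data.Rational using (ℚ)
open import Data.List using (List; length)
open import Data.List.Relation.Unary.All using (All)
open import Data.List.Relation.Unary.Linked using (Linked)
open import Data.Product using (Σ; _×_)
open import Relation.Binary.PropositionalEquality using (_≡_)

theorem2 : (α β : List ℕ) → Linked _≥_ α → Linked _≥_ β → All (0 <_) α → All (0 <_) β →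
    Σ (List ℚ) (λ cs → (length cs ≤ 1 + 2 * (sumℕ α + sumℕ β)) ×
    ((k : ℕ) → 1 ≤ k → length α ≤ k → length β ≤ k → N k α β ≡ evalPoly cs k))
theorem2 α β _ _ α>0 β>0 = N-poly α β α>0 β>0
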